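{- For every positive integer $m$ let $\lambda_{2,m}=\{\{1,2\},\{3,4\},\ldots,\{2m-1,2m\}\}\in\mathrm{NC}(2m)$ and let $$\widetilde d_{2,m}:=\frac{1}{\mathrm{Cat}_{2m}}\sum_{\rho\in\mathrm{NC}(2m)}d_H(\lambda_{2,m},\rho).$$ Then $$\widetilde d_{2,m}=\frac{2^{2m-1}\binom{2m}{m}}{\mathrm{Cat}_{2m}}-\frac32 ,$$ and consequently $$\lim_{m\to\infty}\bigl(\widetilde d_{2,m}-\sqrt2\,m\bigr)=\frac{7\sqrt2}{16}-\frac32 .$$
   Context: For a positive integer $n$, a partition $\pi$ of $\{1,\ldots,n\}$ is non-crossing if there are no two distinct blocks $V,W$ of $\pi$ and numbers $a<b<c<d$ with $a,c\in V$ and $b,d\in W$. $\mathrm{NC}(n)$ is the set of non-crossing partitions of $\{1,\ldots,n\}$, partially ordered by $\pi\le\rho$ iff every block of $\pi$ is contained in a block of $\rho$. The Hasse diagram $\mathcal{H}_n$ is the undirected graph with vertex set $\mathrm{NC}(n)$ in which $\pi_1,\pi_2$ are joined by an edge iff one of them covers the other in $(\mathrm{NC}(n),\le)$; $d_H(\pi,\rho)$ is the graph distance in $\mathcal{H}_n$. $\mathrm{Cat}_n=\frac{(2n)!}{n!(n+1)!}=|\mathrm{NC}(n)|$ is the $n$th Catalan number. -}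

module Defs where

module NonCrossingPartitions where

  open import Data.Bool using (true; false)
  open import Data.Bool.Properties using (T-≡)
  open import Data.Fin using (Fin; toℕ; _<_; _<?_)
  open import Data.Fin.Properties using (all?; any?; <-trans; <-irrefl)
  open import Data.Fin.Subset using (Subset; _∈_; _⊆_; ∣_∣; ⁅_⁆; inside; outside)
  open import Data.Fin.Subset.Properties
    using (_∈?_; _⊆?_; ⊆-refl; ⊆-trans; x∈⁅x⁆; x∈⁅y⁆⇒x≡y; p⊆q⇒∣p∣≤∣q∣; drop-∷-⊆)
  open import Data.List using (List; []; _∷_; cartesianProductWith; mapMaybe)
  open import Data.List.Membership.Propositional using () renaming (_∈_ to _∈ᴸ_)
  open import Data.List.Membership.Propositional.Properties
    using (∈-cartesianProductWith⁺)
  open import Data.List.Relation.Unary.All using (All; []; _∷_)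
  open import Data.List.Relation.Unary.AllPairs using ([]; _∷_)
  open import Data.List.Relation.Unary.Any as Any using (here; there)
  open import Data.List.Relation.Unary.Unique.Propositional using (Unique)
  open import Data.List.Relation.Unary.Unique.Propositional.Properties
    using (cartesianProductWith⁺)
  open import Data.Maybe using (Maybe; just; nothing)
  open import Data.Nat as ℕ using (ℕ; zero; suc; _+_; _*_; _≤_; z≤n; s≤s; ⌊_/2⌋)
  import Data.Nat.Properties as ℕ
  open import Data.Product using (∃; ∃-syntax; _×_; _,_; proj₁; proj₂)
  open import Data.Sum using (_⊎_; inj₁; inj₂; swap)
  open import Data.Vec using (Vec; []; _∷_; lookup; tabulate; here)
  open import Data.Vec.Properties
    using (≡-dec; ∷-injective; lookup∘tabulate; lookup⇒[]=; []=⇒lookup; tabulate-cong)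
  import Data.Bool.Properties as Bool
  open import Function using (_∘_; Equivalence)
  open import Relation.Binary.Definitions using (DecidableEquality)
  open import Relation.Binary.PropositionalEquality
    using (_≡_; _≢_; refl; sym; trans; cong; cong₂; subst)
  open import Relation.Nullary using (¬_; Dec; yes; no; contradiction; recompute)
  open import Relation.Nullary.Decidable using (map′; _×-dec_; _⊎-dec_; ¬?; _→-dec_)

  private
    variable
      n : ℕ

  -- A partition of {1,…,n} (here Fin n, so shifted to {0,…,n-1}) is stored as
  -- the table B sending each point to the block that contains it.  Thus the
  -- blocks are the entries of B, and every partition has exactly one table.
  -- The value n = 0 is allowed and gives the single empty partition.
  BlockTable : ℕ → Set
  BlockTable n = Vec (Subset n) n

  IsPartition : BlockTable n → Set
  IsPartition B =
    ∀ i → i ∈ lookup B i × (∀ j → j ∈ lookup B i → lookup B j ≡ lookup B i)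

  Crossing : Subset n → Subset n → Set
  Crossing V W = ∃[ a ] ∃[ b ] ∃[ c ] ∃[ d ]
    (a < b × b < c × c < d) × (a ∈ V × c ∈ V) × (b ∈ W × d ∈ W)

  IsNonCrossing : BlockTable n → Set
  IsNonCrossing B = ∀ i j → lookup B i ≢ lookup B j → ¬ Crossing (lookup B i) (lookup B j)

  -- The proof field is irrelevant, so equality in NC n is equality of partitions.
  record NC (n : ℕ) : Set where
    constructor mkNC
    field
      table : BlockTable n
      .isNC : IsPartition table × IsNonCrossing table

    block : Fin n → Subset n
    block = lookup table

  open NC public

  infix 4 _⊑_ _⊏_ _⋖_ _∼_

  _⊑_ : NC n → NC n → Set
  π ⊑ ρ = ∀ i → ∃[ j ] block π i ⊆ block ρ j

  _⊏_ : NC n → NC n → Set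
  π ⊏ ρ = π ⊑ ρ × π ≢ ρ

  _⋖_ : NC n → NC n → Set
  π ⋖ ρ = π ⊏ ρ × ¬ (∃[ σ ] π ⊏ σ × σ ⊏ ρ)

  _∼_ : NC n → NC n → Set
  π ∼ ρ = π ⋖ ρ ⊎ ρ ⋖ π

  data Walk {n : ℕ} : ℕ → NC n → NC n → Set where
    nil  : ∀ {π} → Walk 0 π π
    cons : ∀ {k π σ ρ} → π ∼ σ → Walk k σ ρ → Walk (suc k) π ρ

  record IsDistance (π ρ : NC n) (d : ℕ) : Set where
    field
      walk    : Walk d π ρ
      minimal : ∀ k → Walk k π ρ → d ≤ k

  _≟ˢ_ : DecidableEquality (Subset n)
  _≟ˢ_ = ≡-dec Bool._≟_

  isPartition? : (B : BlockTable n) → Dec (IsPartition B)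
  isPartition? B = all? λ i → (i ∈? lookup B i) ×-dec
    (all? λ j → (j ∈? lookup B i) →-dec (lookup B j ≟ˢ lookup B i))

  crossing? : (V W : Subset n) → Dec (Crossing V W)
  crossing? V W = any? λ a → any? λ b → any? λ c → any? λ d →
    ((a <? b) ×-dec (b <? c) ×-dec (c <? d)) ×-dec
    ((a ∈? V) ×-dec (c ∈? V)) ×-dec ((b ∈? W) ×-dec (d ∈? W))

  isNonCrossing? : (B : BlockTable n) → Dec (IsNonCrossing B)
  isNonCrossing? B = all? λ i → all? λ j →
    ¬? (lookup B i ≟ˢ lookup B j) →-dec ¬? (crossing? (lookup B i) (lookup B j))

  isNC? : (B : BlockTable n) → Dec (IsPartition B × IsNonCrossing B)
  isNC? B = isPartition? B ×-dec isNonCrossing? B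

  isNC! : (π : NC n) → IsPartition (table π) × IsNonCrossing (table π)
  isNC! (mkNC B p) = recompute (isNC? B) p

  NC-≡ : {π ρ : NC n} → table π ≡ table ρ → π ≡ ρ
  NC-≡ refl = refl

  _≟_ : DecidableEquality (NC n)
  π ≟ ρ = map′ NC-≡ (cong table) (≡-dec _≟ˢ_ (table π) (table ρ))

  vectors : ∀ {A : Set} → List A → ∀ n → List (Vec A n)
  vectors xs zero    = [] ∷ []
  vectors xs (suc n) = cartesianProductWith _∷_ xs (vectors xs n)

  subsets : ∀ n → List (Subset n)
  subsets = vectors (outside ∷ inside ∷ [])

  toNC : BlockTable n → Maybe (NC n)
  toNC B with isNC? B
  ... | yes p = just (mkNC B p)
  ... | no  _ = nothing

  -- Lists every element of NC n exactly once: see allNC-complete, allNC-unique.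
  allNC : ∀ n → List (NC n)
  allNC n = mapMaybe toNC (vectors (subsets n) n)

  private
    vectors-complete : ∀ {A : Set} {xs : List A} → (∀ x → x ∈ᴸ xs) →
                       (v : Vec A n) → v ∈ᴸ vectors xs n
    vectors-complete h []      = here refl
    vectors-complete h (x ∷ v) = ∈-cartesianProductWith⁺ _∷_ (h x) (vectors-complete h v)

    subsets-complete : (p : Subset n) → p ∈ᴸ subsets n
    subsets-complete = vectors-complete λ where
      false → here refl
      true  → there (here refl)

    vectors-unique : ∀ {A : Set} {xs : List A} → Unique xs → ∀ n → Unique (vectors xs n)
    vectors-unique u zero    = [] ∷ []
    vectors-unique u (suc n) = cartesianProductWith⁺ _∷_ ∷-injective u (vectors-unique u n)

    ∈-mapMaybe-toNC : (π : NC n) (Bs : List (BlockTable n)) →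
                      table π ∈ᴸ Bs → π ∈ᴸ mapMaybe toNC Bs
    ∈-mapMaybe-toNC π (B ∷ Bs) h with isNC? B | h
    ... | yes _ | here eq = here (NC-≡ eq)
    ... | no ¬p | here eq = contradiction (subst (λ B → IsPartition B × IsNonCrossing B) eq (isNC! π)) ¬p
    ... | yes _ | there h = there (∈-mapMaybe-toNC π Bs h)
    ... | no  _ | there h = ∈-mapMaybe-toNC π Bs h

    mapMaybe-toNC-All : {B : BlockTable n} (Bs : List (BlockTable n)) → All (B ≢_) Bs →
                        All (λ π → B ≢ table π) (mapMaybe toNC Bs)
    mapMaybe-toNC-All []       []       = []
    mapMaybe-toNC-All (B ∷ Bs) (h ∷ hs) with isNC? B
    ... | yes _ = h ∷ mapMaybe-toNC-All Bs hs
    ... | no  _ = mapMaybe-toNC-All Bs hs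

    All-NC : {π : NC n} (ρs : List (NC n)) → All (λ ρ → table π ≢ table ρ) ρs → All (π ≢_) ρs
    All-NC []       []       = []
    All-NC (ρ ∷ ρs) (h ∷ hs) = (h ∘ cong table) ∷ All-NC ρs hs

    mapMaybe-toNC-unique : (Bs : List (BlockTable n)) → Unique Bs → Unique (mapMaybe toNC Bs)
    mapMaybe-toNC-unique []       []       = []
    mapMaybe-toNC-unique (B ∷ Bs) (h ∷ hs) with isNC? B
    ... | yes _ = All-NC _ (mapMaybe-toNC-All Bs h) ∷ mapMaybe-toNC-unique Bs hs
    ... | no  _ = mapMaybe-toNC-unique Bs hs

  allNC-complete : (π : NC n) → π ∈ᴸ allNC n
  allNC-complete {n} π =
    ∈-mapMaybe-toNC π (vectors (subsets n) n) (vectors-complete subsets-complete (table π))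

  allNC-unique : ∀ n → Unique (allNC n)
  allNC-unique n = mapMaybe-toNC-unique _
    (vectors-unique (vectors-unique (((λ ()) ∷ []) ∷ [] ∷ []) n) n)

  anyNC? : {P : NC n → Set} → (∀ π → Dec (P π)) → Dec (∃ P)
  anyNC? {n} P? = map′ Any.satisfied (λ (π , p) → Any.map (λ { refl → p }) (allNC-complete π))
                       (Any.any? P? (allNC n))

  _⊑?_ : (π ρ : NC n) → Dec (π ⊑ ρ)
  π ⊑? ρ = all? λ i → any? λ j → block π i ⊆? block ρ j

  _⊏?_ : (π ρ : NC n) → Dec (π ⊏ ρ)
  π ⊏? ρ = (π ⊑? ρ) ×-dec ¬? (π ≟ ρ)

  between? : (π ρ : NC n) → Dec (∃[ σ ] π ⊏ σ × σ ⊏ ρ)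
  between? π ρ = anyNC? λ σ → (π ⊏? σ) ×-dec (σ ⊏? ρ)

  _⋖?_ : (π ρ : NC n) → Dec (π ⋖ ρ)
  π ⋖? ρ = (π ⊏? ρ) ×-dec ¬? (between? π ρ)

  _∼?_ : (π ρ : NC n) → Dec (π ∼ ρ)
  π ∼? ρ = (π ⋖? ρ) ⊎-dec (ρ ⋖? π)

  walk? : ∀ k (π ρ : NC n) → Dec (Walk k π ρ)
  walk? zero    π ρ = map′ (λ { refl → nil }) (λ { nil → refl }) (π ≟ ρ)
  walk? (suc k) π ρ = map′ (λ (_ , e , w) → cons e w) (λ { (cons e w) → _ , e , w })
                           (anyNC? λ σ → (π ∼? σ) ×-dec walk? k σ ρ)

  ⊑⇒⊆ : {π ρ : NC n} → π ⊑ ρ → ∀ i → block π i ⊆ block ρ i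
  ⊑⇒⊆ {π = π} {ρ} h i with h i
  ... | j , s = subst (block π i ⊆_)
    (sym (proj₂ (proj₁ (isNC! ρ) j) i (s (proj₁ (proj₁ (isNC! π) i))))) s

  private
    ⊆-full : {p q : Subset n} → p ⊆ q → ∣ q ∣ ≤ ∣ p ∣ → p ≡ q
    ⊆-full {p = []}          {[]}          s h = refl
    ⊆-full {p = outside ∷ p} {outside ∷ q} s h = cong (outside ∷_) (⊆-full (drop-∷-⊆ s) h)
    ⊆-full {p = outside ∷ p} {inside  ∷ q} s h =
      contradiction (ℕ.≤-trans h (p⊆q⇒∣p∣≤∣q∣ {p = p} {q} (drop-∷-⊆ s))) ℕ.1+n≰n
    ⊆-full {p = inside  ∷ p} {outside ∷ q} s h = contradiction (s here) λ ()
    ⊆-full {p = inside  ∷ p} {inside  ∷ q} s (s≤s h) = cong (inside ∷_) (⊆-full (drop-∷-⊆ s) h)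

    total : ∀ {k} → Vec (Subset n) k → ℕ
    total []       = 0
    total (p ∷ ps) = ∣ p ∣ + total ps

    total-mono : ∀ {k} (ps qs : Vec (Subset n) k) →
                 (∀ i → lookup ps i ⊆ lookup qs i) → total ps ≤ total qs
    total-mono []       []       h = z≤n
    total-mono (p ∷ ps) (q ∷ qs) h =
      ℕ.+-mono-≤ (p⊆q⇒∣p∣≤∣q∣ (h Fin.zero)) (total-mono ps qs (h ∘ Fin.suc))

    total-full : ∀ {k} (ps qs : Vec (Subset n) k) → (∀ i → lookup ps i ⊆ lookup qs i) →
                 total qs ≤ total ps → ps ≡ qs
    total-full []       []       h le = refl
    total-full (p ∷ ps) (q ∷ qs) h le = cong₂ _∷_
      (⊆-full (h Fin.zero) (ℕ.+-cancelʳ-≤ (total qs) ∣ q ∣ ∣ p ∣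
        (ℕ.≤-trans le (ℕ.+-monoʳ-≤ ∣ p ∣ (total-mono ps qs (h ∘ Fin.suc))))))
      (total-full ps qs (h ∘ Fin.suc) (ℕ.+-cancelˡ-≤ ∣ q ∣ (total qs) (total ps)
        (ℕ.≤-trans le (ℕ.+-monoˡ-≤ (total ps) (p⊆q⇒∣p∣≤∣q∣ (h Fin.zero))))))

    size : NC n → ℕ
    size π = total (table π)

    ⊏⇒size< : {π ρ : NC n} → π ⊏ ρ → size π ℕ.< size ρ
    ⊏⇒size< {π = π} {ρ} (le , ne) with size ρ ℕ.≤? size π
    ... | yes h = contradiction (NC-≡ (total-full (table π) (table ρ) (⊑⇒⊆ {π = π} {ρ} le) h)) ne
    ... | no ¬h = ℕ.≰⇒> ¬h

  ⊑-trans : {π ρ σ : NC n} → π ⊑ ρ → ρ ⊑ σ → π ⊑ σ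
  ⊑-trans h g i = let j , s = h i ; k , t = g j in k , ⊆-trans s t

  ⊑-antisym : {π ρ : NC n} → π ⊑ ρ → ρ ⊑ π → π ≡ ρ
  ⊑-antisym {π = π} {ρ} h g = NC-≡ (total-full (table π) (table ρ) (⊑⇒⊆ {π = π} {ρ} h)
    (total-mono (table ρ) (table π) (⊑⇒⊆ {π = ρ} {π} g)))

  _++ʷ_ : ∀ {k l} {π ρ σ : NC n} → Walk k π ρ → Walk l ρ σ → Walk (k + l) π σ
  nil      ++ʷ w = w
  cons e v ++ʷ w = cons e (v ++ʷ w)

  reverseʷ : ∀ {k} {π ρ : NC n} → Walk k π ρ → Walk k ρ π
  reverseʷ nil                = nil
  reverseʷ (cons {k} {π} {σ} {ρ} e w) =
    subst (λ l → Walk l ρ π) (ℕ.+-comm k 1) (reverseʷ w ++ʷ cons (swap e) nil)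

  private
    climb : ∀ fuel (π ρ : NC n) → π ⊏ ρ → size ρ ≤ size π + fuel → ∃[ k ] Walk k π ρ
    climb zero π ρ lt h = contradiction
      (ℕ.<-≤-trans (⊏⇒size< {π = π} {ρ} lt) (subst (size ρ ≤_) (ℕ.+-identityʳ _) h)) (ℕ.<-irrefl refl)
    climb (suc f) π ρ lt h with between? π ρ
    ... | no ¬b = 1 , cons (inj₁ (lt , ¬b)) nil
    ... | yes (σ , πσ , σρ) =
      let k , v = climb f π σ πσ (ℕ.s≤s⁻¹ (ℕ.≤-trans (⊏⇒size< {π = σ} {ρ} σρ)
                    (subst (size ρ ≤_) (ℕ.+-suc (size π) f) h)))
          l , w = climb f σ ρ σρ (ℕ.≤-trans (subst (size ρ ≤_) (ℕ.+-suc (size π) f) h)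
                    (ℕ.+-monoˡ-≤ f (⊏⇒size< {π = π} {σ} πσ)))
      in k + l , (v ++ʷ w)

    discrete : ∀ n → NC n
    discrete n = mkNC D (isP , isN)
      where
      D : BlockTable n
      D = tabulate ⁅_⁆
      D-lookup : ∀ i → lookup D i ≡ ⁅ i ⁆
      D-lookup = lookup∘tabulate ⁅_⁆
      mem : ∀ {i j} → j ∈ lookup D i → j ≡ i
      mem {i} {j} h = x∈⁅y⁆⇒x≡y i (subst (j ∈_) (D-lookup i) h)
      isP : IsPartition D
      isP i = subst (i ∈_) (sym (D-lookup i)) (x∈⁅x⁆ i) , λ j h → cong (lookup D) (mem h)
      isN : IsNonCrossing D
      isN i j _ (a , b , c , d , (ab , bc , _) , (aV , cV) , _) =
        <-irrefl (trans (mem aV) (sym (mem cV))) (<-trans ab bc)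

    discrete-⊑ : (π : NC n) → discrete n ⊑ π
    discrete-⊑ π i = i , λ {x} h → subst (_∈ block π i)
      (sym (x∈⁅y⁆⇒x≡y i (subst (x ∈_) (lookup∘tabulate ⁅_⁆ i) h))) (proj₁ (proj₁ (isNC! π) i))

    fromDiscrete : (π : NC n) → ∃[ k ] Walk k (discrete n) π
    fromDiscrete {n} π with discrete n ≟ π
    ... | yes refl = 0 , nil
    ... | no  ne   = climb (size π) (discrete n) π (discrete-⊑ π , ne) (ℕ.m≤n+m _ _)

  connected : (π ρ : NC n) → ∃[ k ] Walk k π ρ
  connected π ρ = let k , v = fromDiscrete π ; l , w = fromDiscrete ρ
                  in k + l , (reverseʷ v ++ʷ w)

  private
    least : {P : ℕ → Set} → (∀ k → Dec (P k)) → ∀ k → P k → ∃[ d ] P d × (∀ j → P j → d ≤ j)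
    least P? k p with P? 0
    ... | yes p₀ = 0 , p₀ , λ _ _ → z≤n
    least     P? zero    p | no ¬p₀ = contradiction p ¬p₀
    least {P} P? (suc k) p | no ¬p₀ with least (P? ∘ suc) k p
    ... | d , pd , min = suc d , pd , minimal
      where
      minimal : ∀ j → P j → suc d ≤ j
      minimal zero    q = contradiction q ¬p₀
      minimal (suc j) q = s≤s (min j q)

    shortest : (π ρ : NC n) → ∃[ d ] Walk d π ρ × (∀ k → Walk k π ρ → d ≤ k)
    shortest π ρ = let k , w = connected π ρ in least (λ k → walk? k π ρ) k w

  -- The least length of a walk; d-H-isDistance is its characterisation.
  d-H : NC n → NC n → ℕ
  d-H π ρ = proj₁ (shortest π ρ)

  d-H-isDistance : (π ρ : NC n) → IsDistance π ρ (d-H π ρ)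
  d-H-isDistance π ρ = record
    { walk    = proj₁ (proj₂ (shortest π ρ))
    ; minimal = proj₂ (proj₂ (shortest π ρ))
    }

  -- The pairing {{1,2},{3,4},…}: with points numbered from 0, the points i
  -- and j share a block iff ⌊ i /2⌋ ≡ ⌊ j /2⌋.
  pairTable : ∀ n → BlockTable n
  pairTable n = tabulate λ i → tabulate λ j → ⌊ toℕ i /2⌋ ℕ.≡ᵇ ⌊ toℕ j /2⌋

  private
    pairs⁻ : ∀ {i j : Fin n} → j ∈ lookup (pairTable n) i → ⌊ toℕ i /2⌋ ≡ ⌊ toℕ j /2⌋
    pairs⁻ {n} {i} {j} h = ℕ.≡ᵇ⇒≡ _ _ (Equivalence.from T-≡
      (trans (sym (lookup∘tabulate _ j))
        (trans (cong (λ v → lookup v j) (sym (lookup∘tabulate _ i))) ([]=⇒lookup h))))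

    pairs⁺ : ∀ {i j : Fin n} → ⌊ toℕ i /2⌋ ≡ ⌊ toℕ j /2⌋ → j ∈ lookup (pairTable n) i
    pairs⁺ {n} {i} {j} e = lookup⇒[]= j _
      (trans (cong (λ v → lookup v j) (lookup∘tabulate _ i))
        (trans (lookup∘tabulate _ j) (Equivalence.to T-≡ (ℕ.≡⇒≡ᵇ _ _ e))))

    pairs-block : ∀ {i j : Fin n} → ⌊ toℕ i /2⌋ ≡ ⌊ toℕ j /2⌋ →
                  lookup (pairTable n) i ≡ lookup (pairTable n) j
    pairs-block {n} {i} {j} e = trans (lookup∘tabulate _ i)
      (trans (tabulate-cong (λ k → cong (ℕ._≡ᵇ ⌊ toℕ k /2⌋) e)) (sym (lookup∘tabulate _ j)))

  pairTable-isNC : ∀ n → IsPartition (pairTable n) × IsNonCrossing (pairTable n)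
  pairTable-isNC n = (λ i → pairs⁺ {i = i} refl , λ j h → sym (pairs-block (pairs⁻ h))) ,
      λ i j ne (a , b , c , d , (ab , bc , _) , (aV , cV) , (bW , _)) → ne (pairs-block
        (trans (pairs⁻ aV) (trans
          (ℕ.≤-antisym (ℕ.⌊n/2⌋-mono (ℕ.<⇒≤ ab))
            (subst (⌊ toℕ b /2⌋ ≤_) (trans (sym (pairs⁻ cV)) (pairs⁻ aV)) (ℕ.⌊n/2⌋-mono (ℕ.<⇒≤ bc))))
          (sym (pairs⁻ bW)))))

  λ₂ : ∀ m → NC (2 * m)
  λ₂ m = mkNC (pairTable (2 * m)) (pairTable-isNC (2 * m))

open NonCrossingPartitions public

module Reals where

  open import Data.Integer as ℤ using (+_)
  import Data.Integer.Properties as ℤ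
  import Data.Integer.Solver as ℤSolver
  open import Data.Nat as ℕ using (ℕ; zero; suc)
  import Data.Nat.Properties as ℕ
  import Data.Nat.Solver as ℕSolver
  open import Data.Product using (∃-syntax; _×_; _,_; proj₁; proj₂)
  open import Data.Rational
  open import Data.Rational.Properties
  open import Data.Rational.Solver using (module +-*-Solver)
  open import Data.Rational.Unnormalised as ℚᵘ using (mkℚᵘ; *≡*; *≤*; *<*)
  import Data.Rational.Unnormalised.Properties as ℚᵘ
  open import Data.Sum using (inj₁; inj₂)
  open import Relation.Binary.PropositionalEquality
    using (_≡_; refl; sym; trans; cong; cong₂; subst; subst₂)
  open import Relation.Nullary using (yes; no; contradiction)

  IsCauchy : (ℕ → ℚ) → Set
  IsCauchy s = ∀ ε → 0ℚ < ε →
    ∃[ N ] (∀ m n → N ℕ.≤ m → N ℕ.≤ n → ∣ s m - s n ∣ < ε)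

  -- A real number is a Cauchy sequence of rationals; equality of reals is _≃ᴿ_.
  record ℝ : Set where
    constructor mkℝ
    field
      seq    : ℕ → ℚ
      cauchy : IsCauchy seq

  open ℝ public

  infix 4 _≃ᴿ_ _<ᴿ_

  _≃ᴿ_ : ℝ → ℝ → Set
  x ≃ᴿ y = ∀ ε → 0ℚ < ε → ∃[ N ] (∀ n → N ℕ.≤ n → ∣ seq x n - seq y n ∣ < ε)

  _<ᴿ_ : ℝ → ℝ → Set
  x <ᴿ y = ∃[ ε ] 0ℚ < ε × ∃[ N ] (∀ n → N ℕ.≤ n → seq x n + ε ≤ seq y n)

  private
    halve : ∀ {ε} → 0ℚ < ε → 0ℚ < ½ * ε
    halve {ε} h = subst (_< ½ * ε) (*-zeroʳ ½) (*-monoʳ-<-pos ½ h)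

    halves : ∀ ε → ½ * ε + ½ * ε ≡ ε
    halves ε = trans (sym (*-distribʳ-+ ε ½ ½)) (*-identityˡ ε)

    ∣∣-lub : ∀ {p r} → p ≤ r → - p ≤ r → ∣ p ∣ ≤ r
    ∣∣-lub {p} {r} h g with ∣p∣≡p∨∣p∣≡-p p
    ... | inj₁ e = subst (_≤ r) (sym e) h
    ... | inj₂ e = subst (_≤ r) (sym e) g

    ∣∣-sym : ∀ p q → ∣ p - q ∣ ≡ ∣ q - p ∣
    ∣∣-sym p q = trans (sym (∣-p∣≡∣p∣ (p - q)))
      (cong ∣_∣ (solve 2 (λ p q → :- (p :- q) := q :- p) refl p q))
      where open +-*-Solver

    ≤-shift : ∀ {p q r} → p ≤ r + q → p - q ≤ r
    ≤-shift {p} {q} {r} h = subst (p - q ≤_)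
      (solve 2 (λ r q → r :+ q :- q := r) refl r q) (+-monoˡ-≤ (- q) h)
      where open +-*-Solver

    ∣∣-triangle : ∀ p q → ∣ p ∣ ≤ ∣ p - q ∣ + ∣ q ∣
    ∣∣-triangle p q = subst (λ t → ∣ t ∣ ≤ ∣ p - q ∣ + ∣ q ∣)
      (solve 2 (λ p q → p :- q :+ q := p) refl p q) (∣p+q∣≤∣p∣+∣q∣ (p - q) q)
      where open +-*-Solver

    ∣∣-lipschitz : ∀ p q → ∣ ∣ p ∣ - ∣ q ∣ ∣ ≤ ∣ p - q ∣
    ∣∣-lipschitz p q = ∣∣-lub (≤-shift (∣∣-triangle p q))
      (subst₂ _≤_ (solve 2 (λ p q → q :- p := :- (p :- q)) refl ∣ p ∣ ∣ q ∣) (∣∣-sym q p)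
        (≤-shift (∣∣-triangle q p)))
      where open +-*-Solver

    +-cauchy : ∀ {s t} → IsCauchy s → IsCauchy t → IsCauchy (λ n → s n + t n)
    +-cauchy {s} {t} cs ct ε ε>0 =
      let M , f = cs (½ * ε) (halve ε>0)
          N , g = ct (½ * ε) (halve ε>0)
      in M ℕ.⊔ N , λ m n hm hn → begin-strict
        ∣ s m + t m - (s n + t n) ∣
          ≡⟨ cong ∣_∣ (solve 4 (λ a b c d → a :+ b :- (c :+ d) := (a :- c) :+ (b :- d))
                               refl (s m) (t m) (s n) (t n)) ⟩
        ∣ (s m - s n) + (t m - t n) ∣
          ≤⟨ ∣p+q∣≤∣p∣+∣q∣ (s m - s n) (t m - t n) ⟩
        ∣ s m - s n ∣ + ∣ t m - t n ∣
          <⟨ +-mono-< (f m n (ℕ.m⊔n≤o⇒m≤o M N hm) (ℕ.m⊔n≤o⇒m≤o M N hn))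
                      (g m n (ℕ.m⊔n≤o⇒n≤o M N hm) (ℕ.m⊔n≤o⇒n≤o M N hn)) ⟩
        ½ * ε + ½ * ε
          ≡⟨ halves ε ⟩
        ε ∎
      where
      open ≤-Reasoning
      open +-*-Solver

    neg-cauchy : ∀ {s} → IsCauchy s → IsCauchy (λ n → - s n)
    neg-cauchy {s} cs ε ε>0 = let N , f = cs ε ε>0 in N , λ m n hm hn →
      subst (_< ε) (trans (sym (∣-p∣≡∣p∣ (s m - s n)))
        (cong ∣_∣ (solve 2 (λ a b → :- (a :- b) := :- a :- (:- b)) refl (s m) (s n))))
        (f m n hm hn)
      where open +-*-Solver

    ∣∣-cauchy : ∀ {s} → IsCauchy s → IsCauchy (λ n → ∣ s n ∣)
    ∣∣-cauchy {s} cs ε ε>0 = let N , f = cs ε ε>0 in N , λ m n hm hn →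
      ≤-<-trans (∣∣-lipschitz (s m) (s n)) (f m n hm hn)

    const-cauchy : ∀ q → IsCauchy (λ _ → q)
    const-cauchy q ε ε>0 = 0 , λ _ _ _ _ →
      subst (_< ε) (sym (cong ∣_∣ (+-inverseʳ q))) ε>0

    bounded : ∀ {s} → IsCauchy s →
              ∃[ B ] 0ℚ < B × ∃[ N ] (∀ n → N ℕ.≤ n → ∣ s n ∣ ≤ B)
    bounded {s} cs with cs 1ℚ (positive⁻¹ 1ℚ)
    ... | N , f = 1ℚ + ∣ s N ∣
      , <-≤-trans (positive⁻¹ 1ℚ)
          (subst (_≤ 1ℚ + ∣ s N ∣) (+-identityʳ 1ℚ) (+-monoʳ-≤ 1ℚ (0≤∣p∣ (s N))))
      , N , λ n h → ≤-trans (∣∣-triangle (s n) (s N))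
          (+-monoˡ-≤ ∣ s N ∣ (<⇒≤ (f n N h ℕ.≤-refl)))

    *-estimate : ∀ a b c d {A B δ} → 0ℚ < A → 0ℚ < B → ∣ a ∣ ≤ A → ∣ d ∣ ≤ B →
                 ∣ a - c ∣ < δ → ∣ b - d ∣ < δ → ∣ a * b - c * d ∣ < δ * (A + B)
    *-estimate a b c d {A} {B} {δ} A>0 B>0 hA hB hac hbd = begin-strict
      ∣ a * b - c * d ∣
        ≡⟨ cong ∣_∣ (solve 4 (λ a b c d → a :* b :- c :* d := a :* (b :- d) :+ (a :- c) :* d)
                             refl a b c d) ⟩
      ∣ a * (b - d) + (a - c) * d ∣
        ≤⟨ ∣p+q∣≤∣p∣+∣q∣ (a * (b - d)) ((a - c) * d) ⟩
      ∣ a * (b - d) ∣ + ∣ (a - c) * d ∣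
        ≡⟨ cong₂ _+_ (∣p*q∣≡∣p∣*∣q∣ a (b - d)) (∣p*q∣≡∣p∣*∣q∣ (a - c) d) ⟩
      ∣ a ∣ * ∣ b - d ∣ + ∣ a - c ∣ * ∣ d ∣
        ≤⟨ +-mono-≤ (*-monoʳ-≤-nonNeg ∣ b - d ∣ {{∣-∣-nonNeg (b - d)}} hA)
                    (*-monoˡ-≤-nonNeg ∣ a - c ∣ {{∣-∣-nonNeg (a - c)}} hB) ⟩
      A * ∣ b - d ∣ + ∣ a - c ∣ * B
        <⟨ +-mono-< (*-monoʳ-<-pos A {{positive A>0}} hbd)
                    (*-monoˡ-<-pos B {{positive B>0}} hac) ⟩
      A * δ + δ * B
        ≡⟨ solve 3 (λ A B δ → A :* δ :+ δ :* B := δ :* (A :+ B)) refl A B δ ⟩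
      δ * (A + B) ∎
      where
      open ≤-Reasoning
      open +-*-Solver

    divide : ∀ {C ε} → 0ℚ < C → 0ℚ < ε → ∃[ δ ] 0ℚ < δ × δ * C ≡ ε
    divide {C} {ε} C>0 ε>0 = ε * 1/ C
      , subst (_< ε * 1/ C) (*-zeroˡ (1/ C)) (*-monoˡ-<-pos (1/ C) {{1/pos⇒pos C}} ε>0)
      , trans (*-assoc ε (1/ C) C) (trans (cong (ε *_) (*-inverseˡ C)) (*-identityʳ ε))
      where
      instance
        C-pos : Positive C
        C-pos = positive C>0
        C-nonZero : NonZero C
        C-nonZero = pos⇒nonZero C

    *-cauchy : ∀ {s t} → IsCauchy s → IsCauchy t → IsCauchy (λ n → s n * t n)
    *-cauchy {s} {t} cs ct ε ε>0 =
      let A , A>0 , K , a = bounded cs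
          B , B>0 , L , b = bounded ct
          δ , δ>0 , δC≡ε  = divide (+-mono-< A>0 B>0) ε>0
          M , f           = cs δ δ>0
          N , g           = ct δ δ>0
      in (K ℕ.⊔ L) ℕ.⊔ (M ℕ.⊔ N) , λ m n hm hn →
        let hm₁ = ℕ.m⊔n≤o⇒m≤o (K ℕ.⊔ L) (M ℕ.⊔ N) hm
            hm₂ = ℕ.m⊔n≤o⇒n≤o (K ℕ.⊔ L) (M ℕ.⊔ N) hm
            hn₁ = ℕ.m⊔n≤o⇒m≤o (K ℕ.⊔ L) (M ℕ.⊔ N) hn
            hn₂ = ℕ.m⊔n≤o⇒n≤o (K ℕ.⊔ L) (M ℕ.⊔ N) hn
        in subst (∣ s m * t m - s n * t n ∣ <_) δC≡ε
             (*-estimate (s m) (t m) (s n) (t n) A>0 B>0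
               (a m (ℕ.m⊔n≤o⇒m≤o K L hm₁)) (b n (ℕ.m⊔n≤o⇒n≤o K L hn₁))
               (f m n (ℕ.m⊔n≤o⇒m≤o M N hm₂) (ℕ.m⊔n≤o⇒m≤o M N hn₂))
               (g m n (ℕ.m⊔n≤o⇒n≤o M N hm₂) (ℕ.m⊔n≤o⇒n≤o M N hn₂)))

  infixl 6 _+ᴿ_ _-ᴿ_
  infixl 7 _*ᴿ_
  infix  8 -ᴿ_

  fromℚ : ℚ → ℝ
  fromℚ q = mkℝ (λ _ → q) (const-cauchy q)

  _+ᴿ_ : ℝ → ℝ → ℝ
  x +ᴿ y = mkℝ (λ n → seq x n + seq y n) (+-cauchy {seq x} {seq y} (cauchy x) (cauchy y))

  -ᴿ_ : ℝ → ℝ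
  -ᴿ x = mkℝ (λ n → - seq x n) (neg-cauchy {seq x} (cauchy x))

  _-ᴿ_ : ℝ → ℝ → ℝ
  x -ᴿ y = x +ᴿ (-ᴿ y)

  _*ᴿ_ : ℝ → ℝ → ℝ
  x *ᴿ y = mkℝ (λ n → seq x n * seq y n) (*-cauchy {seq x} {seq y} (cauchy x) (cauchy y))

  ∣_∣ᴿ : ℝ → ℝ
  ∣ x ∣ᴿ = mkℝ (λ n → ∣ seq x n ∣) (∣∣-cauchy {seq x} (cauchy x))

  infix 4 _⟶_

  _⟶_ : (ℕ → ℝ) → ℝ → Set
  x ⟶ L = ∀ ε → fromℚ 0ℚ <ᴿ ε → ∃[ N ] (∀ n → N ℕ.≤ n → ∣ x n -ᴿ L ∣ᴿ <ᴿ ε)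

  isqrt-step : ℕ → ℕ → ℕ
  isqrt-step n r with suc r ℕ.* suc r ℕ.≤? suc n
  ... | yes _ = suc r
  ... | no  _ = r

  isqrt : ℕ → ℕ
  isqrt zero    = zero
  isqrt (suc n) = isqrt-step n (isqrt n)

  isqrt-spec : ∀ n → isqrt n ℕ.* isqrt n ℕ.≤ n × n ℕ.< suc (isqrt n) ℕ.* suc (isqrt n)
  isqrt-spec zero    = ℕ.z≤n , ℕ.s≤s ℕ.z≤n
  isqrt-spec (suc n) = step (isqrt n) (isqrt-spec n)
    where
    step : ∀ r → r ℕ.* r ℕ.≤ n × n ℕ.< suc r ℕ.* suc r →
           let q = isqrt-step n r in q ℕ.* q ℕ.≤ suc n × suc n ℕ.< suc q ℕ.* suc q
    step r (lo , hi) with suc r ℕ.* suc r ℕ.≤? suc n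
    ... | yes h = h , ℕ.≤-<-trans hi (ℕ.*-mono-< (ℕ.n<1+n (suc r)) (ℕ.n<1+n (suc r)))
    ... | no ¬h = ℕ.m≤n⇒m≤1+n lo , ℕ.≰⇒> ¬h

  √2-num : ℕ → ℕ
  √2-num n = isqrt (2 ℕ.* (suc n ℕ.* suc n))

  √2-seq : ℕ → ℚ
  √2-seq n = + √2-num n / suc n

  private
    toℚᵘ-/ : ∀ i d → toℚᵘ (i / suc d) ℚᵘ.≃ mkℚᵘ i d
    toℚᵘ-/ i d = toℚᵘ-fromℚᵘ (mkℚᵘ i d)

    /-mono-≤ : ∀ a b c d → a ℕ.* suc d ℕ.≤ c ℕ.* suc b → + a / suc b ≤ + c / suc d
    /-mono-≤ a b c d h = toℚᵘ-cancel-≤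
      (ℚᵘ.≤-respˡ-≃ (ℚᵘ.≃-sym (toℚᵘ-/ (+ a) b)) (ℚᵘ.≤-respʳ-≃ (ℚᵘ.≃-sym (toℚᵘ-/ (+ c) d))
        (*≤* (subst₂ ℤ._≤_ (ℤ.pos-* a (suc d)) (ℤ.pos-* c (suc b)) (ℤ.+≤+ h)))))

    /-+ : ∀ a b d → + (a ℕ.+ b) / suc d ≡ + a / suc d + + b / suc d
    /-+ a b d = toℚᵘ-injective (ℚᵘ.≃-trans (toℚᵘ-/ (+ (a ℕ.+ b)) d)
      (ℚᵘ.≃-trans (*≡* (solve 3 (λ a b d → (a :+ b) :* (d :* d) := (a :* d :+ b :* d) :* d)
                                refl (+ a) (+ b) (+ suc d)))
        (ℚᵘ.≃-sym (ℚᵘ.≃-trans (toℚᵘ-homo-+ (+ a / suc d) (+ b / suc d))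
          (ℚᵘ.+-cong (toℚᵘ-/ (+ a) d) (toℚᵘ-/ (+ b) d))))))
      where open ℤSolver.+-*-Solver

    /-* : ∀ a d → (+ a / suc d) * (+ a / suc d) ≡ + (a ℕ.* a) / (suc d ℕ.* suc d)
    /-* a d = toℚᵘ-injective (ℚᵘ.≃-trans (toℚᵘ-homo-* (+ a / suc d) (+ a / suc d))
      (ℚᵘ.≃-trans (ℚᵘ.*-cong (toℚᵘ-/ (+ a) d) (toℚᵘ-/ (+ a) d))
        (ℚᵘ.≃-trans (*≡* (cong (ℤ._* + (suc d ℕ.* suc d)) (sym (ℤ.pos-* a a))))
          (ℚᵘ.≃-sym (toℚᵘ-/ (+ (a ℕ.* a)) (d ℕ.+ d ℕ.* suc d))))))

    archimedean : ∀ c ε → 0ℚ < ε → ∃[ N ] (∀ n → N ℕ.≤ n → + c / suc n < ε)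
    archimedean c ε@(mkℚ (+ zero) d _)  (*<* (ℤ.+<+ ()))
    archimedean c ε@(mkℚ (+ suc p) d _) ε>0 = c ℕ.* suc d , λ n h → toℚᵘ-cancel-<
      (ℚᵘ.<-respˡ-≃ (ℚᵘ.≃-sym (toℚᵘ-/ (+ c) n))
        (*<* (subst₂ ℤ._<_ (ℤ.pos-* c (suc d)) (ℤ.pos-* (suc p) (suc n))
          (ℤ.+<+ (ℕ.≤-<-trans h (ℕ.<-≤-trans (ℕ.n<1+n n) (ℕ.m≤m+n (suc n) (p ℕ.* suc n))))))))

    square-cancel-≤ : ∀ {a b} → a ℕ.* a ℕ.≤ b ℕ.* b → a ℕ.≤ b
    square-cancel-≤ {a} {b} h with a ℕ.≤? b
    ... | yes p = p
    ... | no ¬p = contradiction h (ℕ.<⇒≱ (ℕ.*-mono-< (ℕ.≰⇒> ¬p) (ℕ.≰⇒> ¬p)))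

    √2-cross : ∀ m n → √2-num m ℕ.* suc n ℕ.≤ suc (√2-num n) ℕ.* suc m
    √2-cross m n = square-cancel-≤ (begin
      k ℕ.* suc n ℕ.* (k ℕ.* suc n)
        ≡⟨ solve 2 (λ k n → k :* n :* (k :* n) := k :* k :* (n :* n)) refl k (suc n) ⟩
      k ℕ.* k ℕ.* (suc n ℕ.* suc n)
        ≤⟨ ℕ.*-monoˡ-≤ (suc n ℕ.* suc n) (proj₁ (isqrt-spec (2 ℕ.* (suc m ℕ.* suc m)))) ⟩
      2 ℕ.* (suc m ℕ.* suc m) ℕ.* (suc n ℕ.* suc n)
        ≡⟨ solve 2 (λ m n → con 2 :* m :* n := con 2 :* n :* m) refl
                   (suc m ℕ.* suc m) (suc n ℕ.* suc n) ⟩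
      2 ℕ.* (suc n ℕ.* suc n) ℕ.* (suc m ℕ.* suc m)
        ≤⟨ ℕ.*-monoˡ-≤ (suc m ℕ.* suc m) (ℕ.<⇒≤ (proj₂ (isqrt-spec (2 ℕ.* (suc n ℕ.* suc n))))) ⟩
      suc l ℕ.* suc l ℕ.* (suc m ℕ.* suc m)
        ≡⟨ solve 2 (λ l m → l :* l :* (m :* m) := l :* m :* (l :* m)) refl (suc l) (suc m) ⟩
      suc l ℕ.* suc m ℕ.* (suc l ℕ.* suc m) ∎)
      where
      open ℕ.≤-Reasoning
      open ℕSolver.+-*-Solver
      k l : ℕ
      k = √2-num m
      l = √2-num n

    √2-close : ∀ m n → √2-seq m - √2-seq n ≤ + 1 / suc n
    √2-close m n = ≤-shift (subst (√2-seq m ≤_) (/-+ 1 (√2-num n) n)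
      (/-mono-≤ (√2-num m) m (suc (√2-num n)) n (√2-cross m n)))

    √2-cauchy : IsCauchy √2-seq
    √2-cauchy ε ε>0 = let N , f = archimedean 1 ε ε>0 in N , λ m n hm hn →
      ∣∣-elim (√2-seq m - √2-seq n) (≤-<-trans (√2-close m n) (f n hn))
        (subst (_< ε) (solve 2 (λ a b → b :- a := :- (a :- b)) refl (√2-seq m) (√2-seq n))
          (≤-<-trans (√2-close n m) (f m hm)))
      where
      open +-*-Solver
      ∣∣-elim : ∀ p → p < ε → - p < ε → ∣ p ∣ < ε
      ∣∣-elim p h g with ∣p∣≡p∨∣p∣≡-p p
      ... | inj₁ e = subst (_< ε) (sym e) h
      ... | inj₂ e = subst (_< ε) (sym e) g

  -- √2 is the limit of ⌊ (n+1)√2 ⌋ / (n+1); √2-nonNeg and √2*√2≃2 below confirm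
  -- that it is the non-negative square root of 2.
  √2 : ℝ
  √2 = mkℝ √2-seq √2-cauchy

  √2-nonNeg : ∀ n → 0ℚ ≤ seq √2 n
  √2-nonNeg n = /-mono-≤ 0 0 (√2-num n) n ℕ.z≤n

  √2*√2≃2 : √2 *ᴿ √2 ≃ᴿ fromℚ (+ 2 / 1)
  √2*√2≃2 ε ε>0 = let N , f = archimedean 5 ε ε>0 in N , λ n h →
    ≤-<-trans (∣∣-lub (≤-trans (≤-shift {√2-seq n * √2-seq n} {+ 2 / 1} {0ℚ} (below n)) (0≤5/ n))
      (subst (_≤ + 5 / suc n)
        (solve 2 (λ a b → b :- a := :- (a :- b)) refl (√2-seq n * √2-seq n) (+ 2 / 1))
        (≤-shift (above n)))) (f n h)
    where
    open +-*-Solver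
    0≤5/ : ∀ n → 0ℚ ≤ + 5 / suc n
    0≤5/ n = /-mono-≤ 0 0 5 n ℕ.z≤n
    module _ (n : ℕ) where
      k S : ℕ
      k = √2-num n
      S = suc n ℕ.* suc n
      below : √2-seq n * √2-seq n ≤ 0ℚ + + 2 / 1
      below = subst (_≤ + 2 / 1) (sym (/-* k n))
        (/-mono-≤ (k ℕ.* k) (n ℕ.+ n ℕ.* suc n) 2 0
          (subst (ℕ._≤ 2 ℕ.* S) (sym (ℕ.*-identityʳ (k ℕ.* k))) (proj₁ (isqrt-spec (2 ℕ.* S)))))
      k≤2n : k ℕ.≤ 2 ℕ.* suc n
      k≤2n = square-cancel-≤ (ℕ.≤-trans (proj₁ (isqrt-spec (2 ℕ.* S)))
        (subst (2 ℕ.* S ℕ.≤_) (ℕsolve 1 (λ x → ℕcon 4 ℕ:* (x ℕ:* x) ℕ:= ℕcon 2 ℕ:* x ℕ:* (ℕcon 2 ℕ:* x)) refl (suc n))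
          (ℕ.*-monoˡ-≤ S {2} {4} (ℕ.s≤s (ℕ.s≤s ℕ.z≤n)))))
        where open ℕSolver.+-*-Solver renaming (solve to ℕsolve; con to ℕcon; _:*_ to _ℕ:*_; _:=_ to _ℕ:=_)
      error : ℕ
      error = suc (k ℕ.+ k)
      error≤ : error ℕ.≤ 5 ℕ.* suc n
      error≤ = ℕ.≤-trans (ℕ.+-mono-≤ {1} {suc n} (ℕ.s≤s ℕ.z≤n) (ℕ.+-mono-≤ k≤2n k≤2n))
        (ℕ.≤-reflexive (ℕsolve 1 (λ x → x ℕ:+ (ℕcon 2 ℕ:* x ℕ:+ ℕcon 2 ℕ:* x) ℕ:= ℕcon 5 ℕ:* x) refl (suc n)))
        where open ℕSolver.+-*-Solver renaming (solve to ℕsolve; con to ℕcon; _:*_ to _ℕ:*_; _:+_ to _ℕ:+_; _:=_ to _ℕ:=_)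
      square : suc k ℕ.* suc k ≡ error ℕ.+ k ℕ.* k
      square = ℕsolve 1 (λ x → (ℕcon 1 ℕ:+ x) ℕ:* (ℕcon 1 ℕ:+ x) ℕ:= ℕcon 1 ℕ:+ (x ℕ:+ x) ℕ:+ x ℕ:* x) refl k
        where open ℕSolver.+-*-Solver renaming (solve to ℕsolve; con to ℕcon; _:*_ to _ℕ:*_; _:+_ to _ℕ:+_; _:=_ to _ℕ:=_)
      above : + 2 / 1 ≤ + 5 / suc n + √2-seq n * √2-seq n
      above = ≤-trans
        (/-mono-≤ 2 0 (error ℕ.+ k ℕ.* k) (n ℕ.+ n ℕ.* suc n)
          (subst (2 ℕ.* S ℕ.≤_) (trans square (sym (ℕ.*-identityʳ (error ℕ.+ k ℕ.* k))))
            (ℕ.<⇒≤ (proj₂ (isqrt-spec (2 ℕ.* S))))))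
        (subst₂ _≤_ (sym (/-+ error (k ℕ.* k) (n ℕ.+ n ℕ.* suc n))) refl
          (+-mono-≤
            (/-mono-≤ error (n ℕ.+ n ℕ.* suc n) 5 n
              (subst (error ℕ.* suc n ℕ.≤_) (ℕ.*-assoc 5 (suc n) (suc n)) (ℕ.*-monoˡ-≤ (suc n) error≤)))
            (≤-reflexive (sym (/-* k n)))))

open Reals public

open import Data.Integer using (+_)
open import Data.List using (map)
open import Data.Nat using (ℕ; suc; _*_; _!)
open import Data.Nat.ListAction using (sum)
open import Data.Nat.Properties using (m*n≢0; _!≢0)
open import Data.Rational using (ℚ; NonZero; _/_; _÷_)
open import Data.Rational.Properties using (normalize-pos; pos⇒nonZero)

ℕ→ℚ : ℕ → ℚ
ℕ→ℚ n = + n / 1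

private
  denominator≢0 : ∀ n → Data.Nat.NonZero (n ! * suc n !)
  denominator≢0 n = m*n≢0 (n !) (suc n !) {{n !≢0}} {{suc n !≢0}}

Cat : ℕ → ℚ
Cat n = (+ ((2 * n) !) / (n ! * suc n !)) {{denominator≢0 n}}

Cat-nonZero : ∀ n → NonZero (Cat n)
Cat-nonZero n = pos⇒nonZero (Cat n)
  {{normalize-pos ((2 * n) !) (n ! * suc n !) {{denominator≢0 n}} {{(2 * n) !≢0}}}}

infixl 7 _÷Cat_

_÷Cat_ : ℚ → ℕ → ℚ
q ÷Cat n = (q ÷ Cat n) {{Cat-nonZero n}}

d̃₂ : ℕ → ℚ
d̃₂ m = ℕ→ℚ (sum (map (d-H (λ₂ m)) (allNC (2 * m)))) ÷Cat (2 * m)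

{-# OPTIONS --safe #-}

-- Positions are numbered from 0.  For a non-crossing partition ρ, the pairs
-- x, y for which (x, y] is a union of blocks of ρ form the Kreweras complement
-- K(ρ).  Let L be the number of blocks of ρ, and e the number of blocks of K(ρ)
-- with an odd element.  Passing to a cover merges two blocks of ρ and splits a
-- block of K(ρ), so L + 2e changes by 1 along every edge of the Hasse diagram.
-- It can be decreased all the way down to its value m + 2 at λ: merge the blocks
-- of 2i and 2i+1 for all i, which does not affect e, and then descend to λ.
-- Hence d(λ, ρ) = L + 2e - m - 2.
--
-- Non-crossing partitions are binary trees, with the blocks of ρ as the maximal
-- paths of left edges and those of K(ρ) as the maximal paths of right edges.
-- Let C = E + O be the Catalan series and its even and odd parts.  Cutting a path
-- of right edges after its last odd node shows that the series of e times E is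
-- the series counting odd nodes, which is X E′/2 in even degrees.  Since
-- E / √(1 - 16X²) = E + 2 X E′, the sum of e over the trees with 2m nodes is
-- 4ᵐ⁻¹ C(2m,m), while the sum of L is C(4m,2m)/2.
--
-- Let a = 2²ᵐ⁻¹ C(2m,m) / Cat₂ₘ.  Comparing two monotone multiples of
-- C(2n,n)² / 16ⁿ at n = m and n = 2m gives
-- 2(m + 7/16)² - 1/4 ≤ a² ≤ 2(m + 7/16)², so a - √2 (m + 7/16) tends to 0.

module Submission where

open import Defs

-- The factor 2 in L + 2e fits the two effects of a merge: L falls by 1 while e stays or grows by 1,
-- so the potential moves by -1 or +1. That e grows by at most 1 is seen by also counting the blocks
-- of the complement without odd elements: neither count can shrink, and together they gain exactly
-- one.
--
-- Cancelling a power series, or solving a linear system of them, always goes through one fact: a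
-- homogeneous linear system whose right side carries a factor X has only the zero solution. So a
-- predicted identity is proved by showing that the difference of its sides solves such a system, if
-- necessary together with a companion identity.
--
-- The constant 7/16 is 1/2 - 1/16. With b(n) = C(2n,n) one has a = (m + 1/2) 4ᵐ b(m) / b(2m), and
-- the expansion of b(n) beginning with 4ⁿ/√(πn) (1 - 1/(8n)) gives 4ᵐ b(m) / b(2m) = √2 (1 -
-- 1/(16m)) up to O(1/m²).

module Counting where

  open import Data.Nat hiding (_≟_)
  open import Data.Nat.Properties as ℕ hiding (_≟_)
  open import Data.Product using (∃-syntax; _×_; _,_; proj₁)
  open import Data.Sum using (inj₁; inj₂)
  open import Relation.Binary.PropositionalEquality
  open import Relation.Nullary using (¬_; Dec; yes; no; contradiction)
  open import Relation.Nullary.Decidable using (_×-dec_; ¬?)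

  -- Counting the solutions of decidable predicates below a bound.

  𝟙 : {A : Set} → Dec A → ℕ
  𝟙 (yes _) = 1
  𝟙 (no _)  = 0

  count : {P : ℕ → Set} → (∀ x → Dec (P x)) → ℕ → ℕ
  count P? zero    = 0
  count P? (suc n) = count P? n + 𝟙 (P? n)

  𝟙-mono : {A B : Set} (a : Dec A) (b : Dec B) → (A → B) → 𝟙 a ≤ 𝟙 b
  𝟙-mono (yes a) (yes b) f = ≤-refl
  𝟙-mono (yes a) (no ¬b) f = contradiction (f a) ¬b
  𝟙-mono (no ¬a) b       f = z≤n

  𝟙-cong : {A B : Set} (a : Dec A) (b : Dec B) → (A → B) → (B → A) → 𝟙 a ≡ 𝟙 b
  𝟙-cong a b f g = ≤-antisym (𝟙-mono a b f) (𝟙-mono b a g)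

  𝟙-yes : {A : Set} (a : Dec A) → A → 𝟙 a ≡ 1
  𝟙-yes (yes _) x = refl
  𝟙-yes (no ¬x) x = contradiction x ¬x

  𝟙-no : {A : Set} (a : Dec A) → ¬ A → 𝟙 a ≡ 0
  𝟙-no (yes x) ¬x = contradiction x ¬x
  𝟙-no (no _)  ¬x = refl

  count-++ : {P : ℕ → Set} (P? : ∀ x → Dec (P x)) → ∀ m n →
             count P? (m + n) ≡ count P? m + count (λ x → P? (m + x)) n
  count-++ P? m zero    = trans (cong (count P?) (+-identityʳ m)) (sym (+-identityʳ _))
  count-++ P? m (suc n) = trans (cong (count P?) (+-suc m n))
    (trans (cong (_+ 𝟙 (P? (m + n))) (count-++ P? m n)) (+-assoc (count P? m) _ _))

  module _ {P Q : ℕ → Set} (P? : ∀ x → Dec (P x)) (Q? : ∀ x → Dec (Q x)) where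

    count-mono : ∀ n → (∀ {x} → x < n → P x → Q x) → count P? n ≤ count Q? n
    count-mono zero    f = z≤n
    count-mono (suc n) f =
      +-mono-≤ (count-mono n (λ h → f (m<n⇒m<1+n h))) (𝟙-mono (P? n) (Q? n) (f ≤-refl))

    count-mono-< : ∀ n → (∀ {x} → x < n → P x → Q x) →
                   ∀ {x} → x < n → Q x → ¬ P x → count P? n < count Q? n
    count-mono-< (suc n) f {x} x<1+n q ¬p with m<1+n⇒m<n∨m≡n x<1+n
    ... | inj₁ x<n  = +-mono-<-≤ (count-mono-< n (λ h → f (m<n⇒m<1+n h)) x<n q ¬p)
                                 (𝟙-mono (P? n) (Q? n) (f ≤-refl))
    ... | inj₂ refl = +-mono-≤-< (count-mono n (λ h → f (m<n⇒m<1+n h)))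
      (subst₂ _<_ (sym (𝟙-no (P? n) ¬p)) (sym (𝟙-yes (Q? n) q)) (s≤s z≤n))

  module _ {P Q : ℕ → Set} (P? : ∀ x → Dec (P x)) (Q? : ∀ x → Dec (Q x)) where

    count-cong : ∀ n → (∀ {x} → x < n → P x → Q x) → (∀ {x} → x < n → Q x → P x) →
                 count P? n ≡ count Q? n
    count-cong n f g = ≤-antisym (count-mono P? Q? n f) (count-mono Q? P? n g)

    count-partition : ∀ n → count P? n ≡ count (λ x → P? x ×-dec Q? x) n
                                       + count (λ x → P? x ×-dec ¬? (Q? x)) n
    count-partition zero    = refl
    count-partition (suc n) = begin
      count P? n + 𝟙 (P? n)                          ≡⟨ cong₂ _+_ (count-partition n) point ⟩
      a + b + (𝟙 (P? n ×-dec Q? n) + 𝟙 (P? n ×-dec ¬? (Q? n)))  ≡⟨ interchange a b _ _ ⟩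
      (a + _) + (b + _)                              ∎
      where
      open ≡-Reasoning
      open import Algebra.Properties.CommutativeSemigroup +-commutativeSemigroup
        using (interchange)
      a b : ℕ
      a = count (λ x → P? x ×-dec Q? x) n
      b = count (λ x → P? x ×-dec ¬? (Q? x)) n
      point : 𝟙 (P? n) ≡ 𝟙 (P? n ×-dec Q? n) + 𝟙 (P? n ×-dec ¬? (Q? n))
      point with P? n | Q? n
      ... | yes _ | yes _ = refl
      ... | yes _ | no _  = refl
      ... | no _  | yes _ = refl
      ... | no _  | no _  = refl

  count-all : {P : ℕ → Set} (P? : ∀ x → Dec (P x)) → ∀ n → (∀ {x} → x < n → P x) → count P? n ≡ n
  count-all P? zero    f = refl
  count-all P? (suc n) f =
    trans (cong₂ _+_ (count-all P? n (λ h → f (m<n⇒m<1+n h))) (𝟙-yes (P? n) (f ≤-refl))) (+-comm n 1)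

  count-none : {P : ℕ → Set} (P? : ∀ x → Dec (P x)) → ∀ n → (∀ {x} → x < n → ¬ P x) → count P? n ≡ 0
  count-none P? zero    f = refl
  count-none P? (suc n) f =
    cong₂ _+_ (count-none P? n (λ h → f (m<n⇒m<1+n h))) (𝟙-no (P? n) (f ≤-refl))

  count-remove : {P : ℕ → Set} (P? : ∀ x → Dec (P x)) → ∀ n {y} → y < n → P y →
                 count P? n ≡ suc (count (λ x → P? x ×-dec ¬? (x ℕ.≟ y)) n)
  count-remove P? (suc n) {y} y<1+n p with m<1+n⇒m<n∨m≡n y<1+n
  ... | inj₁ y<n  = cong₂ _+_ (count-remove P? n y<n p)
    (𝟙-cong (P? n) (P? n ×-dec ¬? (n ℕ.≟ y)) (λ q → q , λ { refl → <-irrefl refl y<n }) proj₁)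
  ... | inj₂ refl = trans (+-comm (count P? n) _) (cong₂ _+_ (𝟙-yes (P? n) p)
    (trans (count-cong P? _ n (λ h q → q , λ { refl → <-irrefl refl h }) (λ _ → proj₁))
      (trans (sym (+-identityʳ _)) (cong (count (λ x → P? x ×-dec ¬? (x ℕ.≟ y)) n +_)
        (sym (𝟙-no (P? n ×-dec ¬? (n ℕ.≟ n)) (λ (_ , ne) → ne refl)))))))

  -- A pigeonhole principle: take the largest `x`, remove its partner from `Q`, and continue;
  -- injectivity keeps the partner from being used again. The matching is a relation since partners
  -- are found by searches.
  count-matching : {P Q : ℕ → Set} (P? : ∀ x → Dec (P x)) (Q? : ∀ x → Dec (Q x)) →
    (M : ℕ → ℕ → Set) → ∀ m n →
    (∀ {x} → x < m → P x → ∃[ y ] y < n × Q y × M x y) →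
    (∀ {x x′ y} → P x → P x′ → M x y → M x′ y → x ≡ x′) →
    count P? m ≤ count Q? n
  count-matching P? Q? M zero    n f inj = z≤n
  count-matching P? Q? M (suc m) n f inj with P? m
  ... | no ¬p = subst (_≤ count Q? n) (sym (+-identityʳ _))
    (count-matching P? Q? M m n (λ h → f (m<n⇒m<1+n h)) inj)
  ... | yes p with f ≤-refl p
  ...   | y , y<n , q , my = subst₂ _≤_ (+-comm 1 _) (sym (count-remove Q? n y<n q))
    (s≤s (count-matching P? _ M m n
      (λ h px → let z , z<n , qz , mz = f (m<n⇒m<1+n h) px in
        z , z<n , (qz , λ { refl → <-irrefl (inj px p mz my) h }) , mz) inj))

open Counting

-- Non-crossing partitions as equivalence relations, merging of blocks, and the Kreweras complement.

module Partitions where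

  open import Data.Bool using (true)
  open import Data.Empty using (⊥-elim)
  open import Data.Fin using (toℕ; fromℕ<)
  open import Data.Fin.Properties using (toℕ<n; toℕ-injective; toℕ-fromℕ<; any?)
  open import Data.Fin.Subset using (_∈_)
  open import Data.Fin.Subset.Properties using (_∈?_)
  open import Data.Nat hiding (_≟_)
  open import Data.Nat.Properties as ℕ hiding (_≟_)
  open import Data.Nat.Properties hiding (_≟_)
  open import Data.Product using (∃-syntax; _×_; _,_; proj₁; proj₂)
  open import Data.Sum using (_⊎_; inj₁; inj₂)
  open import Data.Unit using (⊤; tt)
  open import Data.Vec using (lookup; tabulate)
  open import Data.Vec.Properties using (lookup∘tabulate; lookup⇒[]=; []=⇒lookup; tabulate-cong)
  open import Function using (_∘_)
  open import Relation.Binary.Definitions using (tri<; tri≈; tri>)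
  open import Relation.Binary.PropositionalEquality as ≡ using (_≡_; refl; cong; subst; subst₂)
  open import Relation.Nullary using (¬_; Dec; yes; no; contradiction; does)
  open import Relation.Nullary.Decidable using (_×-dec_; _⊎-dec_; dec-true; _→-dec_; ¬?)

  -- Points are natural numbers and not elements of `Fin n`, so that the shifts `j + suc x` used for
  -- subtrees need no casts; `bound` confines the relation to the first `n` of them.
  record NCEquiv (n : ℕ) : Set₁ where
    no-eta-equality
    field
      rel      : ℕ → ℕ → Set
      rel?     : ∀ x y → Dec (rel x y)
      bound    : ∀ {x y} → rel x y → x < n
      ~-refl   : ∀ {x} → x < n → rel x x
      ~-sym    : ∀ {x y} → rel x y → rel y x
      ~-trans  : ∀ {x y z} → rel x y → rel y z → rel x z
      crossing : ∀ {a b c d} → a < b → b < c → c < d → rel a c → rel b d → rel a b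

    bound′ : ∀ {x y} → rel x y → y < n
    bound′ = bound ∘ ~-sym

  open NCEquiv public

  infix 4 _⊆ᴱ_ _≃ᴱ_

  _⊆ᴱ_ : ∀ {m n} → NCEquiv m → NCEquiv n → Set
  E ⊆ᴱ F = ∀ {x y} → rel E x y → rel F x y

  _≃ᴱ_ : ∀ {m n} → NCEquiv m → NCEquiv n → Set
  E ≃ᴱ F = E ⊆ᴱ F × F ⊆ᴱ E

  module _ {n : ℕ} (ρ : NC n) where

    private
      part : IsPartition (table ρ)
      part = proj₁ (isNC! ρ)

      block-≡ : ∀ {i j} → j ∈ block ρ i → block ρ j ≡ block ρ i
      block-≡ {i} h = proj₂ (part i) _ h

      SameBlock : ℕ → ℕ → Set
      SameBlock x y = ∃[ i ] ∃[ j ] toℕ i ≡ x × toℕ j ≡ y × j ∈ block ρ i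

      same-nc : ∀ {a b c d} → a < b → b < c → c < d → SameBlock a c → SameBlock b d → SameBlock a b
      same-nc ab bc cd (i , k , refl , refl , ki) (j , l , refl , refl , lj)
        with j ∈? block ρ i
      ... | yes h = i , j , refl , refl , h
      ... | no ¬h = contradiction
        (i , j , k , l , (ab , bc , cd) , (proj₁ (part i) , ki) , (proj₁ (part j) , lj))
        (proj₂ (isNC! ρ) i j λ e → ¬h (subst (j ∈_) (≡.sym e) (proj₁ (part j))))

    opaque
      toEquiv : NCEquiv n
      toEquiv = record
        { rel      = SameBlock
        ; rel?     = λ x y → any? λ i → any? λ j → (toℕ i ℕ.≟ x) ×-dec (toℕ j ℕ.≟ y) ×-dec (j ∈? block ρ i)
        ; bound    = λ { (i , _ , refl , _) → toℕ<n i }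
        ; ~-refl   = λ h → fromℕ< h , fromℕ< h , toℕ-fromℕ< h , toℕ-fromℕ< h , proj₁ (part _)
        ; ~-sym    = λ { (i , j , p , q , h) →
                       j , i , q , p , subst (i ∈_) (≡.sym (block-≡ h)) (proj₁ (part i)) }
        ; ~-trans  = λ { (i , j , refl , refl , h) (j′ , k , e , refl , g) →
                       i , k , refl , refl , subst (k ∈_)
                         (≡.trans (cong (block ρ) (toℕ-injective e)) (block-≡ h)) g }
        ; crossing = same-nc
        }

      toEquiv⁺ : ∀ {i j} → j ∈ block ρ i → rel toEquiv (toℕ i) (toℕ j)
      toEquiv⁺ {i} {j} h = i , j , refl , refl , h

      toEquiv⁻ : ∀ {i j} → rel toEquiv (toℕ i) (toℕ j) → j ∈ block ρ i
      toEquiv⁻ (_ , _ , p , q , h) =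
        subst₂ (λ i j → j ∈ block ρ i) (toℕ-injective p) (toℕ-injective q) h

  module _ {n : ℕ} (E : NCEquiv n) where

    private
      tab : BlockTable n
      tab = tabulate λ i → tabulate λ j → does (rel? E (toℕ i) (toℕ j))

      tab-lookup : ∀ i j → lookup (lookup tab i) j ≡ does (rel? E (toℕ i) (toℕ j))
      tab-lookup i j = ≡.trans (cong (λ v → lookup v j) (lookup∘tabulate _ i)) (lookup∘tabulate _ j)

      does⁻ : ∀ {A : Set} (a : Dec A) → does a ≡ true → A
      does⁻ (yes a) _ = a

      tab⁻ : ∀ {i j} → j ∈ lookup tab i → rel E (toℕ i) (toℕ j)
      tab⁻ {i} {j} h = does⁻ (rel? E _ _) (≡.trans (≡.sym (tab-lookup i j)) ([]=⇒lookup h))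

      tab⁺ : ∀ {i j} → rel E (toℕ i) (toℕ j) → j ∈ lookup tab i
      tab⁺ {i} {j} h = lookup⇒[]= j _ (≡.trans (tab-lookup i j) (dec-true (rel? E _ _) h))

      does-cong : ∀ {A B : Set} (a : Dec A) (b : Dec B) → (A → B) → (B → A) → does a ≡ does b
      does-cong (yes _) (yes _) f g = refl
      does-cong (yes a) (no ¬b) f g = contradiction (f a) ¬b
      does-cong (no ¬a) (yes b) f g = contradiction (g b) ¬a
      does-cong (no _)  (no _)  f g = refl

      tab-≡ : ∀ {i j} → rel E (toℕ i) (toℕ j) → lookup tab i ≡ lookup tab j
      tab-≡ {i} {j} h = ≡.trans (lookup∘tabulate _ i) (≡.trans
        (tabulate-cong λ k → does-cong (rel? E _ _) (rel? E _ _) (~-trans E (~-sym E h)) (~-trans E h))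
        (≡.sym (lookup∘tabulate _ j)))

    fromEquiv : NC n
    fromEquiv = mkNC tab
      ( (λ i → tab⁺ (~-refl E (toℕ<n i)) , λ j h → ≡.sym (tab-≡ (tab⁻ h)))
      , λ { i j ne (a , b , c , d , (ab , bc , cd) , (aV , cV) , (bW , dW)) →
            ne (tab-≡ (~-trans E (tab⁻ aV) (~-trans E
              (crossing E ab bc cd (~-trans E (~-sym E (tab⁻ aV)) (tab⁻ cV))
                                   (~-trans E (~-sym E (tab⁻ bW)) (tab⁻ dW)))
              (~-sym E (tab⁻ bW))))) } )

    opaque
      unfolding toEquiv

      toEquiv-fromEquiv : toEquiv fromEquiv ≃ᴱ E
      toEquiv-fromEquiv = (λ { (i , j , refl , refl , h) → tab⁻ h })
        , λ h → fromℕ< (bound E h) , fromℕ< (bound′ E h) , toℕ-fromℕ< _ , toℕ-fromℕ< _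
              , tab⁺ (subst₂ (rel E) (≡.sym (toℕ-fromℕ< _)) (≡.sym (toℕ-fromℕ< _)) h)

  opaque
    unfolding toEquiv

    ⊑⇒⊆ᴱ : ∀ {n} {π ρ : NC n} → π ⊑ ρ → toEquiv π ⊆ᴱ toEquiv ρ
    ⊑⇒⊆ᴱ {π = π} {ρ} h (i , j , p , q , ji) = i , j , p , q , ⊑⇒⊆ {π = π} {ρ} h i ji

  ⊆ᴱ⇒⊑ : ∀ {n} {π ρ : NC n} → toEquiv π ⊆ᴱ toEquiv ρ → π ⊑ ρ
  ⊆ᴱ⇒⊑ {π = π} {ρ} h i = i , λ ji → toEquiv⁻ ρ (h (toEquiv⁺ π ji))

  toEquiv-injective : ∀ {n} {π ρ : NC n} → toEquiv π ≃ᴱ toEquiv ρ → π ≡ ρ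
  toEquiv-injective {π = π} {ρ} (f , g) =
    ⊑-antisym {π = π} {ρ} (⊆ᴱ⇒⊑ {π = π} {ρ} f) (⊆ᴱ⇒⊑ {π = ρ} {π} g)

  -- The condition `gap` covers two situations: `a` and `b` are consecutive in a block of a coarser
  -- partition (`consecutive-gap`), or `a = 2i` and `b = 2i + 1`, where no `u` exists.
  module _ {n : ℕ} (E : NCEquiv n) {a b : ℕ} (a<n : a < n) (b<n : b < n) (a<b : a < b)
           (gap : ∀ {u v} → a < u → u < b → rel E u v → a ≤ v × v ≤ b) where

    private
      In : ℕ → Set
      In x = rel E a x ⊎ rel E b x

      Merged : ℕ → ℕ → Set
      Merged x y = rel E x y ⊎ (In x × In y)

      In-~ : ∀ {x y} → In x → rel E x y → In y
      In-~ (inj₁ h) g = inj₁ (~-trans E h g)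
      In-~ (inj₂ h) g = inj₂ (~-trans E h g)

      Between : ℕ → ℕ → ℕ → Set
      Between p r z = p < z × z < r

      Beyond : ℕ → ℕ → ℕ → Set
      Beyond p r z = z < p ⊎ r < z

      beyond⇒¬between : ∀ {p r w} → Beyond p r w → ¬ Between p r w
      beyond⇒¬between (inj₁ h) (g , _) = <⇒≯ h g
      beyond⇒¬between (inj₂ h) (_ , g) = <⇒≯ h g

      module _ {p r} (p~r : rel E p r) where

        -- The chord from `p` to `r` divides the other points into two sides, and a block different
        -- from that of `p` stays on one side.
        stays-between : ∀ {z w} → ¬ rel E w p → Between p r z → rel E z w → Between p r w
        stays-between {z} {w} ne (pz , zr) zw with <-cmp p w | <-cmp w r
        ... | tri< pw _ _   | tri< wr _ _   = pw , wr
        ... | tri< pw _ _   | tri≈ _ refl _ = contradiction (~-sym E p~r) ne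
        ... | tri< pw _ _   | tri> _ _ rw   =
          contradiction (~-trans E (~-sym E zw) (~-sym E (crossing E pz zr rw p~r zw))) ne
        ... | tri≈ _ refl _ | _             = contradiction (~-refl E (bound E p~r)) ne
        ... | tri> _ _ wp   | _             =
          contradiction (crossing E wp pz zr (~-sym E zw) p~r) ne

        stays-beyond : ∀ {z w} → ¬ rel E w p → Beyond p r z → rel E z w → Beyond p r w
        stays-beyond {z} {w} ne out zw with <-cmp p w | <-cmp w r
        ... | tri> _ _ wp   | _             = inj₁ wp
        ... | tri≈ _ refl _ | _             = contradiction (~-refl E (bound E p~r)) ne
        ... | tri< pw _ _   | tri> _ _ rw   = inj₂ rw
        ... | tri< pw _ _   | tri≈ _ refl _ = contradiction (~-sym E p~r) ne
        ... | tri< pw _ _   | tri< wr _ _   with out | stays-between {w} {z}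
        ...   | inj₁ zp | f = contradiction zp (<⇒≯ (proj₁ (f (λ h → ne (~-trans E (~-sym E zw) h)) (pw , wr) (~-sym E zw))))
        ...   | inj₂ rz | f = contradiction rz (<⇒≯ (proj₂ (f (λ h → ne (~-trans E (~-sym E zw) h)) (pw , wr) (~-sym E zw))))

        -- A block separating the blocks of a and b has a point strictly
        -- between a and b and another one outside, which the gap forbids.
        unseparated : ∀ {z w} → Between p r z → In z → Beyond p r w → In w → In p
        unseparated {z} {w} bz Iz bw Iw with rel? E a p | rel? E b p
        ... | yes h | _     = inj₁ h
        ... | no _  | yes h = inj₂ h
        ... | no ¬a | no ¬b with Iz | Iw
        ...   | inj₁ az | inj₁ aw = contradiction
          (stays-between {z} {w} (λ h → ¬a (~-trans E aw h)) bz (~-trans E (~-sym E az) aw)) (beyond⇒¬between bw)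
        ...   | inj₂ bz′ | inj₂ bw′ = contradiction
          (stays-between {z} {w} (λ h → ¬b (~-trans E bw′ h)) bz (~-trans E (~-sym E bz′) bw′)) (beyond⇒¬between bw)
        ...   | inj₁ az | inj₂ bw′ with stays-between ¬a bz (~-sym E az) | stays-beyond ¬b bw (~-sym E bw′)
        ...     | (pa , ar) | inj₁ bp = contradiction a<b (<⇒≯ (<-trans bp pa))
        ...     | (pa , ar) | inj₂ rb = contradiction (proj₁ (gap ar rb (~-sym E p~r))) (<⇒≱ pa)
        unseparated {z} {w} bz Iz bw Iw | no ¬a | no ¬b | inj₂ bz′ | inj₁ aw
          with stays-between ¬b bz (~-sym E bz′) | stays-beyond ¬a bw (~-sym E aw)
        ...     | (pb , br) | inj₁ ap = contradiction (proj₂ (gap ap pb p~r)) (<⇒≱ br)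
        ...     | (pb , br) | inj₂ ra = contradiction a<b (<⇒≯ (<-trans br ra))

      merged-nc : ∀ {p q r s} → p < q → q < r → r < s → Merged p r → Merged q s → Merged p q
      merged-nc pq qr rs (inj₁ pr)        (inj₁ qs)        = inj₁ (crossing E pq qr rs pr qs)
      merged-nc pq qr rs (inj₂ (Ip , _))  (inj₂ (Iq , _))  = inj₂ (Ip , Iq)
      merged-nc pq qr rs (inj₁ pr)        (inj₂ (Iq , Is)) =
        inj₂ (unseparated pr (pq , qr) Iq (inj₂ rs) Is , Iq)
      merged-nc pq qr rs (inj₂ (Ip , Ir)) (inj₁ qs)        =
        inj₂ (Ip , unseparated qs (qr , rs) Ir (inj₁ pq) Ip)

      merged-trans : ∀ {x y z} → Merged x y → Merged y z → Merged x z
      merged-trans (inj₁ h)        (inj₁ g)        = inj₁ (~-trans E h g)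
      merged-trans (inj₁ h)        (inj₂ (Iy , Iz)) = inj₂ (In-~ Iy (~-sym E h) , Iz)
      merged-trans (inj₂ (Ix , Iy)) (inj₁ g)        = inj₂ (Ix , In-~ Iy g)
      merged-trans (inj₂ (Ix , _)) (inj₂ (_ , Iz)) = inj₂ (Ix , Iz)

      In? : ∀ x → Dec (In x)
      In? x = rel? E a x ⊎-dec rel? E b x

      In-bound : ∀ {x} → In x → x < n
      In-bound (inj₁ h) = bound′ E h
      In-bound (inj₂ h) = bound′ E h

    merge : NCEquiv n
    merge = record
      { rel      = Merged
      ; rel?     = λ x y → rel? E x y ⊎-dec (In? x ×-dec In? y)
      ; bound    = λ { (inj₁ h) → bound E h ; (inj₂ (Ix , _)) → In-bound Ix }
      ; ~-refl   = inj₁ ∘ ~-refl E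
      ; ~-sym    = λ { (inj₁ h) → inj₁ (~-sym E h) ; (inj₂ (Ix , Iy)) → inj₂ (Iy , Ix) }
      ; ~-trans  = merged-trans
      ; crossing = merged-nc
      }

    ⊆-merge : E ⊆ᴱ merge
    ⊆-merge = inj₁

    merge-⊆ : ∀ {F : NCEquiv n} → E ⊆ᴱ F → rel F a b → merge ⊆ᴱ F
    merge-⊆ {F} f ab (inj₁ h) = f h
    merge-⊆ {F} f ab (inj₂ (Ix , Iy)) = ~-trans F (~-sym F (from-a Ix)) (from-a Iy)
      where
      from-a : ∀ {x} → In x → rel F a x
      from-a (inj₁ h) = f h
      from-a (inj₂ h) = ~-trans F ab (f h)

    merge-joins : rel merge a b
    merge-joins = inj₂ (inj₁ (~-refl E a<n) , inj₂ (~-refl E b<n))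

  module _ {n : ℕ} {E F : NCEquiv n} (E⊆F : E ⊆ᴱ F) where

    -- If `v` were outside, `F` would have crossing relations between `u`, `v` and `a`, `b`, which
    -- puts `u` into the block of `a` although no point of that block lies between `a` and `b`.
    consecutive-gap : ∀ {a b} → rel F a b → (∀ {w} → a < w → w < b → ¬ rel F a w) →
                      ∀ {u v} → a < u → u < b → rel E u v → a ≤ v × v ≤ b
    consecutive-gap {a} {b} ab none {u} {v} au ub uv = ≮⇒≥ left , ≮⇒≥ right
      where
      left : ¬ v < a
      left va = none au ub (~-trans F (~-sym F (crossing F va au ub (~-sym F (E⊆F uv)) ab))
                                      (~-sym F (E⊆F uv)))
      right : ¬ b < v
      right bv = none au ub (crossing F au ub bv ab (E⊆F uv))

    -- A point `w` of the block strictly between `a` and `b` cannot be related in `E` to both of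
    -- them, so one of the shorter pairs is still apart. The fuel bounds `b - a`.
    consecutive : ∀ fuel {a b} → b ≤ fuel + a → a < b → rel F a b → ¬ rel E a b →
      ∃[ a′ ] ∃[ b′ ] a′ < b′ × rel F a′ b′ × ¬ rel E a′ b′ × (∀ {w} → a′ < w → w < b′ → ¬ rel F a′ w)
    consecutive zero       b≤ a<b ab ¬ab = contradiction a<b (≤⇒≯ b≤)
    consecutive (suc fuel) {a} {b} b≤ a<b ab ¬ab
      with anyUpTo? (λ w → (suc a ≤? w) ×-dec rel? F a w) b
    ... | no none = a , b , a<b , ab , ¬ab , λ aw wb h → none (_ , wb , aw , h)
    ... | yes (w , wb , aw , h) with rel? E a w
    ...   | no ¬aw = consecutive fuel (≤-pred (≤-trans wb b≤)) aw h ¬aw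
    ...   | yes g  = consecutive fuel
              (≤-trans b≤ (subst (_≤ fuel + w) (+-suc fuel a) (+-monoʳ-≤ fuel aw)))
              wb (~-trans F (~-sym F h) ab) λ wb′ → ¬ab (~-trans E g wb′)

  module _ {Q : ℕ → Set} (Q? : ∀ x → Dec (Q x)) where

    least : ∀ {y} → Q y → ∃[ z ] z ≤ y × Q z × (∀ {w} → w < z → ¬ Q w)
    least {y} = search y ≤-refl
      where
      search : ∀ fuel {y} → y ≤ fuel → Q y → ∃[ z ] z ≤ y × Q z × (∀ {w} → w < z → ¬ Q w)
      search fuel {y} h q with anyUpTo? Q? y
      ... | no none = y , ≤-refl , q , λ wy qw → none (_ , wy , qw)
      search zero       {zero} h q | yes (_ , () , _)
      search (suc fuel) {y}    h q | yes (x , x<y , qx) =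
        let z , z≤x , rest = search fuel (≤-pred (≤-trans x<y h)) qx
        in z , ≤-trans z≤x (<⇒≤ x<y) , rest

    greatest : ∀ n {y} → y < n → Q y → ∃[ z ] z < n × Q z × (∀ {w} → w < n → z < w → ¬ Q w)
    greatest (suc n) {y} y<1+n q with Q? n
    ... | yes qn = n , ≤-refl , qn , λ w<1+n n<w _ → <⇒≱ n<w (≤-pred w<1+n)
    ... | no ¬qn with m<1+n⇒m<n∨m≡n y<1+n
    ...   | inj₂ refl = contradiction q ¬qn
    ...   | inj₁ y<n with greatest n y<n q
    ...     | z , z<n , qz , max = z , m<n⇒m<1+n z<n , qz , above
      where
      above : ∀ {w} → w < suc n → z < w → ¬ Q w
      above w<1+n z<w qw with m<1+n⇒m<n∨m≡n w<1+n
      ... | inj₁ w<n  = max w<n z<w qw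
      ... | inj₂ refl = ¬qn qw

  module _ {n : ℕ} (E : NCEquiv n) where

    First : ℕ → Set
    First x = ∀ {y} → y < x → ¬ rel E y x

    first? : ∀ x → Dec (First x)
    first? x = allUpTo? (λ y → ¬? (rel? E y x)) x

    opaque
      blocks : ℕ
      blocks = count first? n

    -- The half-open interval (x, y] is a union of blocks.  Regarding x as the
    -- gap after x, this says for x ≤ y that x and y are in the same block of
    -- the Kreweras complement; for x ≥ y the interval is empty.
    Saturated : ℕ → ℕ → Set
    Saturated x y = ∀ u v → rel E u v → x < u → u ≤ y → x < v × v ≤ y

    saturated? : ∀ x y → Dec (Saturated x y)
    saturated? x y
      with allUpTo? (λ u → allUpTo? (λ v → rel? E u v →-dec (x <? u →-dec (u ≤? y →-dec
        ((x <? v) ×-dec (v ≤? y))))) n) n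
    ... | yes f = yes λ u v h → f (bound E h) (bound′ E h) h
    ... | no ¬f = no λ s → ¬f λ {u} _ {v} _ → s u v

    module _ {P : ℕ → Set} (P? : ∀ x → Dec (P x)) where

      -- The last position with `P` in its block of the Kreweras complement; hence `lasts` counts
      -- the blocks of the complement that meet `P`. Only the interval from `x` to the later `y`
      -- matters, the reverse one being empty.
      Last : ℕ → Set
      Last x = P x × (∀ {y} → y < n → x < y → P y → ¬ Saturated x y)

      last? : ∀ x → Dec (Last x)
      last? x = P? x ×-dec allUpTo? (λ y → x <? y →-dec (P? y →-dec ¬? (saturated? x y))) n

      opaque
        lasts : ℕ
        lasts = count last? n

  ⊤? : ∀ (x : ℕ) → Dec ⊤
  ⊤? _ = yes tt

  module _ {n : ℕ} (E : NCEquiv n) where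

    infix 4 _≈_

    _≈_ : ℕ → ℕ → Set
    x ≈ y = Saturated E x y × Saturated E y x

    ≈-sym : ∀ {x y} → x ≈ y → y ≈ x
    ≈-sym (f , g) = g , f

    vacuous : ∀ {x y} → x ≤ y → Saturated E y x
    vacuous x≤y _ _ _ yu ux = contradiction (<-≤-trans yu (≤-trans ux x≤y)) (<-irrefl refl)

    private
      -- Depending on the order of the three positions, (x, z] is the union of (x, y] and (y, z], or
      -- a difference such as (x, y] minus (z, y]. Comparing `u` with `y` tells which interval to
      -- start from.
      sat-trans : ∀ {x y z} → x ≈ y → y ≈ z → Saturated E x z
      sat-trans {x} {y} {z} (xy , yx) (yz , zy) u v uv xu uz with u ≤? y
      sat-trans {x} {y} {z} (xy , yx) (yz , zy) u v uv xu uz | yes uy with v ≤? z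
      ... | yes vz = proj₁ (xy _ _ uv xu uy) , vz
      ... | no ¬vz = contradiction uz (<⇒≱ (proj₁ (zy _ _ (~-sym E uv) (≰⇒> ¬vz) (proj₂ (xy _ _ uv xu uy)))))
      sat-trans {x} {y} {z} (xy , yx) (yz , zy) u v uv xu uz | no ¬uy with x <? v
      ... | yes xv = xv , proj₂ (yz _ _ uv (≰⇒> ¬uy) uz)
      ... | no ¬xv = contradiction (proj₂ (yx _ _ (~-sym E uv) (proj₁ (yz _ _ uv (≰⇒> ¬uy) uz)) (≮⇒≥ ¬xv))) (<⇒≱ xu)

    ≈-trans : ∀ {x y z} → x ≈ y → y ≈ z → x ≈ z
    ≈-trans p q = sat-trans p q , sat-trans (≈-sym q) (≈-sym p)

    ≈-refl : ∀ {x} → x ≈ x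
    ≈-refl = vacuous ≤-refl , vacuous ≤-refl

    _≈?_ : ∀ x y → Dec (x ≈ y)
    x ≈? y = saturated? E x y ×-dec saturated? E y x

    module _ {P : ℕ → Set} (P? : ∀ x → Dec (P x)) where

      Avoids : ℕ → Set
      Avoids x = ∀ {y} → y < n → P y → ¬ x ≈ y

      avoids? : ∀ x → Dec (Avoids x)
      avoids? x = allUpTo? (λ y → P? y →-dec ¬? (x ≈? y)) n

      opaque
        -- The blocks of the complement that miss `P`, each counted by its last position. With
        -- `lasts E P?` they make up all blocks, and both numbers can only grow with the partition;
        -- this bounds the growth of `lasts` from above.
        avoiding : ℕ
        avoiding = count (λ x → last? E ⊤? x ×-dec avoids? x) n

      private
        Meets : ℕ → Set
        Meets x = Last E ⊤? x × ¬ Avoids x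

        meets? : ∀ x → Dec (Meets x)
        meets? x = last? E ⊤? x ×-dec ¬? (avoids? x)

        last-≤ : ∀ {x x′} → x < n → Last E P? x′ → P x → x ≈ x′ → x ≤ x′
        last-≤ {x} {x′} x<n (_ , l) px e with x ≤? x′
        ... | yes h = h
        ... | no ¬h = contradiction (proj₂ e) (l x<n (≰⇒> ¬h) px)

        to-last : ∀ {x} → x < n → Meets x → ∃[ y ] y < n × Last E P? y × (x < n × y < n × x ≈ y)
        to-last {x} x<n (_ , ¬av) with anyUpTo? (λ y → P? y ×-dec (x ≈? y)) n
        ... | no none = ⊥-elim (¬av λ y<n p e → none (_ , y<n , p , e))
        ... | yes (y , y<n , q) with greatest (λ y → P? y ×-dec (x ≈? y)) n y<n q
        ...   | z , z<n , (pz , xz) , max = z , z<n ,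
          (pz , λ w<n zw pw s → max w<n zw (pw , ≈-trans xz (s , vacuous (<⇒≤ zw)))) , x<n , z<n , xz

        from-last : ∀ {y} → y < n → Last E P? y → ∃[ x ] x < n × Meets x × (x < n × y < n × x ≈ y)
        from-last {y} y<n (py , _) with greatest (λ x → x ≈? y) n y<n ≈-refl
        ... | x , x<n , xy , max = x , x<n ,
          ( (tt , λ w<n xw _ s → max w<n xw (≈-trans (vacuous (<⇒≤ xw) , s) xy))
          , λ av → av y<n py xy) , x<n , y<n , xy

      opaque
        unfolding lasts avoiding

        -- In a block of the complement that meets `P`, the last position and the last position in
        -- `P` determine each other through `_≈_`. One matching in each direction gives the
        -- equality.
        lasts-partition : lasts E ⊤? ≡ lasts E P? + avoiding
        lasts-partition = ≡.trans (count-partition (last? E ⊤?) avoids? n)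
          (≡.trans (+-comm avoiding _) (cong (_+ avoiding) (≤-antisym
            (count-matching meets? (last? E P?) (λ x y → x < n × y < n × x ≈ y) n n to-last
              λ { ((_ , l) , _) ((_ , l′) , _) (x<n , _ , e) (x′<n , _ , e′) → unique l l′ x<n x′<n (≈-trans e (≈-sym e′)) })
            (count-matching (last? E P?) meets? (λ y x → x < n × y < n × x ≈ y) n n
              from-last
              λ { l l′ (_ , y<n , e) (_ , y′<n , e′) → let d = ≈-trans (≈-sym e) e′ in
                  ≤-antisym (last-≤ y<n l′ (proj₁ l) d) (last-≤ y′<n l (proj₁ l′) (≈-sym d)) }))))
          where
          unique : ∀ {x x′} → (∀ {y} → y < n → x < y → ⊤ → ¬ Saturated E x y) →
                   (∀ {y} → y < n → x′ < y → ⊤ → ¬ Saturated E x′ y) →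
                   x < n → x′ < n → x ≈ x′ → x ≡ x′
          unique {x} {x′} l l′ x<n x′<n e with <-cmp x x′
          ... | tri< h _ _ = contradiction (proj₁ e) (l x′<n h tt)
          ... | tri≈ _ h _ = h
          ... | tri> _ _ h = contradiction (proj₂ e) (l′ x<n h tt)

  opaque
    unfolding lasts

    lasts-≤ : ∀ {n} {E F : NCEquiv n} {P : ℕ → Set} (P? : ∀ x → Dec (P x)) →
              (∀ {x y} → P x → P y → Saturated F x y → Saturated E x y) → lasts E P? ≤ lasts F P?
    lasts-≤ {n} {E} {F} P? f = count-mono (last? E P?) (last? F P?) n
      λ _ (p , l) → p , λ y<n xy py s → l y<n xy py (f p py s)

  module _ {n : ℕ} {E F : NCEquiv n} (E⊆F : E ⊆ᴱ F) where

    -- The Kreweras complement reverses the order of partitions.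
    saturated-antitone : ∀ {x y} → Saturated F x y → Saturated E x y
    saturated-antitone s u v h = s u v (E⊆F h)

    module _ {P : ℕ → Set} (P? : ∀ x → Dec (P x)) where

      lasts-mono : lasts E P? ≤ lasts F P?
      lasts-mono = lasts-≤ {E = E} {F} P? λ _ _ → saturated-antitone

      opaque
        unfolding avoiding

        avoiding-mono : avoiding E P? ≤ avoiding F P?
        avoiding-mono = count-mono (λ x → last? E ⊤? x ×-dec avoids? E P? x) _ n
          λ _ ((_ , l) , av) → (tt , λ y<n xy py s → l y<n xy py (saturated-antitone s))
            , λ y<n py (s , t) → av y<n py (saturated-antitone s , saturated-antitone t)

    first-antitone : ∀ {x} → First F x → First E x
    first-antitone f yx h = f yx (E⊆F h)

    private
      least-below : ∀ {v z} → (∀ {w} → w < z → ¬ rel E w v) → rel E z v →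
                    First E z
      least-below min zv yz h = min yz (~-trans E h zv)

    opaque
      unfolding blocks

      -- Of the least points of the two blocks of `E`, the larger one is no longer least in the
      -- common block of `F`.
      blocks-strict : ∀ {u v} → rel F u v → ¬ rel E u v → blocks F < blocks E
      blocks-strict {u} {v} uv ¬uv
        with least (λ w → rel? E w u) (~-refl E (bound F uv))
           | least (λ w → rel? E w v) (~-refl E (bound′ F uv))
      ... | x , x≤u , xu , xmin | y , y≤v , yv , ymin with <-cmp x y
      ...   | tri≈ _ refl _ = contradiction (~-trans E (~-sym E xu) yv) ¬uv
      ...   | tri< x<y _ _ = count-mono-< (first? F) (first? E) n (λ _ → first-antitone)
        (≤-<-trans y≤v (bound′ F uv)) (least-below {v} ymin yv)
        λ f → f x<y (~-trans F (E⊆F xu) (~-trans F uv (~-sym F (E⊆F yv))))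
      ...   | tri> _ _ y<x = count-mono-< (first? F) (first? E) n (λ _ → first-antitone)
        (≤-<-trans x≤u (bound F uv)) (least-below {u} xmin xu)
        λ f → f y<x (~-trans F (E⊆F yv) (~-trans F (~-sym F uv) (~-sym F (E⊆F xu))))

  module _ {n : ℕ} {E F : NCEquiv n} (E≃F : E ≃ᴱ F) where

    opaque
      unfolding blocks

      blocks-cong : blocks E ≡ blocks F
      blocks-cong = count-cong (first? E) (first? F) n
        (λ _ → first-antitone {E = F} {E} (proj₂ E≃F)) (λ _ → first-antitone {E = E} {F} (proj₁ E≃F))

    lasts-cong : ∀ {P : ℕ → Set} (P? : ∀ x → Dec (P x)) → lasts E P? ≡ lasts F P?
    lasts-cong P? = ≤-antisym (lasts-mono {E = E} {F} (proj₁ E≃F) P?) (lasts-mono {E = F} {E} (proj₂ E≃F) P?)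

  module _ {n : ℕ} (E : NCEquiv n) {a b : ℕ} (a<n : a < n) (b<n : b < n) (a<b : a < b)
           (gap : ∀ {u v} → a < u → u < b → rel E u v → a ≤ v × v ≤ b) where

    private
      M : NCEquiv n
      M = merge E a<n b<n a<b gap

      Displaced : ℕ → Set
      Displaced x = First E x × ¬ First M x

      witness : ∀ {x} → Displaced x →
        (rel E a x × ∃[ y ] y < x × rel E b y) ⊎ (rel E b x × ∃[ y ] y < x × rel E a y)
      witness {x} (f , ¬g) with anyUpTo? (λ y → rel? M y x) x
      ... | no none = ⊥-elim (¬g λ yx h → none (_ , yx , h))
      ... | yes (y , yx , inj₁ h) = contradiction h (f yx)
      ... | yes (y , yx , inj₂ (inj₁ ay , inj₁ ax)) = contradiction (~-trans E (~-sym E ay) ax) (f yx)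
      ... | yes (y , yx , inj₂ (inj₂ by , inj₁ ax)) = inj₁ (ax , y , yx , by)
      ... | yes (y , yx , inj₂ (inj₁ ay , inj₂ bx)) = inj₂ (bx , y , yx , ay)
      ... | yes (y , yx , inj₂ (inj₂ by , inj₂ bx)) = contradiction (~-trans E (~-sym E by) bx) (f yx)

      first-≤ : ∀ {z x y} → First E x → rel E z x → rel E z y → x ≤ y
      first-≤ f zx zy = ≮⇒≥ λ yx → f yx (~-trans E (~-sym E zy) zx)

      displaced-unique : ∀ {x x′} → Displaced x → Displaced x′ → x ≡ x′
      displaced-unique {x} {x′} d@(f , _) d′@(f′ , _) with witness d | witness d′
      ... | inj₁ (ax , _) | inj₁ (ax′ , _) = ≤-antisym (first-≤ f ax ax′) (first-≤ f′ ax′ ax)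
      ... | inj₂ (bx , _) | inj₂ (bx′ , _) = ≤-antisym (first-≤ f bx bx′) (first-≤ f′ bx′ bx)
      ... | inj₁ (ax , y , yx , by) | inj₂ (bx′ , y′ , yx′ , ay′) = contradiction
        (≤-<-trans (first-≤ f ax ay′) yx′) (<⇒≯ (≤-<-trans (first-≤ f′ bx′ by) yx))
      ... | inj₂ (bx , y , yx , ay) | inj₁ (ax′ , y′ , yx′ , by′) = contradiction
        (≤-<-trans (first-≤ f bx by′) yx′) (<⇒≯ (≤-<-trans (first-≤ f′ ax′ ay) yx))

    opaque
      unfolding blocks

      -- A block is lost by `blocks-strict`. No more than one is lost since only the larger of the
      -- two least points is displaced: all displaced points are matched to a single slot.
      blocks-merge : ¬ rel E a b → blocks E ≡ suc (blocks M)
      blocks-merge a≁b = ≤-antisym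
        (subst₂ _≤_ (≡.sym (count-partition (first? E) (first? M) n)) (+-comm (blocks M) 1) (+-mono-≤
          (count-mono (λ x → first? E x ×-dec first? M x) (first? M) n (λ _ → proj₂))
          (count-matching (λ x → first? E x ×-dec ¬? (first? M x)) ⊤? (λ _ _ → ⊤) n 1
            (λ _ _ → 0 , s≤s z≤n , tt , tt) λ d d′ _ _ → displaced-unique d d′)))
        (blocks-strict {E = E} {M} (⊆-merge E a<n b<n a<b gap) (merge-joins E a<n b<n a<b gap) a≁b)

open Partitions

-- Non-crossing partitions as binary trees.

module Trees where

  open import Data.Bool as Bool using (Bool; true; false; not; _xor_; if_then_else_)
  open import Data.Bool.Properties as Bool using (xor-assoc)
  open import Data.Empty using (⊥)
  open import Data.Nat hiding (_≟_)
  open import Data.Nat.Induction using (<-rec)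
  open import Data.Nat.Properties as ℕ hiding (_≟_)
  open import Data.Product using (_×_; _,_; proj₁; proj₂; ∃-syntax)
  open import Data.Sum using (_⊎_; inj₁; inj₂)
  open import Data.Unit using (⊤; tt)
  open import Function using (_∘_; id)
  open import Relation.Binary.Definitions using (tri<; tri≈; tri>)
  open import Relation.Binary.PropositionalEquality as ≡ using (_≡_; refl; cong; cong₂; subst; subst₂)
  open import Relation.Nullary using (¬_; Dec; contradiction; yes; no)
  open import Relation.Nullary.Decidable using (_×-dec_; _⊎-dec_; map′)

  module _ (j : ℕ) where

    m+suc-n∸suc-m : ∀ x → j + suc x ∸ suc j ≡ x
    m+suc-n∸suc-m x = ≡.trans (cong (_∸ suc j) (+-suc j x)) (m+n∸m≡n (suc j) x)

    m+suc[n∸suc-m] : ∀ {x} → j < x → x ≡ j + suc (x ∸ suc j)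
    m+suc[n∸suc-m] {x} h = ≡.sym (≡.trans (+-suc j (x ∸ suc j)) (m+[n∸m]≡n h))

    m<m+suc : ∀ x → j < j + suc x
    m<m+suc x = m<m+n j (s≤s z≤n)

  data Side (j : ℕ) : ℕ → Set where
    isLeft  : ∀ {x} → x < j → Side j x
    isRoot  : Side j j
    isRight : ∀ x → Side j (j + suc x)

  side : ∀ j x → Side j x
  side j x with <-cmp x j
  ... | tri< h _ _    = isLeft h
  ... | tri≈ _ refl _ = isRoot
  ... | tri> _ _ h    = subst (Side j) (≡.sym (m+suc[n∸suc-m] j h)) (isRight (x ∸ suc j))

  -- The partition of {0,…,j+k} whose restriction to {0,…,j-1} is E, whose
  -- restriction to {j+1,…,j+k} is F, and whose block of 0 has maximum j.
  module _ {j k : ℕ} (E : NCEquiv j) (F : NCEquiv k) where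

    private
      Root : ℕ → Set
      Root x = x ≡ j ⊎ rel E 0 x

      Right : ℕ → ℕ → Set
      Right x y = j < x × j < y × rel F (x ∸ suc j) (y ∸ suc j)

      Glued : ℕ → ℕ → Set
      Glued x y = rel E x y ⊎ (Root x × Root y) ⊎ Right x y

      Root≤ : ∀ {x} → Root x → x ≤ j
      Root≤ (inj₁ refl) = ≤-refl
      Root≤ (inj₂ h)    = <⇒≤ (bound′ E h)

      Root-~ : ∀ {x y} → Root x → rel E x y → Root y
      Root-~ (inj₁ refl) h = contradiction (bound E h) (<-irrefl refl)
      Root-~ (inj₂ g)    h = inj₂ (~-trans E g h)

      Root-E : ∀ {x y} → Root x → Root y → x < j → y < j → rel E x y
      Root-E (inj₁ refl) _           xj yj = contradiction xj (<-irrefl refl)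
      Root-E _           (inj₁ refl) xj yj = contradiction yj (<-irrefl refl)
      Root-E (inj₂ h)    (inj₂ g)    xj yj = ~-trans E (~-sym E h) g

      glued-sym : ∀ {x y} → Glued x y → Glued y x
      glued-sym (inj₁ h)                    = inj₁ (~-sym E h)
      glued-sym (inj₂ (inj₁ (h , g)))       = inj₂ (inj₁ (g , h))
      glued-sym (inj₂ (inj₂ (jx , jy , h))) = inj₂ (inj₂ (jy , jx , ~-sym F h))

      glued-trans : ∀ {x y z} → Glued x y → Glued y z → Glued x z
      glued-trans (inj₁ h) (inj₁ g) = inj₁ (~-trans E h g)
      glued-trans (inj₁ h) (inj₂ (inj₁ (Ry , Rz))) = inj₂ (inj₁ (Root-~ Ry (~-sym E h) , Rz))
      glued-trans (inj₁ h) (inj₂ (inj₂ (jy , _))) = contradiction (bound′ E h) (<⇒≯ jy)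
      glued-trans (inj₂ (inj₁ (Rx , Ry))) (inj₁ g) = inj₂ (inj₁ (Rx , Root-~ Ry g))
      glued-trans (inj₂ (inj₁ (Rx , _))) (inj₂ (inj₁ (_ , Rz))) = inj₂ (inj₁ (Rx , Rz))
      glued-trans (inj₂ (inj₁ (_ , Ry))) (inj₂ (inj₂ (jy , _))) = contradiction (Root≤ Ry) (<⇒≱ jy)
      glued-trans (inj₂ (inj₂ (_ , jy , _))) (inj₁ g) = contradiction (bound E g) (<⇒≯ jy)
      glued-trans (inj₂ (inj₂ (_ , jy , _))) (inj₂ (inj₁ (Ry , _))) = contradiction (Root≤ Ry) (<⇒≱ jy)
      glued-trans (inj₂ (inj₂ (jx , _ , h))) (inj₂ (inj₂ (_ , jz , g))) = inj₂ (inj₂ (jx , jz , ~-trans F h g))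

      0~ : ∀ {x} → Root x → x < j → rel E 0 x
      0~ Rx xj = Root-E (inj₂ (~-refl E 0<j)) Rx 0<j xj
        where
        0<j : 0 < j
        0<j = ≤-<-trans z≤n xj

      glued-nc : ∀ {a b c d} → a < b → b < c → c < d → Glued a c → Glued b d → Glued a b
      glued-nc ab bc cd (inj₁ h) (inj₁ g) = inj₁ (crossing E ab bc cd h g)
      -- Here `b` lies in the block of 0. For `a = 0` this is the claim; for `a > 0` the points 0,
      -- `a`, `b`, `c` cross, which puts `a` into the block of 0 as well.
      glued-nc {zero} ab bc cd (inj₁ h) (inj₂ (inj₁ (Rb , _))) = inj₁ (0~ Rb (<-trans bc (bound′ E h)))
      glued-nc {suc a} ab bc cd (inj₁ h) (inj₂ (inj₁ (Rb , _))) =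
        let 0~b = 0~ Rb (<-trans bc (bound′ E h))
        in inj₁ (~-trans E (~-sym E (crossing E (s≤s z≤n) ab bc 0~b h)) 0~b)
      glued-nc ab bc cd (inj₁ h) (inj₂ (inj₂ (jb , _))) = contradiction (<-trans bc (bound′ E h)) (<⇒≯ jb)
      glued-nc ab bc cd (inj₂ (inj₁ (Ra , Rc))) (inj₁ g) =
        let b<j = bound E g ; c<j = <-trans cd (bound′ E g)
        in inj₁ (crossing E ab bc cd (Root-E Ra Rc (<-trans ab b<j) c<j) g)
      glued-nc ab bc cd (inj₂ (inj₁ (Ra , _))) (inj₂ (inj₁ (Rb , _))) = inj₂ (inj₁ (Ra , Rb))
      glued-nc ab bc cd (inj₂ (inj₁ (_ , Rc))) (inj₂ (inj₂ (jb , _))) =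
        contradiction (Root≤ Rc) (<⇒≱ (<-trans jb bc))
      glued-nc ab bc cd (inj₂ (inj₂ (ja , _))) (inj₁ g) = contradiction (bound E g) (<⇒≯ (<-trans ja ab))
      glued-nc ab bc cd (inj₂ (inj₂ (ja , _))) (inj₂ (inj₁ (Rb , _))) =
        contradiction (Root≤ Rb) (<⇒≱ (<-trans ja ab))
      glued-nc ab bc cd (inj₂ (inj₂ (ja , _ , h))) (inj₂ (inj₂ (jb , jd , g))) = inj₂ (inj₂ (ja , jb ,
        crossing F (∸-monoˡ-< ab ja) (∸-monoˡ-< bc jb) (∸-monoˡ-< cd (<-trans jb bc)) h g))

      root? : ∀ x → Dec (Root x)
      root? x = (x ℕ.≟ j) ⊎-dec rel? E 0 x

      glued-refl : ∀ {x} → Side j x → x < j + suc k → Glued x x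
      glued-refl (isLeft h)  _ = inj₁ (~-refl E h)
      glued-refl isRoot      _ = inj₂ (inj₁ (inj₁ refl , inj₁ refl))
      glued-refl (isRight x) h = inj₂ (inj₂ (m<m+suc j x , m<m+suc j x ,
        subst (λ z → rel F z z) (≡.sym (m+suc-n∸suc-m j x)) (~-refl F (≤-pred (+-cancelˡ-< j _ _ h)))))

      glued-bound : ∀ {x y} → Glued x y → x < j + suc k
      glued-bound (inj₁ h) = <-≤-trans (bound E h) (m≤m+n j (suc k))
      glued-bound (inj₂ (inj₁ (Rx , _))) = ≤-<-trans (Root≤ Rx) (m<m+suc j k)
      glued-bound (inj₂ (inj₂ (jx , _ , h))) = subst (_< j + suc k) (≡.sym (m+suc[n∸suc-m] j jx))
        (+-monoʳ-< j (s≤s (bound F h)))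

    glue : NCEquiv (j + suc k)
    glue = record
      { rel      = Glued
      ; rel?     = λ x y → rel? E x y ⊎-dec ((root? x ×-dec root? y) ⊎-dec
                     (j <? x ×-dec j <? y ×-dec rel? F (x ∸ suc j) (y ∸ suc j)))
      ; bound    = glued-bound
      ; ~-refl   = λ {x} → glued-refl (side j x)
      ; ~-sym    = glued-sym
      ; ~-trans  = glued-trans
      ; crossing = glued-nc
      }

    glue-left⁺ : ∀ {x y} → rel E x y → rel glue x y
    glue-left⁺ = inj₁

    glue-left⁻ : ∀ {x y} → x < j → y < j → rel glue x y → rel E x y
    glue-left⁻ xj yj (inj₁ h)                  = h
    glue-left⁻ xj yj (inj₂ (inj₁ (Rx , Ry)))   = Root-E Rx Ry xj yj
    glue-left⁻ xj yj (inj₂ (inj₂ (jx , _)))    = contradiction xj (<⇒≯ jx)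

    glue-right⁺ : ∀ {x y} → rel F x y → rel glue (j + suc x) (j + suc y)
    glue-right⁺ {x} {y} h = inj₂ (inj₂ (m<m+suc j x , m<m+suc j y ,
      subst₂ (rel F) (≡.sym (m+suc-n∸suc-m j x)) (≡.sym (m+suc-n∸suc-m j y)) h))

    glue-right⁻ : ∀ {x y} → rel glue (j + suc x) (j + suc y) → rel F x y
    glue-right⁻ {x} (inj₁ h) = contradiction (bound E h) (<⇒≯ (m<m+suc j x))
    glue-right⁻ {x} (inj₂ (inj₁ (Rx , _))) = contradiction (Root≤ Rx) (<⇒≱ (m<m+suc j x))
    glue-right⁻ {x} {y} (inj₂ (inj₂ (_ , _ , h))) =
      subst₂ (rel F) (m+suc-n∸suc-m j x) (m+suc-n∸suc-m j y) h

    glue-separates : ∀ {x y} → x ≤ j → ¬ rel glue x (j + suc y)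
    glue-separates {x} {y} xj (inj₁ h) = <⇒≯ (m<m+suc j y) (bound′ E h)
    glue-separates {x} {y} xj (inj₂ (inj₁ (_ , Ry))) = <⇒≱ (m<m+suc j y) (Root≤ Ry)
    glue-separates {x} {y} xj (inj₂ (inj₂ (jx , _))) = <⇒≱ jx xj

    glue-root⁺ : ∀ {x} → rel E 0 x → rel glue x j
    glue-root⁺ h = inj₂ (inj₁ (inj₂ h , inj₁ refl))

    glue-root⁻ : ∀ {x} → x < j → rel glue x j → rel E 0 x
    glue-root⁻ xj (inj₁ h) = contradiction (bound′ E h) (<-irrefl refl)
    glue-root⁻ xj (inj₂ (inj₁ (inj₁ refl , _))) = contradiction xj (<-irrefl refl)
    glue-root⁻ xj (inj₂ (inj₁ (inj₂ h , _))) = h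
    glue-root⁻ xj (inj₂ (inj₂ (jx , _))) = contradiction xj (<⇒≯ jx)

    glue-0~root : 0 < j → rel glue 0 j
    glue-0~root h = glue-root⁺ (~-refl E h)

    opaque
      unfolding blocks

      -- The root starts a new block only when the left part is empty, since otherwise it belongs to
      -- the block of 0.
      blocks-glue : ∀ (d : Dec (j ≡ 0)) → blocks glue ≡ blocks E + (𝟙 d + blocks F)
      blocks-glue d = ≡.trans (count-++ (first? glue) j (suc k)) (cong₂ _+_
        (count-cong (first? glue) (first? E) j
          (λ _ f yx h → f yx (inj₁ h))
          (λ xj f yx h → f yx (glue-left⁻ (<-trans yx xj) xj h)))
        (≡.trans (count-++ (λ x → first? glue (j + x)) 1 k) (cong₂ _+_
          (𝟙-cong (first? glue (j + 0)) d at-root at-root′)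
          (count-cong (λ x → first? glue (j + suc x)) (first? F) k
            (λ {x} _ f {y} yx h → f (+-monoʳ-< j (s≤s yx)) (glue-right⁺ h))
            (λ {x} _ f {y} yx h → before (side j y) yx f h)))))
        where
        at-root : First glue (j + 0) → j ≡ 0
        at-root f rewrite +-identityʳ j with <-cmp 0 j
        ... | tri< h _ _ = contradiction (glue-0~root h) (f h)
        ... | tri≈ _ e _ = ≡.sym e
        at-root′ : j ≡ 0 → First glue (j + 0)
        at-root′ refl ()
        before : ∀ {x y} → Side j y → y < j + suc x → First F x → ¬ rel glue y (j + suc x)
        before (isLeft h)  _  f = glue-separates (<⇒≤ h)
        before isRoot      _  f = glue-separates ≤-refl
        before {x} (isRight y) yx f h = f (≤-pred (+-cancelˡ-< j _ _ yx)) (glue-right⁻ h)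

  module _ {n : ℕ} (E : NCEquiv n) where

    -- Saturation of (x, y] for a fictitious position x = -1. When the partition is the right part
    -- of a `glue`, the root takes the place of this position.
    ClosedPrefix : ℕ → Set
    ClosedPrefix y = ∀ u v → rel E u v → u ≤ y → v ≤ y

    NoClosedPrefix : (ℕ → Set) → Set
    NoClosedPrefix P = ∀ y → y < n → P y → ¬ ClosedPrefix y

  module _ {j k : ℕ} (E : NCEquiv j) (F : NCEquiv k) where

    private
      G : NCEquiv (j + suc k)
      G = glue E F

      saturated-left⁺ : ∀ {x y} → y < j → Saturated E x y → Saturated G x y
      saturated-left⁺ yj s u v h xu uy with side j v
      ... | isLeft vj  = s u v (glue-left⁻ E F (≤-<-trans uy yj) vj h) xu uy
      ... | isRoot     = contradiction
        (proj₁ (s u 0 (~-sym E (glue-root⁻ E F (≤-<-trans uy yj) h)) xu uy)) λ ()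
      ... | isRight v′ = contradiction h (glue-separates E F (<⇒≤ (≤-<-trans uy yj)))

      saturated-left⁻ : ∀ {x y} → Saturated G x y → Saturated E x y
      saturated-left⁻ s u v h = s u v (inj₁ h)

      unsaturated : ∀ {x y} → x < j → j ≤ y → ¬ Saturated G x y
      unsaturated xj jy s = contradiction
        (proj₁ (s j 0 (~-sym G (glue-0~root E F (≤-<-trans z≤n xj))) xj jy)) λ ()

      unshift-< : ∀ {x y} → j + suc x < j + suc y → x < y
      unshift-< h = ≤-pred (+-cancelˡ-< j _ _ h)

      unshift-≤ : ∀ {x y} → j + suc x ≤ j + suc y → x ≤ y
      unshift-≤ h = ≤-pred (+-cancelˡ-≤ j _ _ h)

      shift-≤ : ∀ {x y} → x ≤ y → j + suc x ≤ j + suc y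
      shift-≤ h = +-monoʳ-≤ j (s≤s h)

      shift-< : ∀ {x y} → x < y → j + suc x < j + suc y
      shift-< h = +-monoʳ-< j (s≤s h)

      saturated-right⁺ : ∀ {x y} → Saturated F x y → Saturated G (j + suc x) (j + suc y)
      saturated-right⁺ {x} {y} s u v h xu uy with side j u | side j v
      ... | isLeft uj  | _ = contradiction uj (<⇒≯ (<-trans (m<m+suc j x) xu))
      ... | isRoot     | _ = contradiction xu (<⇒≯ (m<m+suc j x))
      ... | isRight u′ | isLeft vj  = contradiction (~-sym G h) (glue-separates E F (<⇒≤ vj))
      ... | isRight u′ | isRoot     = contradiction (~-sym G h) (glue-separates E F ≤-refl)
      ... | isRight u′ | isRight v′ = let xv , vy = s u′ v′ (glue-right⁻ E F h) (unshift-< xu) (unshift-≤ uy)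
                                  in shift-< xv , shift-≤ vy

      saturated-right⁻ : ∀ {x y} → Saturated G (j + suc x) (j + suc y) → Saturated F x y
      saturated-right⁻ s u v h xu uy =
        let xv , vy = s (j + suc u) (j + suc v) (glue-right⁺ E F h) (shift-< xu) (shift-≤ uy)
        in unshift-< xv , unshift-≤ vy

      saturated-root⁺ : ∀ {y} → ClosedPrefix F y → Saturated G j (j + suc y)
      saturated-root⁺ {y} s u v h ju uy with side j u | side j v
      ... | isLeft uj  | _ = contradiction uj (<⇒≯ ju)
      ... | isRoot     | _ = contradiction ju (<-irrefl refl)
      ... | isRight u′ | isLeft vj  = contradiction (~-sym G h) (glue-separates E F (<⇒≤ vj))
      ... | isRight u′ | isRoot     = contradiction (~-sym G h) (glue-separates E F ≤-refl)
      ... | isRight u′ | isRight v′ = m<m+suc j v′ , shift-≤ (s u′ v′ (glue-right⁻ E F h) (unshift-≤ uy))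

      saturated-root⁻ : ∀ {y} → Saturated G j (j + suc y) → ClosedPrefix F y
      saturated-root⁻ s u v h uy =
        unshift-≤ (proj₂ (s (j + suc u) (j + suc v) (glue-right⁺ E F h) (m<m+suc j u) (shift-≤ uy)))

    opaque
      unfolding lasts

      -- No saturated interval leads from the left part to the root or beyond it, because the block
      -- of the root reaches back to 0. So the two parts contribute independently, and only the root
      -- has to look at the closed prefixes of `F`.
      lasts-glue : ∀ {P : ℕ → Set} (P? : ∀ x → Dec (P x))
                   (d : Dec (P j × NoClosedPrefix F (λ x → P (j + suc x)))) →
                   lasts G P? ≡ lasts E P? + (𝟙 d + lasts F (λ x → P? (j + suc x)))
      lasts-glue {P} P? d = ≡.trans (count-++ (last? G P?) j (suc k)) (cong₂ _+_
        (count-cong (last? G P?) (last? E P?) j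
          (λ xj (p , l) → p , λ yj xy py s → l (<-≤-trans yj (m≤m+n j _)) xy py (saturated-left⁺ yj s))
          (λ xj (p , l) → p , λ {y} → beyond-left xj l (side j y)))
        (≡.trans (count-++ (λ x → last? G P? (j + x)) 1 k) (cong₂ _+_
          (𝟙-cong (last? G P? (j + 0)) d at-root at-root′)
          (count-cong (λ x → last? G P? (j + suc x)) (last? F (λ x → P? (j + suc x))) k
            (λ xk (p , l) → p , λ yk xy py s → l (shift-< yk) (shift-< xy) py (saturated-right⁺ s))
            (λ xk (p , l) → p , λ {y} → beyond-right l (side j y))))))
        where
        beyond-left : ∀ {x y} → x < j → (∀ {y} → y < j → x < y → P y → ¬ Saturated E x y) → Side j y →
                      y < j + suc k → x < y → P y → ¬ Saturated G x y
        beyond-left xj l (isLeft yj) _ xy py s = l yj xy py (saturated-left⁻ s)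
        beyond-left xj l isRoot      _ xy py s = unsaturated xj ≤-refl s
        beyond-left xj l (isRight y) _ xy py s = unsaturated xj (<⇒≤ (m<m+suc j y)) s
        beyond-right : ∀ {x y} → (∀ {y} → y < k → x < y → P (j + suc y) → ¬ Saturated F x y) → Side j y →
                       y < j + suc k → j + suc x < y → P y → ¬ Saturated G (j + suc x) y
        beyond-right {x} l (isLeft yj) _ xy _ _ = contradiction yj (<⇒≯ (<-trans (m<m+suc j x) xy))
        beyond-right {x} l isRoot      _ xy _ _ = contradiction xy (<⇒≯ (m<m+suc j x))
        beyond-right {x} l (isRight y) yk xy py s = l (unshift-< yk) (unshift-< xy) py (saturated-right⁻ s)
        at-root : Last G P? (j + 0) → P j × NoClosedPrefix F (λ x → P (j + suc x))
        at-root (p , l) rewrite +-identityʳ j =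
          p , λ y yk py c → l (shift-< yk) (m<m+suc j y) py (saturated-root⁺ c)
        at-root′ : P j × NoClosedPrefix F (λ x → P (j + suc x)) → Last G P? (j + 0)
        at-root′ (p , l) rewrite +-identityʳ j = p , λ {y} → after (side j y)
          where
          after : ∀ {y} → Side j y → y < j + suc k → j < y → P y → ¬ Saturated G j y
          after (isLeft yj) _  jy _  _ = <⇒≯ yj jy
          after isRoot      _  jy _  _ = <-irrefl refl jy
          after (isRight y) yk _  py s = l y (unshift-< yk) py (saturated-root⁻ s)

    -- A prefix that ends before the root separates 0 from the root; the one ending at the root is
    -- closed; later ones are closed exactly if their part in `F` is. Hence the closed prefixes of a
    -- tree end at the nodes on the path of right edges.
    closedPrefix-glue⁺ : ∀ {P : ℕ → Set} → ¬ P j → NoClosedPrefix F (λ x → P (j + suc x)) → NoClosedPrefix G P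
    closedPrefix-glue⁺ {P} ¬p f y = go (side j y)
      where
      go : ∀ {y} → Side j y → y < j + suc k → P y → ¬ ClosedPrefix G y
      go (isLeft yj) _ _ c = contradiction (c 0 j (glue-0~root E F (≤-<-trans z≤n yj)) z≤n) (<⇒≱ yj)
      go isRoot      _ p c = ¬p p
      go (isRight y) yk p c = f y (unshift-< yk) p λ u v h uy →
        unshift-≤ (c (j + suc u) (j + suc v) (glue-right⁺ E F h) (shift-≤ uy))

    closedPrefix-glue⁻ : ∀ {P : ℕ → Set} → NoClosedPrefix G P → ¬ P j × NoClosedPrefix F (λ x → P (j + suc x))
    closedPrefix-glue⁻ {P} f = (λ p → f j (m<m+suc j k) p at-root) , λ y yk p c → f _ (shift-< yk) p (at-right c)
      where
      at-root : ClosedPrefix G j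
      at-root u v h uj with side j v
      ... | isLeft vj  = <⇒≤ vj
      ... | isRoot     = ≤-refl
      ... | isRight v′ = contradiction h (glue-separates E F uj)
      at-right : ∀ {y} → ClosedPrefix F y → ClosedPrefix G (j + suc y)
      at-right c u v h uy with side j u | side j v
      ... | _        | isLeft vj  = <⇒≤ (<-trans vj (m<m+suc j _))
      ... | _        | isRoot     = <⇒≤ (m<m+suc j _)
      ... | isLeft uj  | isRight v′ = contradiction h (glue-separates E F (<⇒≤ uj))
      ... | isRoot     | isRight v′ = contradiction h (glue-separates E F ≤-refl)
      ... | isRight u′ | isRight v′ = shift-≤ (c u′ v′ (glue-right⁻ E F h) (unshift-≤ uy))

  data Tree : Set where
    leaf : Tree
    node : Tree → Tree → Tree

  size : Tree → ℕ
  size leaf       = 0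
  size (node l r) = size l + suc (size r)

  empty : NCEquiv 0
  empty = record
    { rel = λ _ _ → ⊥ ; rel? = λ _ _ → no id ; bound = λ () ; ~-refl = λ ()
    ; ~-sym = λ () ; ~-trans = λ () ; crossing = λ _ _ _ () }

  -- Nodes are numbered in infix order; a block consists of the nodes on a
  -- maximal path of left edges, and a block of the Kreweras complement of
  -- those on a maximal path of right edges.
  equiv : (t : Tree) → NCEquiv (size t)
  equiv leaf       = empty
  equiv (node l r) = glue (equiv l) (equiv r)

  isLeaf : Tree → ℕ
  isLeaf leaf       = 1
  isLeaf (node _ _) = 0

  -- The leaves that are left children. Every maximal path of left edges ends in exactly one of
  -- them, so this is the number of blocks; `rightLeaves` plays the same role for the complement.
  leftLeaves : Tree → ℕ
  leftLeaves leaf       = 0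
  leftLeaves (node l r) = leftLeaves l + (isLeaf l + leftLeaves r)

  rightLeaves : Tree → ℕ
  rightLeaves leaf       = 0
  rightLeaves (node l r) = rightLeaves l + (isLeaf r + rightLeaves r)

  -- A binary tree with n nodes has n + 1 leaves; a tree that is itself a leaf has one that is
  -- nobody's child. For other trees this is the relation between the numbers of blocks of a
  -- partition and of its Kreweras complement.
  leaves : ∀ t → isLeaf t + (leftLeaves t + rightLeaves t) ≡ suc (size t)
  leaves leaf       = refl
  leaves (node l r) = ≡.trans
    (solve 6 (λ a b c d e f → (a :+ (d :+ b)) :+ (c :+ (f :+ e)) := (d :+ (a :+ c)) :+ (f :+ (b :+ e)))
      refl (leftLeaves l) (leftLeaves r) (rightLeaves l) (isLeaf l) (rightLeaves r) (isLeaf r))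
    (cong₂ _+_ (leaves l) (leaves r))
    where
    open import Data.Nat.Solver
    open +-*-Solver

  odd : ℕ → Bool
  odd zero    = false
  odd (suc n) = not (odd n)

  odd-+ : ∀ m n → odd (m + n) ≡ odd m xor odd n
  odd-+ zero    n = refl
  odd-+ (suc m) n = ≡.trans (cong not (odd-+ m n)) (Bool.not-distribˡ-xor (odd m) (odd n))

  -- Position x of a subtree with offset parity b is odd in the whole tree.
  OddAt : Bool → ℕ → Set
  OddAt b x = b xor odd x ≡ true

  oddAt? : ∀ b x → Dec (OddAt b x)
  oddAt? b x = b xor odd x Bool.≟ true

  oddAt-shift : ∀ b j x → b xor odd (j + suc x) ≡ not (b xor odd j) xor odd x
  oddAt-shift b j x = begin
    b xor odd (j + suc x)       ≡⟨ cong (b xor_) (odd-+ j (suc x)) ⟩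
    b xor (odd j xor not (odd x)) ≡⟨ xor-assoc b (odd j) (not (odd x)) ⟨
    (b xor odd j) xor not (odd x) ≡⟨ Bool.not-distribʳ-xor (b xor odd j) (odd x) ⟨
    not ((b xor odd j) xor odd x) ≡⟨ Bool.not-distribˡ-xor (b xor odd j) (odd x) ⟩
    not (b xor odd j) xor odd x ∎
    where open ≡.≡-Reasoning

  -- 1 if the path of right edges from the root has no odd position, else 0.
  evenSpine : Bool → Tree → ℕ
  evenSpine b leaf       = 1
  evenSpine b (node l r) = if b xor odd (size l) then 0 else evenSpine true r

  -- The number of maximal paths of right edges with an odd position.
  oddPaths : Bool → Tree → ℕ
  oddPaths b leaf       = 0
  oddPaths b (node l r) = oddPaths b l
    + ((if b xor odd (size l) then evenSpine false r else 0) + oddPaths (not (b xor odd (size l))) r)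

  opaque
    unfolding blocks

    blocks-equiv : ∀ t → blocks (equiv t) ≡ leftLeaves t
    blocks-equiv leaf       = refl
    blocks-equiv (node l r) = ≡.trans (blocks-glue (equiv l) (equiv r) (size l ℕ.≟ 0))
      (cong₂ _+_ (blocks-equiv l) (cong₂ _+_ (zero-size l) (blocks-equiv r)))
      where
      zero-size : ∀ t → 𝟙 (size t ℕ.≟ 0) ≡ isLeaf t
      zero-size leaf       = refl
      zero-size (node l r) = 𝟙-no (size l + suc (size r) ℕ.≟ 0) (m+1+n≢0 (size l))

  opaque
    unfolding lasts

    lasts-cong-P : ∀ {n} (E : NCEquiv n) {P Q : ℕ → Set} (P? : ∀ x → Dec (P x)) (Q? : ∀ x → Dec (Q x)) →
                   (∀ {x} → P x → Q x) → (∀ {x} → Q x → P x) → lasts E P? ≡ lasts E Q?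
    lasts-cong-P {n} E P? Q? f g = count-cong (last? E P?) (last? E Q?) n
      (λ _ (p , l) → f p , λ yn xy q → l yn xy (g q)) (λ _ (p , l) → g p , λ yn xy q → l yn xy (f q))

  opaque
    unfolding lasts

    lasts-equiv-⊤ : ∀ t → lasts (equiv t) ⊤? ≡ rightLeaves t
    lasts-equiv-⊤ leaf       = refl
    lasts-equiv-⊤ (node l r) = ≡.trans (lasts-glue (equiv l) (equiv r) ⊤? (d r))
      (cong₂ _+_ (lasts-equiv-⊤ l) (cong₂ _+_ (d-leaf r) (lasts-equiv-⊤ r)))
      where
      d : ∀ r → Dec (⊤ × NoClosedPrefix (equiv r) (λ _ → ⊤))
      d leaf       = yes (tt , λ _ ())
      d (node l r) = no λ (_ , f) → proj₁ (closedPrefix-glue⁻ (equiv l) (equiv r) f) tt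
      d-leaf : ∀ r → 𝟙 (d r) ≡ isLeaf r
      d-leaf leaf       = refl
      d-leaf (node _ _) = refl

  oddAt-glue⁺ : ∀ b {s} j → b xor odd j ≡ s → ∀ x → OddAt b (j + suc x) → OddAt (not s) x
  oddAt-glue⁺ b j refl x h = ≡.trans (≡.sym (oddAt-shift b j x)) h

  oddAt-glue⁻ : ∀ b {s} j → b xor odd j ≡ s → ∀ x → OddAt (not s) x → OddAt b (j + suc x)
  oddAt-glue⁻ b j refl x h = ≡.trans (oddAt-shift b j x) h

  private
    spine-node? : ∀ b l r s → b xor odd (size l) ≡ s → Dec (NoClosedPrefix (equiv r) (OddAt true)) →
                  Dec (NoClosedPrefix (equiv (node l r)) (OddAt b))
    spine-node? b l r true  eq _ = no λ f → proj₁ (closedPrefix-glue⁻ (equiv l) (equiv r) f) eq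
    spine-node? b l r false eq d = map′
      (λ f → closedPrefix-glue⁺ (equiv l) (equiv r) (λ h → contradiction (≡.trans (≡.sym h) eq) λ ())
        λ y yk p → f y yk (oddAt-glue⁺ b (size l) eq y p))
      (λ g y yk p → proj₂ (closedPrefix-glue⁻ (equiv l) (equiv r) g) y yk (oddAt-glue⁻ b (size l) eq y p))
      d

    spine-node-correct : ∀ b l r s (eq : b xor odd (size l) ≡ s) d →
                         𝟙 (spine-node? b l r s eq d) ≡ (if s then 0 else 𝟙 d)
    spine-node-correct b l r true  eq d       = refl
    spine-node-correct b l r false eq (yes _) = refl
    spine-node-correct b l r false eq (no _)  = refl

  evenSpine? : ∀ b t → Dec (NoClosedPrefix (equiv t) (OddAt b))
  evenSpine? b leaf       = yes λ _ ()
  evenSpine? b (node l r) = spine-node? b l r _ refl (evenSpine? true r)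

  evenSpine-correct : ∀ b t → 𝟙 (evenSpine? b t) ≡ evenSpine b t
  evenSpine-correct b leaf       = refl
  evenSpine-correct b (node l r) = ≡.trans (spine-node-correct b l r _ refl (evenSpine? true r))
    (cong (if b xor odd (size l) then 0 else_) (evenSpine-correct true r))

  opaque
    unfolding lasts

    -- The root is counted if it is odd and no odd position closes a prefix of the right subtree.
    -- These prefixes end on the path of right edges, and behind an odd root the offset is even,
    -- which gives `evenSpine false r`.
    lasts-equiv-odd : ∀ b t → lasts (equiv t) (oddAt? b) ≡ oddPaths b t
    lasts-equiv-odd b leaf       = refl
    lasts-equiv-odd b (node l r) = ≡.trans (lasts-glue (equiv l) (equiv r) (oddAt? b) (d _ refl))
      (cong₂ _+_ (lasts-equiv-odd b l) (cong₂ _+_ (d-correct _ refl)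
        (≡.trans (lasts-cong-P (equiv r) (λ x → oddAt? b (size l + suc x)) (oddAt? (not (b xor odd (size l))))
            (λ {x} → oddAt-glue⁺ b (size l) refl x) (λ {x} → oddAt-glue⁻ b (size l) refl x))
          (lasts-equiv-odd _ r))))
      where
      d : ∀ s → b xor odd (size l) ≡ s →
          Dec (OddAt b (size l) × NoClosedPrefix (equiv r) (λ x → OddAt b (size l + suc x)))
      d false eq = no λ (p , _) → contradiction (≡.trans (≡.sym p) eq) λ ()
      d true  eq = map′
        (λ f → eq , λ y yk p → f y yk (oddAt-glue⁺ b (size l) eq y p))
        (λ (_ , f) y yk p → f y yk (oddAt-glue⁻ b (size l) eq y p))
        (evenSpine? false r)
      d-correct : ∀ s (eq : b xor odd (size l) ≡ s) → 𝟙 (d s eq) ≡ (if s then evenSpine false r else 0)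
      d-correct false eq = refl
      d-correct true  eq = ≡.trans
        (𝟙-cong (d true eq) (evenSpine? false r)
          (λ (_ , f) y yk p → f y yk (oddAt-glue⁻ b (size l) eq y p))
          (λ f → eq , λ y yk p → f y yk (oddAt-glue⁺ b (size l) eq y p)))
        (evenSpine-correct false r)

  module _ {m : ℕ} (E : NCEquiv m) where

    restrict : ∀ {j} → j ≤ m → NCEquiv j
    restrict {j} j≤m = record
      { rel      = λ x y → rel E x y × x < j × y < j
      ; rel?     = λ x y → rel? E x y ×-dec (x <? j ×-dec y <? j)
      ; bound    = proj₁ ∘ proj₂
      ; ~-refl   = λ h → ~-refl E (<-≤-trans h j≤m) , h , h
      ; ~-sym    = λ (h , x , y) → ~-sym E h , y , x
      ; ~-trans  = λ (h , x , _) (g , _ , z) → ~-trans E h g , x , z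
      ; crossing = λ ab bc cd (h , x , _) (g , y , _) → crossing E ab bc cd h g , x , y
      }

    drop : ∀ i {k} → m ≡ i + k → NCEquiv k
    drop i {k} eq = record
      { rel      = λ x y → rel E (i + x) (i + y)
      ; rel?     = λ x y → rel? E (i + x) (i + y)
      ; bound    = λ h → +-cancelˡ-< i _ _ (<-≤-trans (bound E h) (≤-reflexive eq))
      ; ~-refl   = λ h → ~-refl E (<-≤-trans (+-monoʳ-< i h) (≤-reflexive (≡.sym eq)))
      ; ~-sym    = ~-sym E
      ; ~-trans  = ~-trans E
      ; crossing = λ ab bc cd → crossing E (+-monoʳ-< i ab) (+-monoʳ-< i bc) (+-monoʳ-< i cd)
      }

  -- The root has to be the largest point `j` of the block of 0; the points below and above `j` form
  -- the subtrees, as no block meets both sides.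
  toTree : ∀ n (E : NCEquiv n) → ∃[ t ] size t ≡ n × E ≃ᴱ equiv t
  toTree = <-rec _ step
    where
    step : ∀ n → (∀ {m} → m < n → (E : NCEquiv m) → ∃[ t ] size t ≡ m × E ≃ᴱ equiv t) →
           (E : NCEquiv n) → ∃[ t ] size t ≡ n × E ≃ᴱ equiv t
    step zero    rec E = leaf , refl , (λ h → contradiction (bound E h) λ ()) , λ ()
    step (suc n) rec E with greatest (rel? E 0) (suc n) (s≤s z≤n) (~-refl E (s≤s z≤n))
    ... | j , j<1+n , 0~j , max
      with rec j<1+n (restrict E (<⇒≤ j<1+n))
         | rec {n ∸ j} (s≤s (m∸n≤m n j)) (drop E (suc j) (cong suc (≡.sym (m+[n∸m]≡n (≤-pred j<1+n)))))
    ...   | l , refl , l⊆ , ⊆l | r , |r| , r⊆ , ⊆r = node l r , size≡ , (λ {x} {y} h → to (side j x) (side j y) h)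
                                        , λ {x} {y} h → from (side j x) (side j y) h
      where
      T : NCEquiv (size (node l r))
      T = equiv (node l r)
      size≡ : size l + suc (size r) ≡ suc n
      size≡ = ≡.trans (+-suc (size l) (size r)) (cong suc (≡.trans (cong (size l +_) |r|) (m+[n∸m]≡n (≤-pred j<1+n))))
      -- A relation from a positive `x` below `j` to a point above `j` crosses the one from 0 to
      -- `j`, so that point is in the block of 0, against the choice of `j` as its maximum.
      reach : ∀ x {y} → x < j → rel E x (j + suc y) → rel E 0 (j + suc y)
      reach zero        xj h = h
      reach (suc x) {y} xj h = ~-trans E (crossing E (s≤s z≤n) xj (m<m+suc j y) 0~j h) h
      right≁ : ∀ {x y} → Side j x → x ≤ j → ¬ rel E x (j + suc y)
      right≁ {y = y} (isLeft {x} xj) _ h = max (bound′ E h) (m<m+suc j y) (reach x xj h)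
      right≁ {y = y} isRoot      _ h = max (bound′ E h) (m<m+suc j y) (~-trans E 0~j h)
      right≁ {y = y} (isRight x) x≤j _ = contradiction (m<m+suc j x) (≤⇒≯ x≤j)
      suc-shift : ∀ x → suc j + x ≡ j + suc x
      suc-shift x = ≡.sym (+-suc j x)
      to : ∀ {x y} → Side j x → Side j y → rel E x y → rel T x y
      to (isLeft xj) (isLeft yj) h = glue-left⁺ (equiv l) (equiv r) (l⊆ (h , xj , yj))
      to (isLeft xj) isRoot      h = glue-root⁺ (equiv l) (equiv r)
        (l⊆ (~-trans E 0~j (~-sym E h) , ≤-<-trans z≤n xj , xj))
      to isRoot      (isLeft yj) h = ~-sym T (glue-root⁺ (equiv l) (equiv r)
        (l⊆ (~-trans E 0~j h , ≤-<-trans z≤n yj , yj)))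
      to isRoot      isRoot      h = ~-refl T (m<m+suc j (size r))
      to (isLeft xj) (isRight y) h = contradiction h (right≁ (isLeft xj) (<⇒≤ xj))
      to isRoot      (isRight y) h = contradiction h (right≁ isRoot ≤-refl)
      to (isRight x) (isLeft yj) h = contradiction (~-sym E h) (right≁ (isLeft yj) (<⇒≤ yj))
      to (isRight x) isRoot      h = contradiction (~-sym E h) (right≁ isRoot ≤-refl)
      to (isRight x) (isRight y) h = glue-right⁺ (equiv l) (equiv r)
        (r⊆ (subst₂ (rel E) (≡.sym (suc-shift x)) (≡.sym (suc-shift y)) h))
      from : ∀ {x y} → Side j x → Side j y → rel T x y → rel E x y
      from (isLeft xj) (isLeft yj) h = proj₁ (⊆l (glue-left⁻ (equiv l) (equiv r) xj yj h))
      from (isLeft xj) isRoot      h =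
        ~-trans E (~-sym E (proj₁ (⊆l (glue-root⁻ (equiv l) (equiv r) xj h)))) 0~j
      from isRoot      (isLeft yj) h = ~-trans E (~-sym E 0~j)
        (proj₁ (⊆l (glue-root⁻ (equiv l) (equiv r) yj (~-sym T h))))
      from isRoot      isRoot      h = ~-refl E j<1+n
      from (isLeft xj) (isRight y) h = contradiction h (glue-separates (equiv l) (equiv r) (<⇒≤ xj))
      from isRoot      (isRight y) h = contradiction h (glue-separates (equiv l) (equiv r) ≤-refl)
      from (isRight x) (isLeft yj) h = contradiction (~-sym T h) (glue-separates (equiv l) (equiv r) (<⇒≤ yj))
      from (isRight x) isRoot      h = contradiction (~-sym T h) (glue-separates (equiv l) (equiv r) ≤-refl)
      from (isRight x) (isRight y) h =
        subst₂ (rel E) (suc-shift x) (suc-shift y) (⊆r (glue-right⁻ (equiv l) (equiv r) h))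

  -- The relation determines the size of the left subtree, which is the largest point in the block
  -- of 0; after that both subtrees can be read off.
  equiv-injective : ∀ {t t′} → size t ≡ size t′ → equiv t ≃ᴱ equiv t′ → t ≡ t′
  equiv-injective {leaf}     {leaf}       _  _       = refl
  equiv-injective {leaf}     {node l r}   eq _       = contradiction (≡.sym eq) (m+1+n≢0 (size l))
  equiv-injective {node l r} {leaf}       eq _       = contradiction eq (m+1+n≢0 (size l))
  equiv-injective {node l r} {node l′ r′} eq (f , g) =
    cong₂ node (equiv-injective |l| (left-⊆ {l} {r} {l′} {r′} |l| f , left-⊆ {l′} {r′} {l} {r} (≡.sym |l|) g))
               (equiv-injective (suc-injective (+-cancelˡ-≡ (size l) _ _ (≡.trans eq (cong (_+ suc (size r′)) (≡.sym |l|)))))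
                 (right-⊆ {l} {r} {l′} {r′} |l| f , right-⊆ {l′} {r′} {l} {r} (≡.sym |l|) g))
    where
    not-longer : ∀ {l r l′ r′} → equiv (node l r) ⊆ᴱ equiv (node l′ r′) → ¬ size l′ < size l
    not-longer {l} {r} {l′} {r′} f h = glue-separates (equiv l′) (equiv r′) z≤n
      (subst (rel (equiv (node l′ r′)) 0) (m+suc[n∸suc-m] (size l′) h)
        (f (glue-0~root (equiv l) (equiv r) (≤-<-trans z≤n h))))
    |l| : size l ≡ size l′
    |l| = ≤-antisym (≮⇒≥ (not-longer {l} {r} {l′} {r′} f)) (≮⇒≥ (not-longer {l′} {r′} {l} {r} g))
    left-⊆ : ∀ {l r l′ r′} → size l ≡ size l′ → equiv (node l r) ⊆ᴱ equiv (node l′ r′) → equiv l ⊆ᴱ equiv l′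
    left-⊆ {l} {r} {l′} {r′} e f h = glue-left⁻ (equiv l′) (equiv r′)
      (subst (_ <_) e (bound (equiv l) h)) (subst (_ <_) e (bound′ (equiv l) h)) (f (glue-left⁺ (equiv l) (equiv r) h))
    right-⊆ : ∀ {l r l′ r′} → size l ≡ size l′ → equiv (node l r) ⊆ᴱ equiv (node l′ r′) → equiv r ⊆ᴱ equiv r′
    right-⊆ {l} {r} {l′} {r′} e f {x} {y} h = glue-right⁻ (equiv l′) (equiv r′)
      (subst (λ j → rel (equiv (node l′ r′)) (j + suc x) (j + suc y)) e (f (glue-right⁺ (equiv l) (equiv r) h)))

open Trees

-- The potential L + 2e and the distance from the pairing.

module Distance where

  open import Data.Bool using (Bool; false; not)
  open import Data.Bool.Properties as Bool using (T-≡)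
  open import Data.Empty using (⊥-elim)
  open import Data.Fin using (toℕ; fromℕ<)
  open import Data.Fin.Properties using (toℕ-fromℕ<)
  open import Data.Nat hiding (_≟_)
  open import Data.Nat.Properties as ℕ hiding (_≟_)
  open import Data.Nat.Solver using (module +-*-Solver)
  open import Data.Product using (∃-syntax; _×_; _,_; proj₁; proj₂)
  open import Data.Sum using (_⊎_; inj₁; inj₂)
  open import Data.Unit using (tt)
  open import Data.Vec using (lookup)
  open import Data.Vec.Properties using (lookup∘tabulate; lookup⇒[]=; []=⇒lookup)
  open import Function using (_∘_; Equivalence; case_of_)
  open import Relation.Binary.Definitions using (tri<; tri≈; tri>)
  open import Relation.Binary.PropositionalEquality as ≡ using (_≡_; refl; cong; cong₂; subst; subst₂)
  open import Relation.Nullary using (¬_; Dec; yes; no; contradiction)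
  open import Relation.Nullary.Decidable using (_×-dec_; ¬?; decidable-stable)

  -- The leaf count `leaves`, carried over by `toTree`. For `n = 0` both numbers on the left are 0,
  -- hence the hypothesis.
  euler : ∀ {n} (E : NCEquiv n) → 0 < n → blocks E + lasts E ⊤? ≡ suc n
  euler {n} E 0<n with toTree n E
  ... | leaf       , refl , _ = contradiction 0<n λ ()
  ... | t@(node _ _) , refl , e = ≡.trans
    (cong₂ _+_ (≡.trans (blocks-cong {E = E} {equiv t} e) (blocks-equiv t))
               (≡.trans (lasts-cong {E = E} {equiv t} e ⊤?) (lasts-equiv-⊤ t)))
    (leaves t)

  odd? : ∀ x → Dec (OddAt false x)
  odd? = oddAt? false

  module _ {n : ℕ} where

    #blocks #odd : NC n → ℕ
    #blocks ρ = blocks (toEquiv ρ)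
    #odd ρ = lasts (toEquiv ρ) odd?

    potential : NC n → ℕ
    potential ρ = #blocks ρ + 2 * #odd ρ

    difference : {π ρ : NC n} → π ⊏ ρ → ∃[ u ] ∃[ v ] u < v × rel (toEquiv ρ) u v × ¬ rel (toEquiv π) u v
    difference {π} {ρ} (π⊑ρ , π≢ρ)
      with anyUpTo? (λ u → anyUpTo? (λ v → rel? (toEquiv ρ) u v ×-dec ¬? (rel? (toEquiv π) u v)) n) n
    ... | yes (u , _ , v , _ , h , ¬h) with <-cmp u v
    ...   | tri< uv _ _   = u , v , uv , h , ¬h
    ...   | tri≈ _ refl _ = contradiction (~-refl (toEquiv π) (bound (toEquiv ρ) h)) ¬h
    ...   | tri> _ _ vu   = v , u , vu , ~-sym (toEquiv ρ) h , ¬h ∘ ~-sym (toEquiv π)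
    difference {π} {ρ} (π⊑ρ , π≢ρ) | no none = contradiction
      (toEquiv-injective {π = π} {ρ} (⊑⇒⊆ᴱ {π = π} {ρ} π⊑ρ , back)) π≢ρ
      where
      back : toEquiv ρ ⊆ᴱ toEquiv π
      back {u} {v} h with rel? (toEquiv π) u v
      ... | yes g = g
      ... | no ¬g = ⊥-elim (none (u , bound (toEquiv ρ) h , v , bound′ (toEquiv ρ) h , h , ¬g))

    #blocks-strict : {π ρ : NC n} → π ⊏ ρ → #blocks ρ < #blocks π
    #blocks-strict {π} {ρ} h =
      let _ , _ , _ , g , ¬g = difference {π} {ρ} h
      in blocks-strict {E = toEquiv π} {toEquiv ρ} (⊑⇒⊆ᴱ {π = π} {ρ} (proj₁ h)) g ¬g

    -- The number of blocks strictly decreases along `_⊏_`, so a drop by one leaves no room in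
    -- between.
    cover : {π τ : NC n} → π ⊑ τ → #blocks π ≡ suc (#blocks τ) → π ⋖ τ
    cover {π} {τ} π⊑τ eq = (π⊑τ , λ { refl → 1+n≢n (≡.sym eq) }) ,
      λ (σ , πσ , στ) → <⇒≱ (#blocks-strict {σ} {τ} στ)
        (≤-pred (subst (#blocks σ <_) eq (#blocks-strict {π} {σ} πσ)))

    module Merge (π : NC n) {a b : ℕ} (a<n : a < n) (b<n : b < n) (a<b : a < b)
      (gap : ∀ {u v} → a < u → u < b → rel (toEquiv π) u v → a ≤ v × v ≤ b) where

      opaque
        merged : NC n
        merged = fromEquiv (merge (toEquiv π) a<n b<n a<b gap)

        iso : toEquiv merged ≃ᴱ merge (toEquiv π) a<n b<n a<b gap
        iso = toEquiv-fromEquiv (merge (toEquiv π) a<n b<n a<b gap)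

      merged-rel : toEquiv merged ⊆ᴱ merge (toEquiv π) a<n b<n a<b gap
      merged-rel = proj₁ iso

      ⊑-merged : π ⊑ merged
      ⊑-merged = ⊆ᴱ⇒⊑ {π = π} {merged} (proj₂ iso ∘ ⊆-merge (toEquiv π) a<n b<n a<b gap)

      merged-⊑ : {ρ : NC n} → π ⊑ ρ → rel (toEquiv ρ) a b → merged ⊑ ρ
      merged-⊑ {ρ} h ab = ⊆ᴱ⇒⊑ {π = merged} {ρ}
        (merge-⊆ (toEquiv π) a<n b<n a<b gap {toEquiv ρ} (⊑⇒⊆ᴱ {π = π} {ρ} h) ab ∘ proj₁ iso)

      #blocks-merged : ¬ rel (toEquiv π) a b → #blocks π ≡ suc (#blocks merged)
      #blocks-merged ne = ≡.trans (blocks-merge (toEquiv π) a<n b<n a<b gap ne)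
        (cong suc (≡.sym (blocks-cong {E = toEquiv merged} {merge (toEquiv π) a<n b<n a<b gap} iso)))

    -- Two points that are consecutive in a block of `ρ` but apart in `π` can be merged; this costs
    -- one block, hence gives a cover, and does not leave the partitions below `ρ`.
    refine : {π ρ : NC n} → π ⊏ ρ → ∃[ τ ] π ⋖ τ × τ ⊑ ρ × #blocks π ≡ suc (#blocks τ)
    refine {π} {ρ} h with difference {π} {ρ} h
    ... | u , v , u<v , g , ¬g
      with consecutive {E = toEquiv π} {toEquiv ρ} (⊑⇒⊆ᴱ {π = π} {ρ} (proj₁ h)) v (m≤m+n v u) u<v g ¬g
    ...   | a , b , a<b , ab , ¬ab , none =
      merged , cover {π} {merged} ⊑-merged (#blocks-merged ¬ab) , merged-⊑ {ρ} (proj₁ h) ab , #blocks-merged ¬ab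
      where
      open Merge π (bound (toEquiv ρ) ab) (bound′ (toEquiv ρ) ab) a<b
        (consecutive-gap {E = toEquiv π} {toEquiv ρ} (⊑⇒⊆ᴱ {π = π} {ρ} (proj₁ h)) ab none)

    -- The cover `τ` found by `refine` cannot lie strictly between `π` and `ρ`, so it is `ρ`: every
    -- cover is a merge.
    #blocks-cover : {π ρ : NC n} → π ⋖ ρ → #blocks π ≡ suc (#blocks ρ)
    #blocks-cover {π} {ρ} (lt , none) = case refine {π} {ρ} lt of λ
      { (τ , (πτ , _) , τρ , eq) → case τ ≟ ρ of λ
        { (yes τ≡ρ) → subst (λ σ → #blocks π ≡ suc (#blocks σ)) τ≡ρ eq
        ; (no ne)   → contradiction (τ , πτ , τρ , ne) none } }

    climb : ∀ fuel {π ρ : NC n} → #blocks π ≤ fuel → π ⊑ ρ → ∃[ k ] k + #blocks ρ ≡ #blocks π × Walk k π ρ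
    climb fuel {π} {ρ} le h = case π ≟ ρ of λ
      { (yes refl) → 0 , refl , nil
      ; (no ne)    → case refine {π} {ρ} (h , ne) of λ
        { (τ , πτ , τρ , eq) → onward fuel le πτ τρ eq } }
      where
      onward : ∀ fuel {τ} → #blocks π ≤ fuel → π ⋖ τ → τ ⊑ ρ → #blocks π ≡ suc (#blocks τ) →
               ∃[ k ] k + #blocks ρ ≡ #blocks π × Walk k π ρ
      onward zero       le πτ τρ eq = contradiction (subst (_≤ 0) eq le) λ ()
      onward (suc fuel) {τ} le πτ τρ eq =
        let k , k+ , w = climb fuel {τ} {ρ} (≤-pred (subst (_≤ suc fuel) eq le)) τρ
        in suc k , ≡.trans (cong suc k+) (≡.sym eq) , cons (inj₁ πτ) w

    -- Passing to a cover merges two blocks, so splits one block of the Kreweras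
    -- complement; hence the number of blocks there meeting the odd positions
    -- grows by 0 or 1.
    potential-cover : 0 < n → {π ρ : NC n} → π ⋖ ρ → potential π ≤ suc (potential ρ) × potential ρ ≤ suc (potential π)
    potential-cover 0<n {π} {ρ} h =
        subst (λ L → L + 2 * #odd π ≤ suc (potential ρ)) (≡.sym L-eq)
          (s≤s (+-monoʳ-≤ (#blocks ρ) (*-monoʳ-≤ 2 odd-≤)))
      , ≤-pred (≤-trans (≤-reflexive (cong (_+ 2 * #odd ρ) (≡.sym L-eq)))
          (≤-trans (+-monoʳ-≤ (#blocks π) (*-monoʳ-≤ 2 odd-≥))
            (≤-reflexive (solve 2 (λ a b → a :+ con 2 :* (con 1 :+ b) := con 2 :+ (a :+ con 2 :* b)) refl (#blocks π) (#odd π)))))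
      where
      open +-*-Solver
      P R : NCEquiv n
      P = toEquiv π
      R = toEquiv ρ
      P⊆R : P ⊆ᴱ R
      P⊆R = ⊑⇒⊆ᴱ {π = π} {ρ} (proj₁ (proj₁ h))
      L-eq : #blocks π ≡ suc (#blocks ρ)
      L-eq = #blocks-cover {π} {ρ} h
      odd-≤ : #odd π ≤ #odd ρ
      odd-≤ = lasts-mono {E = P} {R} P⊆R odd?
      lasts-eq : lasts R ⊤? ≡ suc (lasts P ⊤?)
      lasts-eq = +-cancelˡ-≡ (blocks R) _ _ (≡.trans (≡.trans (euler R 0<n) (≡.sym (euler P 0<n)))
        (≡.trans (cong (_+ lasts P ⊤?) L-eq) (≡.sym (+-suc (blocks R) (lasts P ⊤?)))))
      odd-≥ : #odd ρ ≤ suc (#odd π)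
      odd-≥ = +-cancelʳ-≤ (avoiding P odd?) _ _
        (≤-trans (+-monoʳ-≤ (#odd ρ) (avoiding-mono {E = P} {R} P⊆R odd?))
          (≤-reflexive (≡.trans (≡.sym (lasts-partition R odd?)) (≡.trans lasts-eq
            (cong suc (lasts-partition P odd?))))))

    potential-step : 0 < n → {π ρ : NC n} → π ∼ ρ → potential ρ ≤ suc (potential π)
    potential-step 0<n {π} {ρ} (inj₁ h) = proj₂ (potential-cover 0<n {π} {ρ} h)
    potential-step 0<n {π} {ρ} (inj₂ h) = proj₁ (potential-cover 0<n {ρ} {π} h)

    potential-walk : 0 < n → ∀ {k} {π ρ : NC n} → Walk k π ρ → potential ρ ≤ k + potential π
    potential-walk 0<n nil = ≤-refl
    potential-walk 0<n {suc k} {π} {ρ} (cons {σ = σ} e w) = ≤-trans (potential-walk 0<n w)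
      (≤-trans (+-monoʳ-≤ k (potential-step 0<n {π} {σ} e)) (≤-reflexive (+-suc k (potential π))))

  data Half : ℕ → Set where
    evenʰ : ∀ i → Half (2 * i)
    oddʰ  : ∀ i → Half (suc (2 * i))

  2*suc : ∀ i → 2 * suc i ≡ suc (suc (2 * i))
  2*suc i = cong suc (+-suc i (i + 0))

  half : ∀ x → Half x
  half zero    = evenʰ 0
  half (suc x) with half x
  ... | evenʰ i = oddʰ i
  ... | oddʰ i  = subst Half (2*suc i) (evenʰ (suc i))

  odd-2* : ∀ i → odd (2 * i) ≡ false
  odd-2* zero    = refl
  odd-2* (suc i) = ≡.trans (cong odd (2*suc i)) (≡.trans (Bool.not-involutive _) (odd-2* i))

  oddAt-odd : ∀ i → OddAt false (suc (2 * i))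
  oddAt-odd i = cong not (odd-2* i)

  oddAt-even : ∀ i → ¬ OddAt false (2 * i)
  oddAt-even i h with ≡.trans (≡.sym h) (odd-2* i)
  ... | ()

  ⌊2*/2⌋ : ∀ i → ⌊ 2 * i /2⌋ ≡ i
  ⌊2*/2⌋ zero    = refl
  ⌊2*/2⌋ (suc i) = ≡.trans (cong ⌊_/2⌋ (2*suc i)) (cong suc (⌊2*/2⌋ i))

  ⌊1+2*/2⌋ : ∀ i → ⌊ suc (2 * i) /2⌋ ≡ i
  ⌊1+2*/2⌋ zero    = refl
  ⌊1+2*/2⌋ (suc i) = ≡.trans (cong (⌊_/2⌋ ∘ suc) (2*suc i)) (cong suc (⌊1+2*/2⌋ i))

  2*<⇒< : ∀ {i m} → 2 * i < 2 * m → i < m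
  2*<⇒< {i} {m} = *-cancelˡ-< 2 i m

  1+2*< : ∀ {i m} → i < m → suc (2 * i) < 2 * m
  1+2*< {i} {m} h = ≤-trans (≤-reflexive (≡.sym (2*suc i))) (*-monoʳ-≤ 2 h)

  count-even : ∀ {P : ℕ → Set} (P? : ∀ x → Dec (P x)) m →
               (∀ {i} → i < m → P (2 * i)) → (∀ {i} → i < m → ¬ P (suc (2 * i))) → count P? (2 * m) ≡ m
  count-even P? zero    f g = refl
  count-even P? (suc m) f g = ≡.trans (cong (count P?) (2*suc m)) (≡.trans
    (cong₂ _+_ (cong₂ _+_ (count-even P? m (λ h → f (m<n⇒m<1+n h)) (λ h → g (m<n⇒m<1+n h)))
      (𝟙-yes (P? (2 * m)) (f ≤-refl))) (𝟙-no (P? (suc (2 * m))) (g ≤-refl)))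
    (≡.trans (+-identityʳ (m + 1)) (+-comm m 1)))

  module _ (m : ℕ) where

    private
      Λ : NCEquiv (2 * m)
      Λ = toEquiv (λ₂ m)

      entry : ∀ i j → lookup (block (λ₂ m) i) j ≡ (⌊ toℕ i /2⌋ ≡ᵇ ⌊ toℕ j /2⌋)
      entry i j = ≡.trans (cong (λ v → lookup v j) (lookup∘tabulate _ i)) (lookup∘tabulate _ j)

      opaque
        unfolding toEquiv

        Λ⁻ : ∀ {x y} → rel Λ x y → ⌊ x /2⌋ ≡ ⌊ y /2⌋
        Λ⁻ (i , j , refl , refl , h) = ≡ᵇ⇒≡ _ _ (Equivalence.from T-≡ (≡.trans (≡.sym (entry i j)) ([]=⇒lookup h)))

        Λ⁺ : ∀ {x y} → x < 2 * m → y < 2 * m → ⌊ x /2⌋ ≡ ⌊ y /2⌋ → rel Λ x y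
        Λ⁺ xn yn e = fromℕ< xn , fromℕ< yn , toℕ-fromℕ< xn , toℕ-fromℕ< yn ,
          lookup⇒[]= _ _ (≡.trans (entry _ _) (Equivalence.to T-≡ (≡⇒≡ᵇ _ _
            (subst₂ (λ x y → ⌊ x /2⌋ ≡ ⌊ y /2⌋) (≡.sym (toℕ-fromℕ< xn)) (≡.sym (toℕ-fromℕ< yn)) e))))

      Pairs : NCEquiv (2 * m) → Set
      Pairs E = ∀ {i} → i < m → rel E (2 * i) (suc (2 * i))

      Λ-pairs : Pairs Λ
      Λ-pairs {i} h = Λ⁺ (<-trans (n<1+n _) (1+2*< h)) (1+2*< h) (≡.trans (⌊2*/2⌋ i) (≡.sym (⌊1+2*/2⌋ i)))

      Λ⊆ : (E : NCEquiv (2 * m)) → Pairs E → Λ ⊆ᴱ E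
      Λ⊆ E pairs {x} {y} h = go (half x) (half y) (bound Λ h) (bound′ Λ h) (Λ⁻ h)
        where
        pair : ∀ i → suc (2 * i) < 2 * m → rel E (2 * i) (suc (2 * i))
        pair i h = pairs (2*<⇒< {i} (<-trans (n<1+n _) h))
        go : ∀ {x y} → Half x → Half y → x < 2 * m → y < 2 * m → ⌊ x /2⌋ ≡ ⌊ y /2⌋ → rel E x y
        go (evenʰ i) (evenʰ j) xn yn e with ≡.trans (≡.sym (⌊2*/2⌋ i)) (≡.trans e (⌊2*/2⌋ j))
        ... | refl = ~-refl E xn
        go (evenʰ i) (oddʰ j)  xn yn e with ≡.trans (≡.sym (⌊2*/2⌋ i)) (≡.trans e (⌊1+2*/2⌋ j))
        ... | refl = pair i yn
        go (oddʰ i)  (evenʰ j) xn yn e with ≡.trans (≡.sym (⌊1+2*/2⌋ i)) (≡.trans e (⌊2*/2⌋ j))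
        ... | refl = ~-sym E (pair i xn)
        go (oddʰ i)  (oddʰ j)  xn yn e with ≡.trans (≡.sym (⌊1+2*/2⌋ i)) (≡.trans e (⌊1+2*/2⌋ j))
        ... | refl = ~-refl E xn

      opaque
        unfolding blocks

        blocks-Λ : blocks Λ ≡ m
        blocks-Λ = count-even (first? Λ) m (λ {i} _ → at-even i)
          (λ {i} h f → f (n<1+n (2 * i)) (Λ-pairs h))
          where
          at-even : ∀ i → First Λ (2 * i)
          at-even i {y} y< h with half y
          ... | evenʰ j = <⇒≢ y< (cong (2 *_) (≡.trans (≡.sym (⌊2*/2⌋ j)) (≡.trans (Λ⁻ h) (⌊2*/2⌋ i))))
          ... | oddʰ j  = <⇒≱ y< (≤-trans (≤-reflexive (cong (2 *_) (≡.trans (≡.sym (⌊2*/2⌋ i))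
                           (≡.trans (≡.sym (Λ⁻ h)) (⌊1+2*/2⌋ j))))) (n≤1+n _))

      -- An even position 2i separates the points 2i and 2i+1 of one block, so
      -- it is a singleton of the Kreweras complement.
      opaque
        unfolding avoiding

        avoiding-pairs : (E : NCEquiv (2 * m)) → Pairs E → avoiding E odd? ≡ m
        avoiding-pairs E pairs = count-even (λ x → last? E ⊤? x ×-dec avoids? E odd? x) m
          (λ {i} h → (tt , λ yn xy _ s → after h xy s) , λ yn y-odd (s , t) → apart h y-odd (s , t))
          (λ {i} h (_ , av) → av (1+2*< h) (oddAt-odd i) (≈-refl E))
          where
          after : ∀ {i y} → i < m → 2 * i < y → ¬ Saturated E (2 * i) y
          after {i} h xy s = <-irrefl refl
            (proj₁ (s (suc (2 * i)) (2 * i) (~-sym E (pairs h)) (n<1+n _) xy))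
          apart : ∀ {i y} → i < m → OddAt false y → ¬ (Saturated E (2 * i) y × Saturated E y (2 * i))
          apart {i} {y} h y-odd (s , t) with <-cmp (2 * i) y
          ... | tri< xy _ _   = after h xy s
          ... | tri≈ _ refl _ = oddAt-even i y-odd
          ... | tri> _ _ yx   = 1+n≰n (proj₂ (t (2 * i) (suc (2 * i)) (pairs h) yx ≤-refl))

    module _ (0<m : 0 < m) where

      private
        0<2m : 0 < 2 * m
        0<2m = ≤-trans 0<m (m≤m+n m (m + 0))

        -- By `euler` the complement has 2m + 1 - L blocks. The even positions are m of them, and
        -- the remaining ones are those counted by e.
        odd-pairs : (ρ : NC (2 * m)) → Pairs (toEquiv ρ) → #blocks ρ + #odd ρ ≡ suc m
        odd-pairs ρ pairs = +-cancelʳ-≡ m _ _ (≡.trans (+-assoc (#blocks ρ) (#odd ρ) m) (≡.trans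
          (cong (#blocks ρ +_) (≡.trans (cong (#odd ρ +_) (≡.sym (avoiding-pairs (toEquiv ρ) pairs)))
            (≡.sym (lasts-partition (toEquiv ρ) odd?))))
          (≡.trans (euler (toEquiv ρ) 0<2m) (cong (λ k → suc (m + k)) (+-identityʳ m)))))

        potential-λ : potential (λ₂ m) ≡ m + 2
        potential-λ = cong₂ (λ L e → L + 2 * e) blocks-Λ
          (+-cancelˡ-≡ m _ _ (≡.trans (cong (_+ #odd (λ₂ m)) (≡.sym blocks-Λ))
            (≡.trans (odd-pairs (λ₂ m) Λ-pairs) (+-comm 1 m))))

        DownTo : NC (2 * m) → Set
        DownTo ρ = ∃[ k ] k + (m + 2) ≡ potential ρ × Walk k ρ (λ₂ m)

        -- Now e = m + 1 - L, so the potential is m + 2 + (m - L), and m - L is the length of the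
        -- chain of covers from `λ₂ m` up to `ρ` that `climb` provides.
        descend-pairs : (ρ : NC (2 * m)) → Pairs (toEquiv ρ) → DownTo ρ
        descend-pairs ρ pairs =
          let k , k+ , w = climb _ {λ₂ m} {ρ} ≤-refl (⊆ᴱ⇒⊑ {π = λ₂ m} {ρ} (Λ⊆ (toEquiv ρ) pairs))
          in k , sums k k+ , reverseʷ w
          where
          open +-*-Solver
          sums : ∀ k → k + #blocks ρ ≡ #blocks (λ₂ m) → k + (m + 2) ≡ #blocks ρ + 2 * #odd ρ
          sums k k+ = +-cancelˡ-≡ (#blocks ρ) _ _ (begin
            #blocks ρ + (k + (m + 2))
              ≡⟨ solve 3 (λ a k m → a :+ (k :+ (m :+ con 2)) := (k :+ a) :+ (m :+ con 2)) refl (#blocks ρ) k m ⟩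
            (k + #blocks ρ) + (m + 2)          ≡⟨ cong (_+ (m + 2)) (≡.trans k+ blocks-Λ) ⟩
            m + (m + 2)                        ≡⟨ solve 1 (λ m → m :+ (m :+ con 2) := con 2 :* (con 1 :+ m)) refl m ⟩
            2 * suc m                          ≡⟨ cong (2 *_) (odd-pairs ρ pairs) ⟨
            2 * (#blocks ρ + #odd ρ)
              ≡⟨ solve 2 (λ a e → con 2 :* (a :+ e) := a :+ (a :+ con 2 :* e)) refl (#blocks ρ) (#odd ρ) ⟩
            #blocks ρ + (#blocks ρ + 2 * #odd ρ) ∎)
            where open ≡.≡-Reasoning

        -- Odd end points cannot separate 2i from 2i+1, so merging the blocks
        -- of these two points keeps the intervals between odd positions saturated.
        module Join (ρ : NC (2 * m)) {i : ℕ} (i<m : i < m) where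

          private
            E : NCEquiv (2 * m)
            E = toEquiv ρ
            gap : ∀ {u v} → 2 * i < u → u < suc (2 * i) → rel E u v → 2 * i ≤ v × v ≤ suc (2 * i)
            gap au ub _ = contradiction (≤-pred ub) (<⇒≱ au)

          open Merge ρ (<-trans (n<1+n _) (1+2*< i<m)) (1+2*< i<m) (n<1+n _) gap public

          private
            saturated-merged : ∀ {x y} → OddAt false x → OddAt false y → Saturated E x y → Saturated (toEquiv merged) x y
            saturated-merged {x} {y} x-odd y-odd s u v h xu uy with merged-rel h
            ... | inj₁ g = s u v g xu uy
            ... | inj₂ (Iu , Iv) = both Iv
              where
              right-in : x < suc (2 * i) × suc (2 * i) ≤ y → x < 2 * i × 2 * i ≤ y
              right-in (p , q) = ≤∧≢⇒< (≤-pred p) (λ { refl → oddAt-even i x-odd }) , <⇒≤ q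
              left-in : x < 2 * i × 2 * i ≤ y → x < suc (2 * i) × suc (2 * i) ≤ y
              left-in (p , q) = m<n⇒m<1+n p , ≤∧≢⇒< q (λ { refl → oddAt-even i y-odd })
              in-left : rel E (2 * i) u ⊎ rel E (suc (2 * i)) u → x < 2 * i × 2 * i ≤ y
              in-left (inj₁ g) = s u (2 * i) (~-sym E g) xu uy
              in-left (inj₂ g) = right-in (s u (suc (2 * i)) (~-sym E g) xu uy)
              both : rel E (2 * i) v ⊎ rel E (suc (2 * i)) v → x < v × v ≤ y
              both (inj₁ g) = let p , q = in-left Iu in s (2 * i) v g p q
              both (inj₂ g) = let p , q = left-in (in-left Iu) in s (suc (2 * i)) v g p q

          #odd-merged : #odd merged ≡ #odd ρ
          #odd-merged = ≤-antisym
            (lasts-≤ {E = toEquiv merged} {E} odd? λ {x} {y} → saturated-merged {x} {y})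
            (lasts-mono {E = E} {toEquiv merged} (⊑⇒⊆ᴱ {π = ρ} {merged} ⊑-merged) odd?)

        descend : ∀ fuel (ρ : NC (2 * m)) → #blocks ρ ≤ fuel → DownTo ρ
        descend fuel ρ le = case anyUpTo? (λ i → ¬? (rel? (toEquiv ρ) (2 * i) (suc (2 * i)))) m of λ
          { (no none)              → descend-pairs ρ (λ {i} → pairs none i)
          ; (yes (i , i<m , ¬g)) → onward fuel le i<m ¬g }
          where
          pairs : ¬ (∃[ i ] i < m × ¬ rel (toEquiv ρ) (2 * i) (suc (2 * i))) →
                  ∀ i → i < m → rel (toEquiv ρ) (2 * i) (suc (2 * i))
          pairs none i h = decidable-stable (rel? (toEquiv ρ) (2 * i) (suc (2 * i))) λ ¬g → none (i , h , ¬g)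
          onward : ∀ fuel {i} → #blocks ρ ≤ fuel → i < m → ¬ rel (toEquiv ρ) (2 * i) (suc (2 * i)) → DownTo ρ
          onward zero       le i<m ¬g = contradiction (subst (_≤ 0) (Join.#blocks-merged ρ i<m ¬g) le) λ ()
          onward (suc fuel) le i<m ¬g =
            let open Join ρ i<m
                k , k+ , w = descend fuel merged (≤-pred (subst (_≤ suc fuel) (#blocks-merged ¬g) le))
            in suc k
              , ≡.trans (cong suc k+) (cong₂ (λ L e → L + 2 * e) (≡.sym (#blocks-merged ¬g)) #odd-merged)
              , cons (inj₁ (cover {π = ρ} {merged} ⊑-merged (#blocks-merged ¬g))) w

      -- The walk found by `descend` bounds the distance from above; from below, no step of a walk
      -- starting at `λ₂ m` raises the potential by more than 1.
      distance : (ρ : NC (2 * m)) → d-H (λ₂ m) ρ + (m + 2) ≡ potential ρ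
      distance ρ = let k , k+ , w = descend (#blocks ρ) ρ ≤-refl in ≤-antisym
        (≤-trans (+-monoˡ-≤ (m + 2) (IsDistance.minimal (d-H-isDistance (λ₂ m) ρ) k (reverseʷ w))) (≤-reflexive k+))
        (subst (λ p → potential ρ ≤ d-H (λ₂ m) ρ + p) potential-λ
          (potential-walk 0<2m (IsDistance.walk (d-H-isDistance (λ₂ m) ρ))))

open Distance

-- Listing trees by size, and the bijection with non-crossing partitions.

module Enumeration where

  open import Data.Bool using (false)
  open import Data.List using (List; []; _∷_; _++_; map; cartesianProductWith)
  open import Data.List.Membership.Propositional using (_∈_)
  open import Data.List.Membership.Propositional.Properties
    using (∈-++⁺ˡ; ∈-++⁺ʳ; ∈-++⁻; ∈-cartesianProductWith⁺; ∈-cartesianProductWith⁻; ∈-map⁺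
      ; ∈-map⁻)
  open import Data.List.Membership.Propositional.Properties.WithK using (unique∧set⇒bag)
  open import Data.List.Properties using (map-∘; map-cong)
  open import Data.List.Relation.Binary.BagAndSetEquality using (∼bag⇒↭)
  open import Data.List.Relation.Binary.Permutation.Propositional using (_↭_)
  open import Data.List.Relation.Binary.Permutation.Propositional.Properties using (map⁺)
  import Data.List.Relation.Unary.All as All
  open import Data.List.Relation.Unary.Any using (here)
  open import Data.List.Relation.Unary.Unique.Propositional using (Unique; []; _∷_)
  open import Data.List.Relation.Unary.Unique.Propositional.Properties as Unique
    using (cartesianProductWith⁺; ++⁺)
  open import Data.Nat hiding (_≟_)
  open import Data.Nat.ListAction using (sum)
  open import Data.Nat.ListAction.Properties using (sum-↭)
  open import Data.Nat.Properties hiding (_≟_)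
  open import Data.Product using (∃-syntax; _×_; _,_; proj₁; proj₂)
  open import Data.Sum using (inj₁; inj₂)
  open import Function using (_∘_; mk⇔)
  open import Relation.Binary.PropositionalEquality as ≡ using (_≡_; refl; cong; cong₂; subst)
  open import Relation.Nullary using (¬_)

  -- The Cauchy product on the level of lists, by the same recursion as `_⊛_`; this lets `Σ-nodes`
  -- turn a sum over trees into a product of series.
  nodes : (ℕ → List Tree) → (ℕ → List Tree) → ℕ → List Tree
  nodes L R zero    = cartesianProductWith node (L 0) (R 0)
  nodes L R (suc n) = cartesianProductWith node (L 0) (R (suc n)) ++ nodes (L ∘ suc) R n

  -- The fuel bounds the height of the tree, so all trees with `n` nodes are present once it reaches
  -- `n`.
  treesWithin : ℕ → ℕ → List Tree
  treesWithin fuel       zero    = leaf ∷ []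
  treesWithin zero       (suc n) = []
  treesWithin (suc fuel) (suc n) = nodes (treesWithin fuel) (treesWithin fuel) n

  trees : ℕ → List Tree
  trees n = treesWithin n n

  nodes-cong : ∀ {L L′ R R′} n → (∀ {i} → i ≤ n → L i ≡ L′ i) → (∀ {i} → i ≤ n → R i ≡ R′ i) →
               nodes L R n ≡ nodes L′ R′ n
  nodes-cong zero    f g = cong₂ (cartesianProductWith node) (f z≤n) (g z≤n)
  nodes-cong (suc n) f g = cong₂ _++_ (cong₂ (cartesianProductWith node) (f z≤n) (g ≤-refl))
    (nodes-cong n (λ h → f (s≤s h)) (λ h → g (m≤n⇒m≤1+n h)))

  treesWithin-fuel : ∀ fuel fuel′ n → n ≤ fuel → n ≤ fuel′ → treesWithin fuel n ≡ treesWithin fuel′ n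
  treesWithin-fuel fuel       fuel′       zero    _       _       = refl
  treesWithin-fuel (suc fuel) (suc fuel′) (suc n) (s≤s h) (s≤s g) = nodes-cong n
    (λ i≤n → treesWithin-fuel fuel fuel′ _ (≤-trans i≤n h) (≤-trans i≤n g))
    (λ i≤n → treesWithin-fuel fuel fuel′ _ (≤-trans i≤n h) (≤-trans i≤n g))

  trees-suc : ∀ n → trees (suc n) ≡ nodes trees trees n
  trees-suc n = nodes-cong n (λ h → treesWithin-fuel n _ _ h ≤-refl) (λ h → treesWithin-fuel n _ _ h ≤-refl)

  ∈-nodes⁻ : ∀ {L R} n {t} → t ∈ nodes L R n →
             ∃[ i ] ∃[ j ] ∃[ l ] ∃[ r ] i + j ≡ n × l ∈ L i × r ∈ R j × t ≡ node l r
  ∈-nodes⁻ {L} {R} zero h with ∈-cartesianProductWith⁻ node (L 0) (R 0) h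
  ... | l , r , hl , hr , eq = 0 , 0 , l , r , refl , hl , hr , eq
  ∈-nodes⁻ {L} {R} (suc n) h with ∈-++⁻ (cartesianProductWith node (L 0) (R (suc n))) h
  ... | inj₁ g with ∈-cartesianProductWith⁻ node (L 0) (R (suc n)) g
  ...   | l , r , hl , hr , eq = 0 , suc n , l , r , refl , hl , hr , eq
  ∈-nodes⁻ {L} {R} (suc n) h | inj₂ g with ∈-nodes⁻ n g
  ...   | i , j , l , r , e , hl , hr , eq = suc i , j , l , r , cong suc e , hl , hr , eq

  ∈-nodes⁺ : ∀ {L R} i j {l r} → l ∈ L i → r ∈ R j → node l r ∈ nodes L R (i + j)
  ∈-nodes⁺ zero    zero    hl hr = ∈-cartesianProductWith⁺ node hl hr
  ∈-nodes⁺ zero    (suc j) hl hr = ∈-++⁺ˡ (∈-cartesianProductWith⁺ node hl hr)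
  ∈-nodes⁺ {L} {R} (suc i) j hl hr =
    ∈-++⁺ʳ (cartesianProductWith node (L 0) (R (suc (i + j)))) (∈-nodes⁺ i j hl hr)

  node-injective : ∀ {l r l′ r′} → node l r ≡ node l′ r′ → l ≡ l′ × r ≡ r′
  node-injective refl = refl , refl

  -- Different summands have left subtrees of different sizes. The offset `c` keeps the size
  -- hypothesis valid when the recursion passes to `L ∘ suc`.
  nodes-unique : ∀ {L R} c n → (∀ {i} → i ≤ n → Unique (L i)) → (∀ {i} → i ≤ n → Unique (R i)) →
                 (∀ i {t} → t ∈ L i → size t ≡ c + i) → Unique (nodes L R n)
  nodes-unique c zero    uL uR |L| = cartesianProductWith⁺ node node-injective (uL z≤n) (uR z≤n)
  nodes-unique {L} {R} c (suc n) uL uR |L| = ++⁺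
    (cartesianProductWith⁺ node node-injective (uL z≤n) (uR ≤-refl))
    (nodes-unique (suc c) n (λ h → uL (s≤s h)) (λ h → uR (m≤n⇒m≤1+n h))
      (λ i h → ≡.trans (|L| (suc i) h) (+-suc c i)))
    λ (h , g) → disjoint h g
    where
    disjoint : ∀ {t} → t ∈ cartesianProductWith node (L 0) (R (suc n)) → ¬ t ∈ nodes (L ∘ suc) R n
    disjoint h g with ∈-cartesianProductWith⁻ node (L 0) (R (suc n)) h | ∈-nodes⁻ n g
    ... | l , _ , hl , _ , refl | i , _ , _ , _ , _ , hl′ , _ , refl =
      m+1+n≢0 i (≡.trans (+-comm i 1) (+-cancelˡ-≡ c _ _ (≡.trans (≡.sym (|L| (suc i) hl′)) (|L| 0 hl))))

  size-treesWithin : ∀ fuel n {t} → t ∈ treesWithin fuel n → size t ≡ n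
  size-treesWithin fuel       zero    (here refl) = refl
  size-treesWithin (suc fuel) (suc n) h with ∈-nodes⁻ n h
  ... | i , j , l , r , refl , hl , hr , refl = ≡.trans (+-suc (size l) (size r))
    (cong suc (cong₂ _+_ (size-treesWithin fuel i hl) (size-treesWithin fuel j hr)))

  treesWithin-unique : ∀ fuel n → Unique (treesWithin fuel n)
  treesWithin-unique fuel       zero    = All.[] ∷ []
  treesWithin-unique zero       (suc n) = []
  treesWithin-unique (suc fuel) (suc n) = nodes-unique 0 n
    (λ {i} _ → treesWithin-unique fuel i) (λ {i} _ → treesWithin-unique fuel i) (λ i h → size-treesWithin fuel i h)

  ∈-trees : ∀ t → t ∈ trees (size t)
  ∈-trees leaf       = here refl
  ∈-trees (node l r) = subst (λ n → node l r ∈ trees n) (≡.sym (+-suc (size l) (size r)))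
    (subst (node l r ∈_) (≡.sym (trees-suc (size l + size r))) (∈-nodes⁺ (size l) (size r) (∈-trees l) (∈-trees r)))

  module _ {n : ℕ} where

    encode : NC n → Tree
    encode ρ = proj₁ (toTree n (toEquiv ρ))

    size-encode : ∀ ρ → size (encode ρ) ≡ n
    size-encode ρ = proj₁ (proj₂ (toTree n (toEquiv ρ)))

    encode-≃ : ∀ ρ → toEquiv ρ ≃ᴱ equiv (encode ρ)
    encode-≃ ρ = proj₂ (proj₂ (toTree n (toEquiv ρ)))

    encode-injective : ∀ {π ρ} → encode π ≡ encode ρ → π ≡ ρ
    encode-injective {π} {ρ} eq = toEquiv-injective {π = π} {ρ}
      ( (λ h → proj₂ (encode-≃ ρ) (subst (λ t → rel (equiv t) _ _) eq (proj₁ (encode-≃ π) h)))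
      , (λ h → proj₂ (encode-≃ π) (subst (λ t → rel (equiv t) _ _) (≡.sym eq) (proj₁ (encode-≃ ρ) h))))

  encode-surjective : ∀ t → encode (fromEquiv (equiv t)) ≡ t
  encode-surjective t = equiv-injective (size-encode ρ)
    ( (λ h → proj₁ (toEquiv-fromEquiv (equiv t)) (proj₂ (encode-≃ ρ) h))
    , (λ h → proj₁ (encode-≃ ρ) (proj₂ (toEquiv-fromEquiv (equiv t)) h)))
    where
    ρ : NC (size t)
    ρ = fromEquiv (equiv t)

  -- Both lists are free of duplicates and have the same members, and such lists are permutations of
  -- each other.
  encode-↭ : ∀ n → map encode (allNC n) ↭ trees n
  encode-↭ n = ∼bag⇒↭ (unique∧set⇒bag (Unique.map⁺ encode-injective (allNC-unique n)) (treesWithin-unique n n)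
    (mk⇔ (to ∘ ∈-map⁻ encode) from))
    where
    to : ∀ {t} → ∃[ ρ ] ρ ∈ allNC n × t ≡ encode ρ → t ∈ trees n
    to (ρ , _ , refl) = subst (λ k → encode ρ ∈ trees k) (size-encode ρ) (∈-trees (encode ρ))
    from : ∀ {t} → t ∈ trees n → t ∈ map encode (allNC n)
    from {t} h with size-treesWithin n n h
    ... | refl = subst (_∈ map encode (allNC n)) (encode-surjective t) (∈-map⁺ encode (allNC-complete _))

  sum-allNC : ∀ n {f : NC n → ℕ} {g : Tree → ℕ} → (∀ ρ → f ρ ≡ g (encode ρ)) →
              sum (map f (allNC n)) ≡ sum (map g (trees n))
  sum-allNC n {f} {g} e = ≡.trans (cong sum (≡.trans (map-cong e (allNC n)) (map-∘ (allNC n))))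
    (sum-↭ (map⁺ g (encode-↭ n)))

  potential-encode : ∀ {n} (ρ : NC n) → potential ρ ≡ leftLeaves (encode ρ) + 2 * oddPaths false (encode ρ)
  potential-encode ρ = transport (encode ρ) (size-encode ρ) (encode-≃ ρ)
    where
    transport : ∀ {n} {E : NCEquiv n} t → size t ≡ n → E ≃ᴱ equiv t →
                blocks E + 2 * lasts E odd? ≡ leftLeaves t + 2 * oddPaths false t
    transport {E = E} t refl e = cong₂ (λ L o → L + 2 * o)
      (≡.trans (blocks-cong {E = E} {equiv t} e) (blocks-equiv t))
      (≡.trans (lasts-cong {E = E} {equiv t} e odd?) (lasts-equiv-odd false t))

open Enumeration

-- The ring of formal power series over the integers.

module PowerSeries where

  open import Algebra.Bundles using (CommutativeRing; RawRing)
  import Algebra.Solver.Ring as RingSolver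
  open import Algebra.Solver.Ring.AlmostCommutativeRing
    using (AlmostCommutativeRing; fromCommutativeRing; _-Raw-AlmostCommutative⟶_)
  open import Data.Integer using (ℤ; +_; -_; _+_; _*_; 0ℤ; 1ℤ)
  open import Data.Integer.Properties as ℤ hiding (_≟_)
  open import Data.Integer.Solver using (module +-*-Solver)
  open import Data.Maybe using (Maybe; just; nothing)
  open import Data.Nat as ℕ using (ℕ; zero; suc; z≤n; s≤s)
  import Data.Nat.Properties as ℕ
  open import Data.Product using (_,_)
  open import Function using (_∘_)
  open import Level using (0ℓ)
  open import Relation.Binary.PropositionalEquality
    using (_≡_; _≗_; refl; sym; trans; cong; cong₂; module ≡-Reasoning)
  open import Relation.Nullary using (yes; no)

  Series : Set
  Series = ℕ → ℤ

  infix  4 _≈ˢ_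
  infixl 6 _⊕_
  infixl 7 _⊛_ _•_

  record _≈ˢ_ (a b : Series) : Set where
    constructor pointwise
    field at : a ≗ b

  open _≈ˢ_ public

  const : ℤ → Series
  const k zero    = k
  const k (suc n) = 0ℤ

  tail : Series → Series
  tail a n = a (suc n)

  _⊕_ : Series → Series → Series
  (a ⊕ b) n = a n + b n

  ⊖_ : Series → Series
  (⊖ a) n = - a n

  _•_ : ℤ → Series → Series
  (k • a) n = k * a n

  _⊛_ : Series → Series → Series
  (a ⊛ b) zero    = a 0 * b 0
  (a ⊛ b) (suc n) = a 0 * b (suc n) + (tail a ⊛ b) n

  X : Series
  X zero    = 0ℤ
  X (suc n) = const 1ℤ n

  ⊛-cong : ∀ {a a′ b b′} → a ≗ a′ → b ≗ b′ → a ⊛ b ≗ a′ ⊛ b′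
  ⊛-cong p q zero    = cong₂ _*_ (p 0) (q 0)
  ⊛-cong p q (suc n) = cong₂ _+_ (cong₂ _*_ (p 0) (q (suc n))) (⊛-cong (p ∘ suc) q n)

  ⊛-distribʳ : ∀ c a b → (a ⊕ b) ⊛ c ≗ (a ⊛ c) ⊕ (b ⊛ c)
  ⊛-distribʳ c a b zero    = *-distribʳ-+ (c 0) (a 0) (b 0)
  ⊛-distribʳ c a b (suc n) = trans
    (cong₂ _+_ (*-distribʳ-+ (c (suc n)) (a 0) (b 0)) (⊛-distribʳ c (tail a) (tail b) n))
    (solve 4 (λ p q r s → (p :+ q) :+ (r :+ s) := (p :+ r) :+ (q :+ s)) refl
      (a 0 * c (suc n)) (b 0 * c (suc n)) ((tail a ⊛ c) n) ((tail b ⊛ c) n))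
    where open +-*-Solver

  •-⊛ : ∀ k a b → (k • a) ⊛ b ≗ k • (a ⊛ b)
  •-⊛ k a b zero    = *-assoc k (a 0) (b 0)
  •-⊛ k a b (suc n) = trans (cong₂ _+_ (*-assoc k (a 0) (b (suc n))) (•-⊛ k (tail a) b n))
    (sym (*-distribˡ-+ k _ _))

  -- The product with the top coefficient of `a` split off instead of the bottom one; commutativity
  -- compares the two recursions.
  ⊛-suc : ∀ a b n → (a ⊛ b) (suc n) ≡ (a ⊛ tail b) n + a (suc n) * b 0
  ⊛-suc a b zero    = refl
  ⊛-suc a b (suc n) = trans (cong (λ s → a 0 * b (suc (suc n)) + s) (⊛-suc (tail a) b n))
    (sym (+-assoc (a 0 * b (suc (suc n))) ((tail a ⊛ tail b) n) (a (suc (suc n)) * b 0)))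

  ⊛-comm : ∀ a b → a ⊛ b ≗ b ⊛ a
  ⊛-comm a b zero    = *-comm (a 0) (b 0)
  ⊛-comm a b (suc n) = trans (cong₂ _+_ (*-comm (a 0) (b (suc n))) (⊛-comm (tail a) b n))
    (trans (+-comm (b (suc n) * a 0) _) (sym (⊛-suc b a n)))

  ⊛-assoc : ∀ a b c → (a ⊛ b) ⊛ c ≗ a ⊛ (b ⊛ c)
  ⊛-assoc a b c zero    = *-assoc (a 0) (b 0) (c 0)
  ⊛-assoc a b c (suc n) = begin
    a 0 * b 0 * c (suc n) + ((a 0 • tail b ⊕ (tail a ⊛ b)) ⊛ c) n
      ≡⟨ cong (λ s → a 0 * b 0 * c (suc n) + s) (⊛-distribʳ c (a 0 • tail b) (tail a ⊛ b) n) ⟩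
    a 0 * b 0 * c (suc n) + (((a 0 • tail b) ⊛ c) n + ((tail a ⊛ b) ⊛ c) n)
      ≡⟨ cong₂ (λ s t → a 0 * b 0 * c (suc n) + (s + t)) (•-⊛ (a 0) (tail b) c n) (⊛-assoc (tail a) b c n) ⟩
    a 0 * b 0 * c (suc n) + (a 0 * (tail b ⊛ c) n + (tail a ⊛ (b ⊛ c)) n)
      ≡⟨ solve 5 (λ p q r s t → p :* q :* r :+ (p :* s :+ t) := p :* (q :* r :+ s) :+ t) refl
           (a 0) (b 0) (c (suc n)) ((tail b ⊛ c) n) ((tail a ⊛ (b ⊛ c)) n) ⟩
    a 0 * (b 0 * c (suc n) + (tail b ⊛ c) n) + (tail a ⊛ (b ⊛ c)) n ∎
    where
    open ≡-Reasoning
    open +-*-Solver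

  const-⊛ : ∀ k a → const k ⊛ a ≗ k • a
  const-⊛ k a zero    = refl
  const-⊛ k a (suc n) = trans (cong (λ s → k * a (suc n) + s) (0s a n)) (+-identityʳ _)
    where
    0s : ∀ a n → ((λ _ → 0ℤ) ⊛ a) n ≡ 0ℤ
    0s a zero    = refl
    0s a (suc n) = cong (λ s → 0ℤ * a (suc n) + s) (0s a n)

  ⊛-identityˡ : ∀ a → const 1ℤ ⊛ a ≗ a
  ⊛-identityˡ a n = trans (const-⊛ 1ℤ a n) (*-identityˡ (a n))

  const-0 : ∀ n → const 0ℤ n ≡ 0ℤ
  const-0 zero    = refl
  const-0 (suc n) = refl

  X⊛-suc : ∀ a n → (X ⊛ a) (suc n) ≡ a n
  X⊛-suc a n = trans (+-identityˡ _) (⊛-identityˡ a n)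

  seriesRing : CommutativeRing 0ℓ 0ℓ
  seriesRing = record
    { Carrier = Series ; _≈_ = _≈ˢ_ ; _+_ = _⊕_ ; _*_ = _⊛_ ; -_ = ⊖_ ; 0# = const 0ℤ ; 1# = const 1ℤ
    ; isCommutativeRing = record
      { isRing = record
        { +-isAbelianGroup = record
          { isGroup = record
            { isMonoid = record
              { isSemigroup = record
                { isMagma = record
                  { isEquivalence = record
                    { refl = pointwise λ _ → refl
                    ; sym = λ p → pointwise λ n → sym (at p n)
                    ; trans = λ p q → pointwise λ n → trans (at p n) (at q n) }
                  ; ∙-cong = λ p q → pointwise λ n → cong₂ _+_ (at p n) (at q n) }
                ; assoc = λ a b c → pointwise λ n → +-assoc (a n) (b n) (c n) }
              ; identity = (λ a → pointwise λ n → trans (cong (_+ a n) (const-0 n)) (+-identityˡ (a n)))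
                         , (λ a → pointwise λ n → trans (cong (λ z → a n + z) (const-0 n)) (+-identityʳ (a n))) }
            ; inverse = (λ a → pointwise λ n → trans (+-inverseˡ (a n)) (sym (const-0 n)))
                      , (λ a → pointwise λ n → trans (+-inverseʳ (a n)) (sym (const-0 n)))
            ; ⁻¹-cong = λ p → pointwise λ n → cong -_ (at p n) }
          ; comm = λ a b → pointwise λ n → +-comm (a n) (b n) }
        ; *-cong = λ p q → pointwise (⊛-cong (at p) (at q))
        ; *-assoc = λ a b c → pointwise (⊛-assoc a b c)
        ; *-identity = (λ a → pointwise (⊛-identityˡ a)) , λ a → pointwise λ n → trans (⊛-comm a (const 1ℤ) n) (⊛-identityˡ a n)
        ; distrib = (λ a b c → pointwise λ n → trans (⊛-comm a (b ⊕ c) n) (trans (⊛-distribʳ a b c n)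
                        (cong₂ _+_ (⊛-comm b a n) (⊛-comm c a n))))
                  , λ c a b → pointwise (⊛-distribʳ c a b)
        }
      ; *-comm = λ a b → pointwise (⊛-comm a b)
      }
    }

  private
    ℤ-rawRing : RawRing 0ℓ 0ℓ
    ℤ-rawRing = CommutativeRing.rawRing +-*-commutativeRing

    const-homo : ℤ-rawRing -Raw-AlmostCommutative⟶ fromCommutativeRing seriesRing
    const-homo = record
      { ⟦_⟧    = const
      ; +-homo = λ k l → pointwise λ { zero → refl ; (suc n) → refl }
      ; *-homo = λ k l → pointwise λ n → trans (const-* k l n) (sym (const-⊛ k (const l) n))
      ; -‿homo = λ k → pointwise λ { zero → refl ; (suc n) → refl }
      ; 0-homo = pointwise λ _ → refl
      ; 1-homo = pointwise λ _ → refl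
      }
      where
      const-* : ∀ k l n → const (k * l) n ≡ k * const l n
      const-* k l zero    = refl
      const-* k l (suc n) = sym (*-zeroʳ k)

    const-≟ : ∀ k l → Maybe (const k ≈ˢ const l)
    const-≟ k l with k ℤ.≟ l
    ... | yes refl = just (pointwise λ _ → refl)
    ... | no _     = nothing

  module SeriesSolver = RingSolver ℤ-rawRing (fromCommutativeRing seriesRing) const-homo const-≟

  -- The Euler operator X d/dX: a derivation that keeps degrees, and so needs no shifts of
  -- coefficients.
  θ : Series → Series
  θ a n = + n * a n

  θ-⊕ : ∀ a b → θ (a ⊕ b) ≈ˢ θ a ⊕ θ b
  θ-⊕ a b = pointwise λ n → *-distribˡ-+ (+ n) (a n) (b n)

  θ-⊛-pointwise : ∀ a b → θ (a ⊛ b) ≗ (θ a ⊛ b) ⊕ (a ⊛ θ b)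
  θ-⊛-pointwise a b zero    = sym (trans (cong (λ z → 0ℤ * a 0 * b 0 + z) (*-zeroʳ (a 0))) refl)
  θ-⊛-pointwise a b (suc n) = begin
    (1ℤ + + n) * (a 0 * b (suc n) + (p ⊛ b) n)
      ≡⟨ solve 4 (λ k u v w → (con 1ℤ :+ k) :* (u :* v :+ w) :=
           con 0ℤ :* u :* v :+ (w :+ k :* w) :+ u :* ((con 1ℤ :+ k) :* v)) refl
           (+ n) (a 0) (b (suc n)) ((p ⊛ b) n) ⟩
    0ℤ * a 0 * b (suc n) + ((p ⊛ b) n + θ (p ⊛ b) n) + a 0 * ((1ℤ + + n) * b (suc n))
      ≡⟨ cong (λ z → 0ℤ * a 0 * b (suc n) + ((p ⊛ b) n + z) + a 0 * ((1ℤ + + n) * b (suc n))) (θ-⊛-pointwise p b n) ⟩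
    0ℤ * a 0 * b (suc n) + ((p ⊛ b) n + ((θ p ⊛ b) n + (p ⊛ θ b) n)) + a 0 * ((1ℤ + + n) * b (suc n))
      ≡⟨ solve 5 (λ u v w x y → u :+ (v :+ (w :+ x)) :+ y := (u :+ (v :+ w)) :+ (y :+ x)) refl
           (0ℤ * a 0 * b (suc n)) ((p ⊛ b) n) ((θ p ⊛ b) n) ((p ⊛ θ b) n) (a 0 * ((1ℤ + + n) * b (suc n))) ⟩
    (0ℤ * a 0 * b (suc n) + ((p ⊛ b) n + (θ p ⊛ b) n)) + (a 0 * ((1ℤ + + n) * b (suc n)) + (p ⊛ θ b) n)
      ≡⟨ cong (λ z → (0ℤ * a 0 * b (suc n) + z) + (a 0 * ((1ℤ + + n) * b (suc n)) + (p ⊛ θ b) n))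
           (trans (sym (⊛-distribʳ b p (θ p) n)) (⊛-cong {b = b} tail-θ (λ _ → refl) n)) ⟩
    (0ℤ * a 0 * b (suc n) + (tail (θ a) ⊛ b) n) + (a 0 * ((1ℤ + + n) * b (suc n)) + (p ⊛ θ b) n) ∎
    where
    open ≡-Reasoning
    open +-*-Solver
    p : Series
    p = tail a
    tail-θ : p ⊕ θ p ≗ tail (θ a)
    tail-θ k = solve 2 (λ k u → u :+ k :* u := (con 1ℤ :+ k) :* u) refl (+ k) (p k)

  θ-⊛ : ∀ a b → θ (a ⊛ b) ≈ˢ θ a ⊛ b ⊕ a ⊛ θ b
  θ-⊛ a b = pointwise (θ-⊛-pointwise a b)

  ⊛-vanishes : ∀ p {a} n → (∀ {k} → k ℕ.≤ n → a k ≡ 0ℤ) → (p ⊛ a) n ≡ 0ℤ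
  ⊛-vanishes p zero    h = trans (cong (p 0 *_) (h z≤n)) (*-zeroʳ (p 0))
  ⊛-vanishes p (suc n) h = cong₂ _+_ (trans (cong (p 0 *_) (h ℕ.≤-refl)) (*-zeroʳ (p 0)))
    (⊛-vanishes (tail p) n λ k≤n → h (ℕ.m≤n⇒m≤1+n k≤n))

  -- Because of the factor `X`, each coefficient on the right involves only earlier coefficients of
  -- `a` and `b`, so all of them vanish by induction.
  module _ {p q r s a b : Series} (eqᵃ : a ≈ˢ X ⊛ (p ⊛ a ⊕ q ⊛ b)) (eqᵇ : b ≈ˢ X ⊛ (r ⊛ a ⊕ s ⊛ b)) where

    private
      below : ∀ n {k} → k ℕ.≤ n → a k ≡ 0ℤ
      below′ : ∀ n {k} → k ℕ.≤ n → b k ≡ 0ℤ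
      below n       {zero}  _         = at eqᵃ 0
      below (suc n) {suc k} (s≤s k≤n) = trans (at eqᵃ (suc k)) (trans (X⊛-suc _ k)
        (cong₂ _+_ (⊛-vanishes p k λ i≤k → below n (ℕ.≤-trans i≤k k≤n))
                   (⊛-vanishes q k λ i≤k → below′ n (ℕ.≤-trans i≤k k≤n))))
      below′ n       {zero}  _         = at eqᵇ 0
      below′ (suc n) {suc k} (s≤s k≤n) = trans (at eqᵇ (suc k)) (trans (X⊛-suc _ k)
        (cong₂ _+_ (⊛-vanishes r k λ i≤k → below n (ℕ.≤-trans i≤k k≤n))
                   (⊛-vanishes s k λ i≤k → below′ n (ℕ.≤-trans i≤k k≤n))))

    linear-system-zero₁ : a ≈ˢ const 0ℤ
    linear-system-zero₁ = pointwise λ n → trans (below n ℕ.≤-refl) (sym (const-0 n))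

    linear-system-zero₂ : b ≈ˢ const 0ℤ
    linear-system-zero₂ = pointwise λ n → trans (below′ n ℕ.≤-refl) (sym (const-0 n))

open PowerSeries

-- The Catalan series and its differential equations.

module CatalanSeries where

  open import Algebra.Bundles using (CommutativeRing)
  open import Data.Integer using (ℤ; +_; -_; _+_; _*_; 0ℤ; 1ℤ)
  open import Data.Integer.Properties
    using (*-identityˡ; *-zeroʳ; *-distribˡ-+; *-cancelˡ-≡; neg-distribʳ-*; neg-distribˡ-*)
  open import Data.Integer.Solver using (module +-*-Solver)
  open import Data.Nat as ℕ using (ℕ; zero; suc)
  open import Relation.Binary.PropositionalEquality using (_≗_; refl; sym; trans; cong)
  open CommutativeRing seriesRing
    using (*-cong; +-cong; +-congˡ; +-congʳ; *-congˡ; *-congʳ; -‿cong; -‿inverseʳ; zeroʳ; +-identityʳ)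
    renaming (refl to ≈ˢ-refl; sym to ≈ˢ-sym; trans to ≈ˢ-trans)
  open SeriesSolver
  open +-*-Solver using () renaming (solve to solveℤ; con to κ; _:+_ to _⊞_; _:*_ to _⊠_; :-_ to ⊟_; _:=_ to _≔_)

  infixl 6 _⊝_

  _⊝_ : Series → Series → Series
  a ⊝ b = a ⊕ (⊖ b)

  ⊝-zero : ∀ {a b} → a ≈ˢ b → ∀ k → k ⊛ (a ⊝ b) ≈ˢ const 0ℤ
  ⊝-zero {a} {b} p k = ≈ˢ-trans (*-congˡ (≈ˢ-trans (+-congʳ p) (-‿inverseʳ b))) (zeroʳ k)

  ⊝-zero⁻ : ∀ {a b} → a ⊝ b ≈ˢ const 0ℤ → a ≈ˢ b
  ⊝-zero⁻ {a} {b} p = ≈ˢ-trans (solve 2 (λ a b → a := (a :- b) :+ b) ≈ˢ-refl a b)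
    (≈ˢ-trans (+-congʳ p) (solve 1 (λ b → con 0ℤ :+ b := b) ≈ˢ-refl b))

  drop-zero : ∀ a {b} → b ≈ˢ const 0ℤ → a ⊕ b ≈ˢ a
  drop-zero a p = ≈ˢ-trans (+-congˡ {a} p) (+-identityʳ a)

  -- An identity that holds modulo the relations uᵢ = vᵢ.
  modulo₁ : ∀ {a b u v} k → a ≈ˢ b ⊕ k ⊛ (u ⊝ v) → u ≈ˢ v → a ≈ˢ b
  modulo₁ {a} {b} k e p = ≈ˢ-trans e (drop-zero b (⊝-zero p k))

  modulo₂ : ∀ {a b u v u′ v′} k k′ → a ≈ˢ b ⊕ k ⊛ (u ⊝ v) ⊕ k′ ⊛ (u′ ⊝ v′) → u ≈ˢ v → u′ ≈ˢ v′ → a ≈ˢ b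
  modulo₂ {b = b} {u} {v} k k′ e p p′ = modulo₁ k (≈ˢ-trans e (drop-zero (b ⊕ k ⊛ (u ⊝ v)) (⊝-zero p′ k′))) p

  modulo₃ : ∀ {a b u v u′ v′ u″ v″} k k′ k″ →
            a ≈ˢ b ⊕ k ⊛ (u ⊝ v) ⊕ k′ ⊛ (u′ ⊝ v′) ⊕ k″ ⊛ (u″ ⊝ v″) → u ≈ˢ v → u′ ≈ˢ v′ → u″ ≈ˢ v″ → a ≈ˢ b
  modulo₃ {b = b} {u} {v} {u′} {v′} k k′ k″ e p p′ p″ =
    modulo₂ k k′ (≈ˢ-trans e (drop-zero (b ⊕ k ⊛ (u ⊝ v) ⊕ k′ ⊛ (u′ ⊝ v′)) (⊝-zero p″ k″))) p p′

  modulo₄ : ∀ {a b u v u′ v′ u″ v″ u‴ v‴} k k′ k″ k‴ →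
            a ≈ˢ b ⊕ k ⊛ (u ⊝ v) ⊕ k′ ⊛ (u′ ⊝ v′) ⊕ k″ ⊛ (u″ ⊝ v″) ⊕ k‴ ⊛ (u‴ ⊝ v‴) →
            u ≈ˢ v → u′ ≈ˢ v′ → u″ ≈ˢ v″ → u‴ ≈ˢ v‴ → a ≈ˢ b
  modulo₄ {b = b} {u} {v} {u′} {v′} {u″} {v″} k k′ k″ k‴ e p p′ p″ p‴ =
    modulo₃ k k′ k″ (≈ˢ-trans e
      (drop-zero (b ⊕ k ⊛ (u ⊝ v) ⊕ k′ ⊛ (u′ ⊝ v′) ⊕ k″ ⊛ (u″ ⊝ v″)) (⊝-zero p‴ k‴))) p p′ p″

  θ-cong : ∀ {a b} → a ≈ˢ b → θ a ≈ˢ θ b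
  θ-cong p = pointwise λ n → cong (+ n *_) (at p n)

  θ-const : ∀ k → θ (const k) ≈ˢ const 0ℤ
  θ-const k = pointwise λ { zero → refl ; (suc n) → *-zeroʳ (+ suc n) }

  θ-X : θ X ≈ˢ X
  θ-X = pointwise λ { zero → refl ; (suc zero) → refl ; (suc (suc n)) → *-zeroʳ (+ suc (suc n)) }

  θ-⊖ : ∀ a → θ (⊖ a) ≈ˢ ⊖ θ a
  θ-⊖ a = pointwise λ n → sym (neg-distribʳ-* (+ n) (a n))

  θ-X⊛ : ∀ a → θ (X ⊛ a) ≈ˢ X ⊛ a ⊕ X ⊛ θ a
  θ-X⊛ a = ≈ˢ-trans (θ-⊛ X a) (+-congʳ (*-congʳ θ-X))

  θ-const⊛ : ∀ k a → θ (const k ⊛ a) ≈ˢ const k ⊛ θ a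
  θ-const⊛ k a = ≈ˢ-trans (θ-⊛ (const k) a) (≈ˢ-trans (+-congʳ (*-congʳ (θ-const k)))
    (solve 2 (λ a b → con 0ℤ :* a :+ b := b) ≈ˢ-refl a (const k ⊛ θ a)))

  sgn : ℕ → ℤ
  sgn zero    = 1ℤ
  sgn (suc n) = - sgn n

  -- The substitution X ↦ -X.
  σ : Series → Series
  σ a n = sgn n * a n

  σ-cong : ∀ {a b} → a ≈ˢ b → σ a ≈ˢ σ b
  σ-cong p = pointwise λ n → cong (sgn n *_) (at p n)

  σ-⊕ : ∀ a b → σ (a ⊕ b) ≈ˢ σ a ⊕ σ b
  σ-⊕ a b = pointwise λ n → *-distribˡ-+ (sgn n) (a n) (b n)

  σ-⊖ : ∀ a → σ (⊖ a) ≈ˢ ⊖ σ a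
  σ-⊖ a = pointwise λ n → sym (neg-distribʳ-* (sgn n) (a n))

  σ-const : ∀ k → σ (const k) ≈ˢ const k
  σ-const k = pointwise λ { zero → *-identityˡ k ; (suc n) → *-zeroʳ (- sgn n) }

  σ-X : σ X ≈ˢ ⊖ X
  σ-X = pointwise λ { zero → refl ; (suc zero) → refl ; (suc (suc n)) → *-zeroʳ (- - sgn n) }

  σ-θ : ∀ a → σ (θ a) ≈ˢ θ (σ a)
  σ-θ a = pointwise λ n → solveℤ 3 (λ s k x → s ⊠ (k ⊠ x) ≔ k ⊠ (s ⊠ x))
    refl (sgn n) (+ n) (a n)

  σ-⊛-pointwise : ∀ a b → σ (a ⊛ b) ≗ σ a ⊛ σ b
  σ-⊛-pointwise a b zero    = solveℤ 2 (λ x y → κ 1ℤ ⊠ (x ⊠ y) ≔ κ 1ℤ ⊠ x ⊠ (κ 1ℤ ⊠ y)) refl (a 0) (b 0)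
  σ-⊛-pointwise a b (suc n) = trans
    (solveℤ 4 (λ s x y t → ⊟ s ⊠ (x ⊠ y ⊞ t) ≔ κ 1ℤ ⊠ x ⊠ (⊟ s ⊠ y) ⊞ ⊟ (s ⊠ t))
      refl (sgn n) (a 0) (b (suc n)) ((tail a ⊛ b) n))
    (cong (λ z → 1ℤ * a 0 * (- sgn n * b (suc n)) + z) (trans (cong -_ (σ-⊛-pointwise (tail a) b n))
      (sym (trans (⊛-cong {b = σ b} tail-σ (λ _ → refl) n)
        (at (solve 2 (λ u v → (:- u) :* v := :- (u :* v)) ≈ˢ-refl (σ (tail a)) (σ b)) n)))))
    where
    tail-σ : tail (σ a) ≗ ⊖ σ (tail a)
    tail-σ k = sym (neg-distribˡ-* (sgn k) (a (suc k)))

  σ-⊛ : ∀ a b → σ (a ⊛ b) ≈ˢ σ a ⊛ σ b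
  σ-⊛ a b = pointwise (σ-⊛-pointwise a b)

  module _ (C : Series) (C-eq : C ≈ˢ const 1ℤ ⊕ X ⊛ (C ⊛ C)) where

    -- Its coefficients are n + 1 times the Catalan numbers, that is C(2n,n): this is the series of
    -- 1/√(1 - 4X).
    central : Series
    central = C ⊕ θ C

    private
      B T : Series
      B = central
      T = θ C

      T-eq : T ≈ˢ X ⊛ (C ⊛ C) ⊕ const (+ 2) ⊛ (X ⊛ (C ⊛ T))
      T-eq = ≈ˢ-trans (θ-cong C-eq) (≈ˢ-trans (θ-⊕ (const 1ℤ) (X ⊛ (C ⊛ C)))
        (≈ˢ-trans (+-cong (θ-const 1ℤ) (≈ˢ-trans (θ-X⊛ (C ⊛ C)) (+-congˡ {X ⊛ (C ⊛ C)} (*-congˡ {X} (θ-⊛ C C)))))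
          (solve 3 (λ x c t → con 0ℤ :+ (x :* (c :* c) :+ x :* (t :* c :+ c :* t)) :=
            x :* (c :* c) :+ con (+ 2) :* (x :* (c :* t))) ≈ˢ-refl X C T)))

      T-recurrence : (const 1ℤ ⊝ const (+ 4) ⊛ X) ⊛ T ≈ˢ const 1ℤ ⊝ C ⊕ const (+ 2) ⊛ (X ⊛ C)
      -- `T-eq` says T(1 - 2XC) = XC². Multiply it by 1 - 2XC and use (1 - 2XC)² = 1 - 4X, which
      -- follows from the equation of `C`.
      T-recurrence = modulo₂
        (const (+ 4) ⊛ (X ⊛ T) ⊕ const 1ℤ ⊕ const (+ 2) ⊛ (X ⊛ C)) (const 1ℤ ⊝ const (+ 2) ⊛ (X ⊛ C))
        (solve 3 (λ x c t →
          (con 1ℤ :- con (+ 4) :* x) :* t :=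
          (con 1ℤ :- c :+ con (+ 2) :* (x :* c))
          :+ (con (+ 4) :* (x :* t) :+ con 1ℤ :+ con (+ 2) :* (x :* c)) :* (c :- (con 1ℤ :+ x :* (c :* c)))
          :+ (con 1ℤ :- con (+ 2) :* (x :* c)) :* (t :- (x :* (c :* c) :+ con (+ 2) :* (x :* (c :* t)))))
          ≈ˢ-refl X C T) C-eq T-eq

    -- In closed form 1 - 2XC is √(1 - 4X). Adding the equations of `C` and of `θ C` is enough,
    -- which is why both multipliers are 1.
    central-inverse : B ⊛ (const 1ℤ ⊝ const (+ 2) ⊛ (X ⊛ C)) ≈ˢ const 1ℤ
    central-inverse = modulo₂ (const 1ℤ) (const 1ℤ)
      (solve 3 (λ x c t →
        (c :+ t) :* (con 1ℤ :- con (+ 2) :* (x :* c)) :=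
        con 1ℤ :+ con 1ℤ :* (c :- (con 1ℤ :+ x :* (c :* c)))
        :+ con 1ℤ :* (t :- (x :* (c :* c) :+ con (+ 2) :* (x :* (c :* t)))))
        ≈ˢ-refl X C T) C-eq T-eq

    -- On coefficients this is the Catalan recurrence (n + 2) c(n+1) = (4n + 2) c(n).
    central-suc : B ≈ˢ const 1ℤ ⊕ X ⊛ (const (+ 4) ⊛ T ⊕ const (+ 2) ⊛ C)
    central-suc = modulo₁ (const 1ℤ)
      (solve 3 (λ x c t →
        c :+ t := con 1ℤ :+ x :* (con (+ 4) :* t :+ con (+ 2) :* c)
        :+ con 1ℤ :* ((con 1ℤ :- con (+ 4) :* x) :* t :- (con 1ℤ :- c :+ con (+ 2) :* (x :* c))))
        ≈ˢ-refl X C T) T-recurrence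

    private
      S : Series
      S = θ B

      central-inverse-θ : S ⊛ (const 1ℤ ⊝ const (+ 2) ⊛ (X ⊛ C)) ⊝ B ⊛ (const (+ 2) ⊛ (X ⊛ B)) ≈ˢ const 0ℤ
      central-inverse-θ = ≈ˢ-trans (≈ˢ-trans (solve 6 (λ s b x c t w →
          s :* w :- b :* (con (+ 2) :* (x :* (c :+ t))) :=
          s :* w :+ b :* (con 0ℤ :- con (+ 2) :* (x :* c :+ x :* t))) ≈ˢ-refl S B X C T W)
        (+-congˡ {S ⊛ W} (*-congˡ {B} (≈ˢ-sym θW)))) (≈ˢ-trans (≈ˢ-sym (θ-⊛ B W)) (≈ˢ-trans (θ-cong central-inverse) (θ-const 1ℤ)))
        where
        W : Series
        W = const 1ℤ ⊝ const (+ 2) ⊛ (X ⊛ C)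
        θW : θ W ≈ˢ const 0ℤ ⊝ const (+ 2) ⊛ (X ⊛ C ⊕ X ⊛ T)
        θW = ≈ˢ-trans (θ-⊕ (const 1ℤ) _) (+-cong (θ-const 1ℤ) (≈ˢ-trans (θ-⊖ _)
          (-‿cong (≈ˢ-trans (θ-const⊛ (+ 2) (X ⊛ C)) (*-congˡ (θ-X⊛ C))))))

    -- Applying `θ` to `central-inverse` gives S(1 - 2XC) = 2XB²; a further factor 1 - 2XC turns
    -- this into the differential equation of (1 - 4X)^(-1/2).
    central-ode : (const 1ℤ ⊝ const (+ 4) ⊛ X) ⊛ S ≈ˢ const (+ 2) ⊛ (X ⊛ B)
    central-ode = modulo₃ (const (+ 4) ⊛ (X ⊛ S)) (const 1ℤ ⊝ const (+ 2) ⊛ (X ⊛ C)) (const (+ 2) ⊛ (X ⊛ B))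
      (solve 4 (λ x c b s →
        (con 1ℤ :- con (+ 4) :* x) :* s := con (+ 2) :* (x :* b)
        :+ con (+ 4) :* (x :* s) :* (c :- (con 1ℤ :+ x :* (c :* c)))
        :+ (con 1ℤ :- con (+ 2) :* (x :* c)) :* ((s :* (con 1ℤ :- con (+ 2) :* (x :* c)) :- b :* (con (+ 2) :* (x :* b))) :- con 0ℤ)
        :+ con (+ 2) :* (x :* b) :* (b :* (con 1ℤ :- con (+ 2) :* (x :* c)) :- con 1ℤ))
        ≈ˢ-refl X C B S) C-eq central-inverse-θ central-inverse

    -- 1 / √(1 - 16 X²) = 1 / √(1 - 4X) · 1 / √(1 + 4X)
    central² : Series
    central² = B ⊛ σ B

    private
      σ-X⊛ : ∀ a → σ (X ⊛ a) ≈ˢ ⊖ (X ⊛ σ a)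
      σ-X⊛ a = ≈ˢ-trans (σ-⊛ X a) (≈ˢ-trans (*-congʳ σ-X) (solve 2 (λ x a → (:- x) :* a := :- (x :* a)) ≈ˢ-refl X (σ a)))

      σ-const⊛ : ∀ k a → σ (const k ⊛ a) ≈ˢ const k ⊛ σ a
      σ-const⊛ k a = ≈ˢ-trans (σ-⊛ (const k) a) (*-congʳ (σ-const k))

      σ-central-ode : (const 1ℤ ⊕ const (+ 4) ⊛ X) ⊛ θ (σ B) ≈ˢ ⊖ (const (+ 2) ⊛ (X ⊛ σ B))
      σ-central-ode = ≈ˢ-trans (≈ˢ-sym left) (≈ˢ-trans (σ-cong central-ode) right)
        where
        left : σ ((const 1ℤ ⊝ const (+ 4) ⊛ X) ⊛ S) ≈ˢ (const 1ℤ ⊕ const (+ 4) ⊛ X) ⊛ θ (σ B)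
        left = ≈ˢ-trans (σ-⊛ _ S) (*-cong
          (≈ˢ-trans (σ-⊕ _ _) (+-cong (σ-const 1ℤ) (≈ˢ-trans (σ-⊖ _) (≈ˢ-trans (-‿cong (≈ˢ-trans (σ-const⊛ (+ 4) X) (*-congˡ σ-X)))
            (solve 1 (λ x → :- (con (+ 4) :* (:- x)) := con (+ 4) :* x) ≈ˢ-refl X)))))
          (σ-θ B))
        right : σ (const (+ 2) ⊛ (X ⊛ B)) ≈ˢ ⊖ (const (+ 2) ⊛ (X ⊛ σ B))
        right = ≈ˢ-trans (σ-const⊛ (+ 2) (X ⊛ B)) (≈ˢ-trans (*-congˡ (σ-X⊛ B))
          (solve 2 (λ x b → con (+ 2) :* (:- (x :* b)) := :- (con (+ 2) :* (x :* b))) ≈ˢ-refl X (σ B)))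

    -- The product rule, with the equation of B(X) scaled by 1 + 4X and that of B(-X) by 1 - 4X.
    central²-ode : (const 1ℤ ⊝ const (+ 16) ⊛ (X ⊛ X)) ⊛ θ central² ≈ˢ const (+ 16) ⊛ (X ⊛ (X ⊛ central²))
    central²-ode = ≈ˢ-trans (*-congˡ (θ-⊛ B (σ B)))
      (modulo₂ ((const 1ℤ ⊕ const (+ 4) ⊛ X) ⊛ σ B) ((const 1ℤ ⊝ const (+ 4) ⊛ X) ⊛ B)
        (solve 5 (λ x b s b′ s′ →
          (con 1ℤ :- con (+ 16) :* (x :* x)) :* (s :* b′ :+ b :* s′) := con (+ 16) :* (x :* (x :* (b :* b′)))
          :+ ((con 1ℤ :+ con (+ 4) :* x) :* b′) :* ((con 1ℤ :- con (+ 4) :* x) :* s :- con (+ 2) :* (x :* b))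
          :+ ((con 1ℤ :- con (+ 4) :* x) :* b) :* ((con 1ℤ :+ con (+ 4) :* x) :* s′ :- (:- (con (+ 2) :* (x :* b′)))))
          ≈ˢ-refl X B S (σ B) (θ (σ B)))
        central-ode σ-central-ode)

    -- Solved for the leading term, so that coefficients D(n) obey (n + 2) D(n+2) = 16 (n + 1) D(n).
    central²-θ : θ central² ≈ˢ const (+ 16) ⊛ (X ⊛ (X ⊛ (θ central² ⊕ central²)))
    central²-θ = modulo₁ (const 1ℤ)
      (solve 3 (λ x d t → t := con (+ 16) :* (x :* (x :* (t :+ d)))
        :+ con 1ℤ :* ((con 1ℤ :- con (+ 16) :* (x :* x)) :* t :- con (+ 16) :* (x :* (x :* d))))
        ≈ˢ-refl X central² (θ central²))
      central²-ode

    X-cancel : ∀ {a b} k .{{_ : Data.Integer.NonZero k}} → const k ⊛ (X ⊛ a) ≈ˢ const k ⊛ (X ⊛ b) → a ≈ˢ b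
    X-cancel {a} {b} k p = pointwise λ n → trans (sym (X⊛-suc a n)) (trans
      (*-cancelˡ-≡ k _ _ (trans (sym (const-⊛ k (X ⊛ a) (suc n))) (trans (at p (suc n)) (const-⊛ k (X ⊛ b) (suc n)))))
      (X⊛-suc b n))

    -- The bracket 2X(C(X) + C(-X)) is √(1 + 4X) - √(1 - 4X). So multiplying the left side by 4X
    -- gives B(X) - B(-X), a difference of reciprocals, and `central-suc` evaluates this as 4X(E + 2
    -- θ E).
    central²-even : ∀ {E} → E ⊕ E ≈ˢ C ⊕ σ C → central² ⊛ E ≈ˢ E ⊕ const (+ 2) ⊛ θ E
    central²-even {E} 2E = X-cancel (+ 4) (≈ˢ-trans left (≈ˢ-trans mid right))
      where
      left : const (+ 4) ⊛ (X ⊛ (central² ⊛ E)) ≈ˢ const (+ 2) ⊛ (X ⊛ (central² ⊛ (C ⊕ σ C)))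
      left = ≈ˢ-trans (solve 3 (λ x d e → con (+ 4) :* (x :* (d :* e)) := con (+ 2) :* (x :* (d :* (e :+ e)))) ≈ˢ-refl X central² E)
        (*-congˡ (*-congˡ (*-congˡ 2E)))
      inverse-σ : σ B ⊛ (const 1ℤ ⊕ const (+ 2) ⊛ (X ⊛ σ C)) ≈ˢ const 1ℤ
      inverse-σ = ≈ˢ-trans (*-congˡ (≈ˢ-sym (≈ˢ-trans (σ-⊕ _ _) (+-cong (σ-const 1ℤ) (≈ˢ-trans (σ-⊖ _)
          (≈ˢ-trans (-‿cong (≈ˢ-trans (σ-const⊛ (+ 2) (X ⊛ C)) (*-congˡ (σ-X⊛ C))))
            (solve 2 (λ x c → :- (con (+ 2) :* (:- (x :* c))) := con (+ 2) :* (x :* c)) ≈ˢ-refl X (σ C))))))))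
        (≈ˢ-trans (≈ˢ-sym (σ-⊛ B _)) (≈ˢ-trans (σ-cong central-inverse) (σ-const 1ℤ)))
      σ-central-suc : σ B ≈ˢ const 1ℤ ⊝ X ⊛ (const (+ 4) ⊛ θ (σ C) ⊕ const (+ 2) ⊛ σ C)
      σ-central-suc = ≈ˢ-trans (σ-cong central-suc) (≈ˢ-trans (σ-⊕ _ _) (+-cong (σ-const 1ℤ)
        (≈ˢ-trans (σ-X⊛ _) (-‿cong (*-congˡ (≈ˢ-trans (σ-⊕ _ _)
          (+-cong (≈ˢ-trans (σ-const⊛ (+ 4) T) (*-congˡ (σ-θ C))) (σ-const⊛ (+ 2) C))))))))
      mid : const (+ 2) ⊛ (X ⊛ (central² ⊛ (C ⊕ σ C))) ≈ˢ B ⊝ σ B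
      mid = modulo₂ (⊖ σ B) B
        (solve 5 (λ x c c′ b b′ →
          con (+ 2) :* (x :* ((b :* b′) :* (c :+ c′))) := (b :- b′)
          :+ (:- b′) :* (b :* (con 1ℤ :- con (+ 2) :* (x :* c)) :- con 1ℤ)
          :+ b :* (b′ :* (con 1ℤ :+ con (+ 2) :* (x :* c′)) :- con 1ℤ))
          ≈ˢ-refl X C (σ C) B (σ B))
        central-inverse inverse-σ
      right : B ⊝ σ B ≈ˢ const (+ 4) ⊛ (X ⊛ (E ⊕ const (+ 2) ⊛ θ E))
      right = ≈ˢ-trans (+-cong central-suc (-‿cong σ-central-suc))
        (≈ˢ-trans (solve 5 (λ x c c′ t t′ →
          (con 1ℤ :+ x :* (con (+ 4) :* t :+ con (+ 2) :* c)) :- (con 1ℤ :- x :* (con (+ 4) :* t′ :+ con (+ 2) :* c′)) :=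
          con (+ 2) :* (x :* ((c :+ c′) :+ con (+ 2) :* (t :+ t′)))) ≈ˢ-refl X C (σ C) T (θ (σ C)))
        (≈ˢ-trans (*-congˡ (*-congˡ (+-cong (≈ˢ-sym 2E) (*-congˡ
          (≈ˢ-trans (≈ˢ-sym (θ-⊕ C (σ C))) (≈ˢ-trans (θ-cong (≈ˢ-sym 2E)) (θ-⊕ E E)))))))
          (solve 3 (λ x e f → con (+ 2) :* (x :* ((e :+ e) :+ con (+ 2) :* (f :+ f))) :=
            con (+ 4) :* (x :* (e :+ con (+ 2) :* f))) ≈ˢ-refl X E (θ E))))

open CatalanSeries

-- Generating functions of tree statistics.

module TreeSeries where

  open import Algebra.Bundles using (CommutativeRing)
  open import Data.Bool using (Bool; true; false; not; _xor_; if_then_else_)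
  open import Data.Integer using (ℤ; +_; -_; _+_; _*_; 0ℤ; 1ℤ; -1ℤ)
  open import Data.Integer.Properties
    using (*-identityˡ; *-identityʳ; *-zeroʳ; *-zeroˡ; *-distribˡ-+; *-distribʳ-+; pos-+
      ; pos-*)
  import Data.Integer.Properties as ℤ
  open import Data.Integer.Solver using (module +-*-Solver)
  open import Data.List using (List; []; _∷_; _++_; map; cartesianProductWith)
  open import Data.List.Membership.Propositional using (_∈_)
  open import Data.List.Relation.Unary.Any using (here; there)
  open import Data.Nat as ℕ using (ℕ; zero; suc)
  import Data.Nat.Properties as ℕ
  open import Function using (_∘_)
  open import Relation.Binary.PropositionalEquality using (_≡_; _≗_; refl; sym; trans; cong; cong₂)
  open CommutativeRing seriesRing using (*-cong; +-cong; +-congˡ; +-congʳ; *-congˡ; *-congʳ; -‿cong)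
    renaming (refl to ≈ˢ-refl; sym to ≈ˢ-sym; trans to ≈ˢ-trans)
  open SeriesSolver

  open +-*-Solver using () renaming (solve to solveℤ; con to κ; _:+_ to _⊞_; _:*_ to _⊠_; _:=_ to _≔_)

  Σ[_] : (Tree → ℤ) → List Tree → ℤ
  Σ[ g ] []       = 0ℤ
  Σ[ g ] (t ∷ ts) = g t + Σ[ g ] ts

  total : (Tree → ℤ) → Series
  total g n = Σ[ g ] (trees n)

  Σ-cong : ∀ {g h} ts → (∀ {t} → t ∈ ts → g t ≡ h t) → Σ[ g ] ts ≡ Σ[ h ] ts
  Σ-cong []       e = refl
  Σ-cong (t ∷ ts) e = cong₂ _+_ (e (here refl)) (Σ-cong ts (e ∘ there))

  Σ-+ : ∀ g h ts → Σ[ (λ t → g t + h t) ] ts ≡ Σ[ g ] ts + Σ[ h ] ts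
  Σ-+ g h []       = refl
  Σ-+ g h (t ∷ ts) = trans (cong (λ z → g t + h t + z) (Σ-+ g h ts))
    (solveℤ 4 (λ a b c d → a ⊞ b ⊞ (c ⊞ d) ≔ a ⊞ c ⊞ (b ⊞ d)) refl (g t) (h t) (Σ[ g ] ts) (Σ[ h ] ts))

  Σ-* : ∀ k g ts → Σ[ (λ t → k * g t) ] ts ≡ k * Σ[ g ] ts
  Σ-* k g []       = sym (*-zeroʳ k)
  Σ-* k g (t ∷ ts) = trans (cong (λ z → k * g t + z) (Σ-* k g ts)) (sym (*-distribˡ-+ k (g t) (Σ[ g ] ts)))

  Σ-++ : ∀ g ts us → Σ[ g ] (ts ++ us) ≡ Σ[ g ] ts + Σ[ g ] us
  Σ-++ g []       us = sym (ℤ.+-identityˡ _)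
  Σ-++ g (t ∷ ts) us = trans (cong (λ z → g t + z) (Σ-++ g ts us)) (sym (ℤ.+-assoc (g t) (Σ[ g ] ts) (Σ[ g ] us)))

  Σ-map : ∀ g (f : Tree → Tree) ts → Σ[ g ] (map f ts) ≡ Σ[ g ∘ f ] ts
  Σ-map g f []       = refl
  Σ-map g f (t ∷ ts) = cong (λ z → g (f t) + z) (Σ-map g f ts)

  nodeProduct : (Tree → ℤ) → (Tree → ℤ) → Tree → ℤ
  nodeProduct a b leaf       = 0ℤ
  nodeProduct a b (node l r) = a l * b r

  Σ-product : ∀ a b ls rs → Σ[ nodeProduct a b ] (cartesianProductWith node ls rs) ≡ Σ[ a ] ls * Σ[ b ] rs
  Σ-product a b []       rs = sym (*-zeroˡ (Σ[ b ] rs))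
  Σ-product a b (l ∷ ls) rs = trans (Σ-++ _ (map (node l) rs) _)
    (trans (cong₂ _+_ (trans (Σ-map _ (node l) rs) (Σ-* (a l) b rs)) (Σ-product a b ls rs))
      (sym (*-distribʳ-+ (Σ[ b ] rs) (a l) (Σ[ a ] ls))))

  Σ-nodes : ∀ a b L R n → Σ[ nodeProduct a b ] (nodes L R n) ≡ ((Σ[ a ] ∘ L) ⊛ (Σ[ b ] ∘ R)) n
  Σ-nodes a b L R zero    = Σ-product a b (L 0) (R 0)
  Σ-nodes a b L R (suc n) = trans (Σ-++ _ (cartesianProductWith node (L 0) (R (suc n))) _)
    (cong₂ _+_ (Σ-product a b (L 0) (R (suc n))) (Σ-nodes a b (L ∘ suc) R n))

  total-node : ∀ a b → total (nodeProduct a b) ≈ˢ X ⊛ (total a ⊛ total b)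
  total-node a b = pointwise λ
    { zero → refl
    ; (suc n) → trans (cong Σ[ nodeProduct a b ] (trees-suc n))
        (trans (Σ-nodes a b trees trees n) (sym (X⊛-suc (total a ⊛ total b) n))) }

  total-cong : ∀ {g h} → (∀ t → g t ≡ h t) → total g ≈ˢ total h
  total-cong e = pointwise λ n → Σ-cong (trees n) λ {t} _ → e t

  total-+ : ∀ g h → total (λ t → g t + h t) ≈ˢ total g ⊕ total h
  total-+ g h = pointwise λ n → Σ-+ g h (trees n)

  total-size : ∀ (f : ℕ → ℤ) g → total (λ t → f (size t) * g t) ≗ λ n → f n * total g n
  total-size f g n = trans (Σ-cong (trees n) λ {t} h → cong (λ k → f k * g t) (size-treesWithin n n h))
    (Σ-* (f n) g (trees n))

  offLeaf : (Tree → ℤ) → Tree → ℤ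
  offLeaf g leaf       = 0ℤ
  offLeaf g (node l r) = g (node l r)

  total-leaf : ∀ g → total g ≈ˢ const (g leaf) ⊕ total (offLeaf g)
  total-leaf g = pointwise λ
    { zero    → refl
    ; (suc n) → trans (Σ-cong (trees (suc n)) λ {t} h → same t (size-treesWithin (suc n) (suc n) h))
        (sym (ℤ.+-identityˡ _)) }
    where
    same : ∀ {n} t → size t ≡ suc n → g t ≡ offLeaf g t
    same (node _ _) _ = refl

  -- Turns a recursive definition on trees into an equation of series: `h` will be a sum of products
  -- over the two subtrees, to which `total-node` applies.
  total-rec : ∀ g k {h} → g leaf ≡ k → (∀ l r → g (node l r) ≡ h (node l r)) → h leaf ≡ 0ℤ →
              total g ≈ˢ const k ⊕ total h
  total-rec g k {h} refl e h₀ = ≈ˢ-trans (total-leaf g) (+-congˡ {const k} (total-cong λ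
    { leaf → sym h₀ ; (node l r) → e l r }))

  one : Tree → ℤ
  one _ = 1ℤ

  ind : Bool → ℤ
  ind b = if b then 1ℤ else 0ℤ

  evenSize oddSize : Tree → ℤ
  evenSize t = ind (not (odd (size t)))
  oddSize t  = ind (odd (size t))

  spine : Bool → Tree → ℤ
  spine b t = + evenSpine b t

  paths : Bool → Tree → ℤ
  paths b t = + oddPaths b t

  oddsBelow : Bool → ℕ → ℕ
  oddsBelow b zero    = 0
  oddsBelow b (suc n) = (if b then 1 else 0) ℕ.+ oddsBelow (not b) n

  odds : Bool → Tree → ℤ
  odds b t = + oddsBelow b (size t)

  𝐂 𝐄 𝐎 : Series
  𝐂 = total one
  𝐄 = total evenSize
  𝐎 = total oddSize

  𝐂-eq : 𝐂 ≈ˢ const 1ℤ ⊕ X ⊛ (𝐂 ⊛ 𝐂)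
  𝐂-eq = ≈ˢ-trans (total-rec one 1ℤ {nodeProduct one one} refl (λ _ _ → refl) refl)
    (+-congˡ {const 1ℤ} (total-node one one))

  𝐂-parity : 𝐂 ≈ˢ 𝐄 ⊕ 𝐎
  𝐂-parity = ≈ˢ-trans (total-cong λ t → lemma (odd (size t))) (total-+ evenSize oddSize)
    where
    lemma : ∀ b → 1ℤ ≡ ind (not b) + ind b
    lemma true  = refl
    lemma false = refl

  private
    odd-node : ∀ l r → odd (size (node l r)) ≡ not (odd (size l) xor odd (size r))
    odd-node l r = trans (cong odd (ℕ.+-suc (size l) (size r))) (cong not (odd-+ (size l) (size r)))

  sum-node : ∀ a b c d → total (λ t → nodeProduct a b t + nodeProduct c d t) ≈ˢ
             X ⊛ (total a ⊛ total b) ⊕ X ⊛ (total c ⊛ total d)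
  sum-node a b c d = ≈ˢ-trans (total-+ (nodeProduct a b) (nodeProduct c d)) (+-cong (total-node a b) (total-node c d))

  𝐄-eq : 𝐄 ≈ˢ const 1ℤ ⊕ (X ⊛ (𝐄 ⊛ 𝐎) ⊕ X ⊛ (𝐎 ⊛ 𝐄))
  𝐄-eq = ≈ˢ-trans (total-rec evenSize 1ℤ refl
      (λ l r → trans (cong (ind ∘ not) (odd-node l r)) (lemma (odd (size l)) (odd (size r)))) refl)
    (+-congˡ {const 1ℤ} (sum-node evenSize oddSize oddSize evenSize))
    where
    lemma : ∀ b c → ind (not (not (b xor c))) ≡ ind (not b) * ind c + ind b * ind (not c)
    lemma true  true  = refl
    lemma true  false = refl
    lemma false true  = refl
    lemma false false = refl

  𝐎-eq : 𝐎 ≈ˢ const 0ℤ ⊕ (X ⊛ (𝐄 ⊛ 𝐄) ⊕ X ⊛ (𝐎 ⊛ 𝐎))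
  𝐎-eq = ≈ˢ-trans (total-rec oddSize 0ℤ refl
      (λ l r → trans (cong ind (odd-node l r)) (lemma (odd (size l)) (odd (size r)))) refl)
    (+-congˡ {const 0ℤ} (sum-node evenSize evenSize oddSize oddSize))
    where
    lemma : ∀ b c → ind (not (b xor c)) ≡ ind (not b) * ind (not c) + ind b * ind c
    lemma true  true  = refl
    lemma true  false = refl
    lemma false true  = refl
    lemma false false = refl

  leftLeavesℤ : Tree → ℤ
  leftLeavesℤ t = + leftLeaves t

  LL : Series
  LL = total leftLeavesℤ

  private
    isLeafℤ : Tree → ℤ
    isLeafℤ t = + isLeaf t

    total-zero : total (λ _ → 0ℤ) ≈ˢ const 0ℤ
    total-zero = pointwise λ n → trans (zeros (trees n)) (sym (const-0 n))
      where
      zeros : ∀ ts → Σ[ (λ _ → 0ℤ) ] ts ≡ 0ℤ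
      zeros []       = refl
      zeros (t ∷ ts) = trans (ℤ.+-identityˡ _) (zeros ts)

    isLeaf-eq : total isLeafℤ ≈ˢ const 1ℤ
    isLeaf-eq = ≈ˢ-trans (total-rec isLeafℤ 1ℤ {λ _ → 0ℤ} refl (λ _ _ → refl) refl)
      (≈ˢ-trans (+-congˡ {const 1ℤ} total-zero) (solve 0 (con 1ℤ :+ con 0ℤ := con 1ℤ) ≈ˢ-refl))

    LL-eq : LL ≈ˢ const 0ℤ ⊕ (X ⊛ (LL ⊛ 𝐂) ⊕ (X ⊛ (const 1ℤ ⊛ 𝐂) ⊕ X ⊛ (𝐂 ⊛ LL)))
    LL-eq = ≈ˢ-trans (total-rec leftLeavesℤ 0ℤ refl
        (λ l r → trans (trans (pos-+ (leftLeaves l) _) (cong (λ z → + leftLeaves l + z) (pos-+ (isLeaf l) _)))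
          (solveℤ 3 (λ a b c → a ⊞ (b ⊞ c) ≔
            a ⊠ κ 1ℤ ⊞ (b ⊠ κ 1ℤ ⊞ κ 1ℤ ⊠ c)) refl (+ leftLeaves l) (+ isLeaf l) (+ leftLeaves r))) refl)
      (+-congˡ {const 0ℤ} (≈ˢ-trans (total-+ (nodeProduct leftLeavesℤ one) _) (+-cong (total-node leftLeavesℤ one)
        (≈ˢ-trans (sum-node isLeafℤ one one leftLeavesℤ)
          (+-congʳ {X ⊛ (𝐂 ⊛ LL)} (*-congˡ {X} (*-congʳ {𝐂} isLeaf-eq)))))))

  -- The recursion reads LL(1 - 2XC) = XC, and B is the inverse of 1 - 2XC; so LL = XCB, while 2XCB
  -- = B - 1.
  leftLeaves-series : const (+ 2) ⊛ LL ≈ˢ central 𝐂 𝐂-eq ⊝ const 1ℤ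
  leftLeaves-series = modulo₂ (⊖ const 1ℤ ⊝ const (+ 2) ⊛ LL) (const (+ 2) ⊛ B)
    (solve 4 (λ x c b l →
      con (+ 2) :* l := (b :- con 1ℤ)
      :+ (:- con 1ℤ :- con (+ 2) :* l) :* (b :* (con 1ℤ :- con (+ 2) :* (x :* c)) :- con 1ℤ)
      :+ (con (+ 2) :* b) :* (l :- (con 0ℤ :+ (x :* (l :* c) :+ (x :* (con 1ℤ :* c) :+ x :* (c :* l))))))
      ≈ˢ-refl X 𝐂 B LL)
    (central-inverse 𝐂 𝐂-eq) LL-eq
    where
    B : Series
    B = central 𝐂 𝐂-eq

  -- The subscript is the parity of the number of positions that precede the subtree.
  B₀ B₁ e₀ e₁ h₀ h₁ : Series
  B₀ = total (spine false)
  B₁ = total (spine true)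
  e₀ = total (paths false)
  e₁ = total (paths true)
  h₀ = total (odds false)
  h₁ = total (odds true)

  private
    B₀-eq : B₀ ≈ˢ const 1ℤ ⊕ X ⊛ (𝐄 ⊛ B₁)
    B₀-eq = ≈ˢ-trans (total-rec (spine false) 1ℤ {nodeProduct evenSize (spine true)} refl
        (λ l r → lemma (odd (size l)) (evenSpine true r)) refl)
      (+-congˡ {const 1ℤ} (total-node evenSize (spine true)))
      where
      lemma : ∀ b k → + (if b then 0 else k) ≡ ind (not b) * + k
      lemma true  k = refl
      lemma false k = sym (*-identityˡ (+ k))

    B₁-eq : B₁ ≈ˢ const 1ℤ ⊕ X ⊛ (𝐎 ⊛ B₁)
    B₁-eq = ≈ˢ-trans (total-rec (spine true) 1ℤ {nodeProduct oddSize (spine true)} refl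
        (λ l r → lemma (odd (size l)) (evenSpine true r)) refl)
      (+-congˡ {const 1ℤ} (total-node oddSize (spine true)))
      where
      lemma : ∀ b k → + (if not b then 0 else k) ≡ ind b * + k
      lemma false k = refl
      lemma true  k = sym (*-identityˡ (+ k))

    -- `oddPaths` and the number of odd positions follow the same recursion up to the contribution
    -- `p` of an odd root, and `f` stands for either. Thus the equations of `e₀` and `h₀` differ
    -- only in having `B₀` or `𝐂` at one place.
    split-false : ∀ s x p (f : Bool → ℕ) → + (x ℕ.+ ((if s then p else 0) ℕ.+ f (not s))) ≡
                  + x * 1ℤ + (ind s * + p + (ind (not s) * + f true + ind s * + f false))
    split-false true  x p f = trans (trans (pos-+ x _) (cong (λ z → + x + z) (pos-+ p _)))
      (solveℤ 4 (λ x p u v → x ⊞ (p ⊞ v) ≔ x ⊠ κ 1ℤ ⊞ (κ 1ℤ ⊠ p ⊞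
        (κ 0ℤ ⊠ u ⊞ κ 1ℤ ⊠ v))) refl (+ x) (+ p) (+ f true) (+ f false))
    split-false false x p f = trans (pos-+ x _)
      (solveℤ 4 (λ x p u v → x ⊞ u ≔ x ⊠ κ 1ℤ ⊞ (κ 0ℤ ⊠ p ⊞
        (κ 1ℤ ⊠ u ⊞ κ 0ℤ ⊠ v))) refl (+ x) (+ p) (+ f true) (+ f false))

    split-true : ∀ s x p (f : Bool → ℕ) → + (x ℕ.+ ((if not s then p else 0) ℕ.+ f (not (not s)))) ≡
                 + x * 1ℤ + (ind (not s) * + p + (ind (not s) * + f false + ind s * + f true))
    split-true true  x p f = trans (pos-+ x _)
      (solveℤ 4 (λ x p u v → x ⊞ u ≔ x ⊠ κ 1ℤ ⊞ (κ 0ℤ ⊠ p ⊞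
        (κ 0ℤ ⊠ v ⊞ κ 1ℤ ⊠ u))) refl (+ x) (+ p) (+ f true) (+ f false))
    split-true false x p f = trans (trans (pos-+ x _) (cong (λ z → + x + z) (pos-+ p _)))
      (solveℤ 4 (λ x p u v → x ⊞ (p ⊞ v) ≔ x ⊠ κ 1ℤ ⊞ (κ 1ℤ ⊠ p ⊞
        (κ 1ℤ ⊠ v ⊞ κ 0ℤ ⊠ u))) refl (+ x) (+ p) (+ f true) (+ f false))

    four-products : ∀ a b c d e f g h →
      total (λ t → nodeProduct a b t + (nodeProduct c d t + (nodeProduct e f t + nodeProduct g h t))) ≈ˢ
      X ⊛ (total a ⊛ total b) ⊕ (X ⊛ (total c ⊛ total d) ⊕ (X ⊛ (total e ⊛ total f) ⊕ X ⊛ (total g ⊛ total h)))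
    four-products a b c d e f g h = ≈ˢ-trans (total-+ (nodeProduct a b) _) (+-cong (total-node a b)
      (≈ˢ-trans (total-+ (nodeProduct c d) _) (+-cong (total-node c d) (sum-node e f g h))))

    e₀-eq : e₀ ≈ˢ const 0ℤ ⊕ (X ⊛ (e₀ ⊛ 𝐂) ⊕ (X ⊛ (𝐎 ⊛ B₀) ⊕ (X ⊛ (𝐄 ⊛ e₁) ⊕ X ⊛ (𝐎 ⊛ e₀))))
    e₀-eq = ≈ˢ-trans (total-rec (paths false) 0ℤ refl
        (λ l r → split-false (odd (size l)) (oddPaths false l) (evenSpine false r) (λ b → oddPaths b r)) refl)
      (+-congˡ {const 0ℤ} (four-products (paths false) one oddSize (spine false) evenSize (paths true) oddSize (paths false)))

    e₁-eq : e₁ ≈ˢ const 0ℤ ⊕ (X ⊛ (e₁ ⊛ 𝐂) ⊕ (X ⊛ (𝐄 ⊛ B₀) ⊕ (X ⊛ (𝐄 ⊛ e₀) ⊕ X ⊛ (𝐎 ⊛ e₁))))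
    e₁-eq = ≈ˢ-trans (total-rec (paths true) 0ℤ refl
        (λ l r → split-true (odd (size l)) (oddPaths true l) (evenSpine false r) (λ b → oddPaths b r)) refl)
      (+-congˡ {const 0ℤ} (four-products (paths true) one evenSize (spine false) evenSize (paths false) oddSize (paths true)))

    oddsBelow-+ : ∀ b m n → oddsBelow b (m ℕ.+ suc n) ≡
      oddsBelow b m ℕ.+ ((if b xor odd m then 1 else 0) ℕ.+ oddsBelow (not (b xor odd m)) n)
    oddsBelow-+ true  zero    n = refl
    oddsBelow-+ false zero    n = refl
    oddsBelow-+ true  (suc m) n with odd m | oddsBelow-+ false m n
    ... | true  | ih = cong suc ih
    ... | false | ih = cong suc ih
    oddsBelow-+ false (suc m) n with odd m | oddsBelow-+ true m n
    ... | true  | ih = ih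
    ... | false | ih = ih

    h₀-eq : h₀ ≈ˢ const 0ℤ ⊕ (X ⊛ (h₀ ⊛ 𝐂) ⊕ (X ⊛ (𝐎 ⊛ 𝐂) ⊕ (X ⊛ (𝐄 ⊛ h₁) ⊕ X ⊛ (𝐎 ⊛ h₀))))
    h₀-eq = ≈ˢ-trans (total-rec (odds false) 0ℤ refl
        (λ l r → trans (cong +_ (oddsBelow-+ false (size l) (size r)))
          (split-false (odd (size l)) (oddsBelow false (size l)) 1 (λ b → oddsBelow b (size r)))) refl)
      (+-congˡ {const 0ℤ} (four-products (odds false) one oddSize one evenSize (odds true) oddSize (odds false)))

    h₁-eq : h₁ ≈ˢ const 0ℤ ⊕ (X ⊛ (h₁ ⊛ 𝐂) ⊕ (X ⊛ (𝐄 ⊛ 𝐂) ⊕ (X ⊛ (𝐄 ⊛ h₀) ⊕ X ⊛ (𝐎 ⊛ h₁))))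
    h₁-eq = ≈ˢ-trans (total-rec (odds true) 0ℤ refl
        (λ l r → trans (cong +_ (oddsBelow-+ true (size l) (size r)))
          (split-true (odd (size l)) (oddsBelow true (size l)) 1 (λ b → oddsBelow b (size r)))) refl)
      (+-congˡ {const 0ℤ} (four-products (odds true) one evenSize one evenSize (odds false) oddSize (odds true)))

  -- Cutting the path of right edges from the root after its last odd node.
  𝐄⊛B₀ : 𝐄 ⊛ B₀ ≈ˢ 𝐂
  𝐄⊛B₀ = ⊝-zero⁻ (linear-system-zero₂ U-eq V-eq)
    where
    U V : Series
    -- The companion identity for odd offset: either the path has no odd node, or the piece up to
    -- its last odd node has odd size. For even offset that piece has even size, and the empty piece
    -- covers the first case.
    U = B₁ ⊕ 𝐎 ⊛ B₀ ⊝ 𝐂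
    V = 𝐄 ⊛ B₀ ⊝ 𝐂
    U-eq : U ≈ˢ X ⊛ (𝐎 ⊛ U ⊕ 𝐄 ⊛ V)
    U-eq = modulo₄ (const 1ℤ) B₀ (⊖ const 1ℤ) (⊖ (X ⊛ 𝐂))
      (solve 6 (λ x c e o b₀ b₁ →
        b₁ :+ o :* b₀ :- c := x :* (o :* (b₁ :+ o :* b₀ :- c) :+ e :* (e :* b₀ :- c))
        :+ con 1ℤ :* (b₁ :- (con 1ℤ :+ x :* (o :* b₁)))
        :+ b₀ :* (o :- (con 0ℤ :+ (x :* (e :* e) :+ x :* (o :* o))))
        :+ (:- con 1ℤ) :* (c :- (con 1ℤ :+ x :* (c :* c)))
        :+ (:- (x :* c)) :* (c :- (e :+ o)))
        ≈ˢ-refl X 𝐂 𝐄 𝐎 B₀ B₁) B₁-eq 𝐎-eq 𝐂-eq 𝐂-parity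
    V-eq : V ≈ˢ X ⊛ (𝐄 ⊛ U ⊕ 𝐎 ⊛ V)
    V-eq = modulo₄ (const 1ℤ) B₀ (⊖ const 1ℤ) (⊖ (X ⊛ 𝐂))
      (solve 6 (λ x c e o b₀ b₁ →
        e :* b₀ :- c := x :* (e :* (b₁ :+ o :* b₀ :- c) :+ o :* (e :* b₀ :- c))
        :+ con 1ℤ :* (b₀ :- (con 1ℤ :+ x :* (e :* b₁)))
        :+ b₀ :* (e :- (con 1ℤ :+ (x :* (e :* o) :+ x :* (o :* e))))
        :+ (:- con 1ℤ) :* (c :- (con 1ℤ :+ x :* (c :* c)))
        :+ (:- (x :* c)) :* (c :- (e :+ o)))
        ≈ˢ-refl X 𝐂 𝐄 𝐎 B₀ B₁) B₀-eq 𝐄-eq 𝐂-eq 𝐂-parity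

  -- Multiplied by `𝐄`, the equations of `e₀` and `e₁` become those of `h₀` and `h₁`, as `𝐄⊛B₀`
  -- replaces the inhomogeneous term. So the differences satisfy a homogeneous system.
  e₀⊛𝐄 : h₀ ≈ˢ e₀ ⊛ 𝐄
  e₀⊛𝐄 = ⊝-zero⁻ (linear-system-zero₁ P-eq Q-eq)
    where
    P Q : Series
    P = h₀ ⊝ e₀ ⊛ 𝐄
    Q = h₁ ⊝ e₁ ⊛ 𝐄
    P-eq : P ≈ˢ X ⊛ ((𝐂 ⊕ 𝐎) ⊛ P ⊕ 𝐄 ⊛ Q)
    P-eq = modulo₃ (const 1ℤ) (⊖ 𝐄) (⊖ (X ⊛ 𝐎))
      (solve 9 (λ x c e o b₀ e₀ e₁ h₀ h₁ →
        h₀ :- e₀ :* e := x :* ((c :+ o) :* (h₀ :- e₀ :* e) :+ e :* (h₁ :- e₁ :* e))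
        :+ con 1ℤ :* (h₀ :- (con 0ℤ :+ (x :* (h₀ :* c) :+ (x :* (o :* c) :+ (x :* (e :* h₁) :+ x :* (o :* h₀))))))
        :+ (:- e) :* (e₀ :- (con 0ℤ :+ (x :* (e₀ :* c) :+ (x :* (o :* b₀) :+ (x :* (e :* e₁) :+ x :* (o :* e₀))))))
        :+ (:- (x :* o)) :* (e :* b₀ :- c))
        ≈ˢ-refl X 𝐂 𝐄 𝐎 B₀ e₀ e₁ h₀ h₁) h₀-eq e₀-eq 𝐄⊛B₀
    Q-eq : Q ≈ˢ X ⊛ (𝐄 ⊛ P ⊕ (𝐂 ⊕ 𝐎) ⊛ Q)
    Q-eq = modulo₃ (const 1ℤ) (⊖ 𝐄) (⊖ (X ⊛ 𝐄))
      (solve 9 (λ x c e o b₀ e₀ e₁ h₀ h₁ →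
        h₁ :- e₁ :* e := x :* (e :* (h₀ :- e₀ :* e) :+ (c :+ o) :* (h₁ :- e₁ :* e))
        :+ con 1ℤ :* (h₁ :- (con 0ℤ :+ (x :* (h₁ :* c) :+ (x :* (e :* c) :+ (x :* (e :* h₀) :+ x :* (o :* h₁))))))
        :+ (:- e) :* (e₁ :- (con 0ℤ :+ (x :* (e₁ :* c) :+ (x :* (e :* b₀) :+ (x :* (e :* e₀) :+ x :* (o :* e₁))))))
        :+ (:- (x :* e)) :* (e :* b₀ :- c))
        ≈ˢ-refl X 𝐂 𝐄 𝐎 B₀ e₀ e₁ h₀ h₁) h₁-eq e₁-eq 𝐄⊛B₀

  sgn-odd : ∀ n → sgn n ≡ (if odd n then -1ℤ else 1ℤ)
  sgn-odd zero    = refl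
  sgn-odd (suc n) with odd n | sgn-odd n
  ... | true  | e = cong -_ e
  ... | false | e = cong -_ e

  𝐄-coeff : 𝐄 ≗ λ n → ind (not (odd n)) * 𝐂 n
  𝐄-coeff n = trans (at (total-cong λ t → sym (*-identityʳ (evenSize t))) n) (total-size (λ k → ind (not (odd k))) one n)

  h₀-coeff : h₀ ≗ λ n → + oddsBelow false n * 𝐂 n
  h₀-coeff n = trans (at (total-cong λ t → sym (*-identityʳ (odds false t))) n) (total-size (λ k → + oddsBelow false k) one n)

  𝐄⊕𝐄 : 𝐄 ⊕ 𝐄 ≈ˢ 𝐂 ⊕ σ 𝐂
  𝐄⊕𝐄 = pointwise λ n → trans (cong₂ _+_ (𝐄-coeff n) (𝐄-coeff n))
    (trans (lemma (odd n) (𝐂 n)) (cong (λ s → 𝐂 n + s * 𝐂 n) (sym (sgn-odd n))))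
    where
    lemma : ∀ b c → ind (not b) * c + ind (not b) * c ≡ c + (if b then -1ℤ else 1ℤ) * c
    lemma true  = solveℤ 1 (λ c → κ 0ℤ ⊠ c ⊞ κ 0ℤ ⊠ c ≔ c ⊞ κ -1ℤ ⊠ c) refl
    lemma false = solveℤ 1 (λ c → κ 1ℤ ⊠ c ⊞ κ 1ℤ ⊠ c ≔ c ⊞ κ 1ℤ ⊠ c) refl

  σ-𝐄 : σ 𝐄 ≈ˢ 𝐄
  σ-𝐄 = pointwise λ n → trans (cong₂ _*_ (sgn-odd n) (𝐄-coeff n)) (trans (lemma (odd n) (𝐂 n)) (sym (𝐄-coeff n)))
    where
    lemma : ∀ b c → (if b then -1ℤ else 1ℤ) * (ind (not b) * c) ≡ ind (not b) * c
    lemma true  = solveℤ 1 (λ c → κ -1ℤ ⊠ (κ 0ℤ ⊠ c) ≔ κ 0ℤ ⊠ c) refl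
    lemma false c = *-identityˡ _

  sgn-2* : ∀ i → sgn (2 ℕ.* i) ≡ 1ℤ
  sgn-2* i = trans (sgn-odd (2 ℕ.* i)) (cong (if_then -1ℤ else 1ℤ) (odd-2* i))

  oddsBelow-2* : ∀ i → oddsBelow false (2 ℕ.* i) ≡ i
  oddsBelow-2* zero    = refl
  oddsBelow-2* (suc i) = trans (cong (oddsBelow false) (2*suc i)) (cong suc (oddsBelow-2* i))

  -- A tree of even size n has n/2 odd positions, which the sum doubles; odd degrees cancel.
  h₀⊕σh₀ : h₀ ⊕ σ h₀ ≈ˢ θ 𝐄
  h₀⊕σh₀ = pointwise λ n → trans (cong₂ (λ u v → u + sgn n * v) (h₀-coeff n) (h₀-coeff n))
    (trans (go n (half n)) (cong (+ n *_) (sym (𝐄-coeff n))))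
    where
    go : ∀ n → Half n → + oddsBelow false n * 𝐂 n + sgn n * (+ oddsBelow false n * 𝐂 n) ≡ + n * (ind (not (odd n)) * 𝐂 n)
    go n (evenʰ i) = at-even (𝐂 n) (sgn-2* i) (cong +_ (oddsBelow-2* i)) (odd-2* i) (pos-* 2 i)
      where
      at-even : ∀ c {s h o k} → s ≡ 1ℤ → h ≡ + i → o ≡ false → k ≡ + 2 * + i →
                h * c + s * (h * c) ≡ k * (ind (not o) * c)
      at-even c refl refl refl refl = solveℤ 2 (λ i c → i ⊠ c ⊞ κ 1ℤ ⊠ (i ⊠ c) ≔
        κ (+ 2) ⊠ i ⊠ (κ 1ℤ ⊠ c)) refl (+ i) c
    go n (oddʰ i) = at-odd (+ oddsBelow false n) (+ n) (𝐂 n) (cong -_ (sgn-2* i)) (cong not (odd-2* i))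
      where
      at-odd : ∀ h k c {s o} → s ≡ -1ℤ → o ≡ true → h * c + s * (h * c) ≡ k * (ind (not o) * c)
      at-odd h k c refl refl = solveℤ 3 (λ h k c → h ⊠ c ⊞ κ -1ℤ ⊠ (h ⊠ c) ≔
        k ⊠ (κ 0ℤ ⊠ c)) refl h k c

  -- Both sides have the product `𝐄 + 2 θ 𝐄` with `𝐄`: the left one by `central²-even`, the right
  -- one by `e₀⊛𝐄` and its reflection under `σ`.
  paths-series : central² 𝐂 𝐂-eq ≈ˢ const 1ℤ ⊕ const (+ 2) ⊛ (e₀ ⊕ σ e₀)
  paths-series = ⊝-zero⁻ (linear-system-zero₁ W-eq W-eq)
    where
    D W : Series
    D = central² 𝐂 𝐂-eq
    W = D ⊝ (const 1ℤ ⊕ const (+ 2) ⊛ (e₀ ⊕ σ e₀))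
    θE : e₀ ⊛ 𝐄 ⊕ σ e₀ ⊛ 𝐄 ≈ˢ θ 𝐄
    θE = ≈ˢ-trans (+-cong (≈ˢ-sym e₀⊛𝐄) (≈ˢ-trans (*-congˡ {σ e₀} (≈ˢ-sym σ-𝐄))
      (≈ˢ-trans (≈ˢ-sym (σ-⊛ e₀ 𝐄)) (σ-cong (≈ˢ-sym e₀⊛𝐄))))) h₀⊕σh₀
    -- Since `𝐄` is 1 plus a multiple of `X`, the relation `𝐄 ⊛ W = 0` can be solved for `W`. The
    -- second unknown of the system is `W` again, with coefficient 0.
    W-eq : W ≈ˢ X ⊛ ((⊖ (𝐄 ⊛ 𝐎 ⊕ 𝐎 ⊛ 𝐄)) ⊛ W ⊕ const 0ℤ ⊛ W)
    W-eq = modulo₃ (⊖ W) (const 1ℤ) (⊖ const (+ 2))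
      (solve 7 (λ x e o d p q t →
        d :- (con 1ℤ :+ con (+ 2) :* (p :+ q)) :=
        x :* ((:- (e :* o :+ o :* e)) :* (d :- (con 1ℤ :+ con (+ 2) :* (p :+ q)))
          :+ con 0ℤ :* (d :- (con 1ℤ :+ con (+ 2) :* (p :+ q))))
        :+ (:- (d :- (con 1ℤ :+ con (+ 2) :* (p :+ q)))) :* (e :- (con 1ℤ :+ (x :* (e :* o) :+ x :* (o :* e))))
        :+ con 1ℤ :* (d :* e :- (e :+ con (+ 2) :* t))
        :+ (:- con (+ 2)) :* ((p :* e :+ q :* e) :- t))
        ≈ˢ-refl X 𝐄 𝐎 D e₀ (σ e₀) (θ 𝐄)) 𝐄-eq (central²-even 𝐂 𝐂-eq 𝐄⊕𝐄) θE

  total-paths : ∀ m → + 4 * e₀ (2 ℕ.* suc m) ≡ central² 𝐂 𝐂-eq (2 ℕ.* suc m)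
  total-paths m = sym (trans (at paths-series n) (trans (ℤ.+-identityˡ _) (trans (const-⊛ (+ 2) (e₀ ⊕ σ e₀) n)
    (trans (cong (λ s → + 2 * (e₀ n + s * e₀ n)) (sgn-2* (suc m)))
      (solveℤ 1 (λ e → κ (+ 2) ⊠ (e ⊞ κ 1ℤ ⊠ e) ≔ κ (+ 4) ⊠ e) refl (e₀ n))))))
    where
    n : ℕ
    n = 2 ℕ.* suc m

open TreeSeries

-- Catalan numbers, central binomial coefficients, and the sum of all distances.

module DistanceSum where

  open import Data.Bool using (false)
  open import Data.Integer as ℤ using (ℤ; +_; 0ℤ; 1ℤ)
  import Data.Integer.Properties as ℤ
  open import Data.Integer.Solver using (module +-*-Solver)
  open import Data.List using (List; []; _∷_; map; length)
  open import Data.List.Properties using (length-map)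
  open import Data.List.Relation.Binary.Permutation.Propositional.Properties using (↭-length)
  open import Data.Nat
  open import Data.Nat.Combinatorics using (_C_; nCk≡n!/k![n-k]!; k![n∸k]!∣n!)
  open import Data.Nat.DivMod using (m/n*n≡m)
  open import Data.Nat.ListAction using (sum)
  open import Data.Nat.Properties
  import Data.Nat.Solver as ℕSolver
  open import Relation.Binary.PropositionalEquality
    using (_≡_; refl; sym; trans; cong; cong₂; module ≡-Reasoning)
  open +-*-Solver using () renaming (solve to solveℤ; con to κ; _:+_ to _⊞_; _:*_ to _⊠_; _:=_ to _≔_)
  open ℕSolver.+-*-Solver

  catalan : ℕ → ℕ
  catalan n = length (trees n)

  centralBinomial : ℕ → ℕ
  centralBinomial n = (2 * n) C n

  private
    Σ-one : ∀ ts → Σ[ one ] ts ≡ + length ts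
    Σ-one []       = refl
    Σ-one (t ∷ ts) = cong (λ z → 1ℤ ℤ.+ z) (Σ-one ts)

    Σ-pos : ∀ (f : Tree → ℕ) ts → Σ[ (λ t → + f t) ] ts ≡ + sum (map f ts)
    Σ-pos f []       = refl
    Σ-pos f (t ∷ ts) = trans (cong (λ z → + f t ℤ.+ z) (Σ-pos f ts)) (sym (ℤ.pos-+ (f t) _))

    B D : Series
    B = central 𝐂 𝐂-eq
    D = central² 𝐂 𝐂-eq

    C-catalan : ∀ n → 𝐂 n ≡ + catalan n
    C-catalan n = Σ-one (trees n)

    B-catalan : ∀ n → B n ≡ + (suc n * catalan n)
    B-catalan n = trans (cong₂ (λ u v → u ℤ.+ + n ℤ.* v) (C-catalan n) (C-catalan n))
      (trans (cong (λ z → + catalan n ℤ.+ z) (sym (ℤ.pos-* n (catalan n)))) (sym (ℤ.pos-+ (catalan n) _)))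

  catalan-suc : ∀ n → suc (suc n) * catalan (suc n) ≡ (4 * n + 2) * catalan n
  catalan-suc n = ℤ.+-injective (begin
    + (suc (suc n) * catalan (suc n))           ≡⟨ B-catalan (suc n) ⟨
    B (suc n)                                   ≡⟨ at (central-suc 𝐂 𝐂-eq) (suc n) ⟩
    0ℤ ℤ.+ (X ⊛ Y) (suc n)                      ≡⟨ trans (ℤ.+-identityˡ _) (X⊛-suc Y n) ⟩
    Y n                                         ≡⟨ cong₂ ℤ._+_ (const-⊛ (+ 4) (θ 𝐂) n) (const-⊛ (+ 2) 𝐂 n) ⟩
    + 4 ℤ.* (+ n ℤ.* 𝐂 n) ℤ.+ + 2 ℤ.* 𝐂 n       ≡⟨ cong (λ c → + 4 ℤ.* (+ n ℤ.* c) ℤ.+ + 2 ℤ.* c) (C-catalan n) ⟩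
    + 4 ℤ.* (+ n ℤ.* + catalan n) ℤ.+ + 2 ℤ.* + catalan n
      ≡⟨ solveℤ 2 (λ n c → κ (+ 4) ⊠ (n ⊠ c) ⊞ κ (+ 2) ⊠ c ≔
           (κ (+ 4) ⊠ n ⊞ κ (+ 2)) ⊠ c) refl (+ n) (+ catalan n) ⟩
    (+ 4 ℤ.* + n ℤ.+ + 2) ℤ.* + catalan n       ≡⟨ cong (λ z → (z ℤ.+ + 2) ℤ.* + catalan n) (ℤ.pos-* 4 n) ⟨
    (+ (4 * n) ℤ.+ + 2) ℤ.* + catalan n         ≡⟨ cong (ℤ._* + catalan n) (ℤ.pos-+ (4 * n) 2) ⟨
    + (4 * n + 2) ℤ.* + catalan n               ≡⟨ ℤ.pos-* (4 * n + 2) (catalan n) ⟨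
    + ((4 * n + 2) * catalan n)                 ∎)
    where
    open ≡-Reasoning
    Y : Series
    Y = const (+ 4) ⊛ θ 𝐂 ⊕ const (+ 2) ⊛ 𝐂

  [2*suc]! : ∀ n → (2 * suc n) ! ≡ suc (suc (2 * n)) * (suc (2 * n) * (2 * n) !)
  [2*suc]! n = cong _! (2*suc n)

  catalan-factorial : ∀ n → catalan n * (n ! * suc n !) ≡ (2 * n) !
  catalan-factorial zero    = refl
  catalan-factorial (suc n) = begin
    c′ * (suc n * n ! * (suc (suc n) * suc n !))
      ≡⟨ solve 4 (λ c n f g → c :* ((con 1 :+ n) :* f :* ((con 2 :+ n) :* g)) :=
           ((con 2 :+ n) :* c) :* ((con 1 :+ n) :* (f :* g))) refl c′ n (n !) (suc n !) ⟩
    suc (suc n) * c′ * (suc n * (n ! * suc n !))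
      ≡⟨ cong (_* (suc n * (n ! * suc n !))) (catalan-suc n) ⟩
    (4 * n + 2) * catalan n * (suc n * (n ! * suc n !))
      ≡⟨ solve 3 (λ n c f → (con 4 :* n :+ con 2) :* c :* ((con 1 :+ n) :* f) :=
           (con 2 :+ con 2 :* n) :* ((con 1 :+ con 2 :* n) :* (c :* f))) refl
           n (catalan n) (n ! * suc n !) ⟩
    suc (suc (2 * n)) * (suc (2 * n) * (catalan n * (n ! * suc n !)))
      ≡⟨ cong (λ z → suc (suc (2 * n)) * (suc (2 * n) * z)) (catalan-factorial n) ⟩
    suc (suc (2 * n)) * (suc (2 * n) * (2 * n) !)
      ≡⟨ [2*suc]! n ⟨
    (2 * suc n) ! ∎
    where
    open ≡-Reasoning
    c′ : ℕ
    c′ = catalan (suc n)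

  centralBinomial-factorial : ∀ n → centralBinomial n * (n ! * n !) ≡ (2 * n) !
  centralBinomial-factorial n = trans
    (cong (λ k → centralBinomial n * (n ! * k !)) (sym (trans (m+n∸m≡n n (n + 0)) (+-identityʳ n))))
    (trans (cong (_* (n ! * (2 * n ∸ n) !)) (nCk≡n!/k![n-k]! n≤2n))
      (m/n*n≡m {{n !* (2 * n ∸ n) !≢0}} (k![n∸k]!∣n! n≤2n)))
    where
    n≤2n : n ≤ 2 * n
    n≤2n = m≤m+n n (n + 0)

  suc-*-catalan : ∀ n → suc n * catalan n ≡ centralBinomial n
  suc-*-catalan n = *-cancelʳ-≡ _ _ (n ! * n !) {{n !* n !≢0}} (begin
    suc n * catalan n * (n ! * n !)
      ≡⟨ solve 3 (λ m c f → m :* c :* (f :* f) := c :* (f :* (m :* f))) refl (suc n) (catalan n) (n !) ⟩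
    catalan n * (n ! * suc n !)         ≡⟨ catalan-factorial n ⟩
    (2 * n) !                           ≡⟨ centralBinomial-factorial n ⟨
    centralBinomial n * (n ! * n !)     ∎)
    where open ≡-Reasoning

  centralBinomial-suc : ∀ n → suc n * centralBinomial (suc n) ≡ (4 * n + 2) * centralBinomial n
  centralBinomial-suc n = begin
    suc n * centralBinomial (suc n)
      ≡⟨ cong (suc n *_) (trans (sym (suc-*-catalan (suc n))) (catalan-suc n)) ⟩
    suc n * ((4 * n + 2) * catalan n)
      ≡⟨ solve 3 (λ n k c → n :* (k :* c) := k :* (n :* c)) refl (suc n) (4 * n + 2) (catalan n) ⟩
    (4 * n + 2) * (suc n * catalan n)             ≡⟨ cong ((4 * n + 2) *_) (suc-*-catalan n) ⟩
    (4 * n + 2) * centralBinomial n               ∎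
    where open ≡-Reasoning

  private
    D-suc² : ∀ n → + suc (suc n) ℤ.* D (suc (suc n)) ≡ + 16 ℤ.* (+ n ℤ.* D n ℤ.+ D n)
    D-suc² n = trans (at (central²-θ 𝐂 𝐂-eq) (suc (suc n))) (trans (const-⊛ (+ 16) (X ⊛ (X ⊛ (θ D ⊕ D))) (suc (suc n)))
      (cong (λ z → + 16 ℤ.* z) (trans (X⊛-suc (X ⊛ (θ D ⊕ D)) (suc n)) (X⊛-suc (θ D ⊕ D) n))))

    -- The expansion of 1/√(1 - 4Y) at Y = 4X², obtained from the two-step recurrence of
    -- `central²-θ`.
    D-even : ∀ m → D (2 * m) ≡ + (4 ^ m * centralBinomial m)
    D-even zero    = refl
    D-even (suc m) = trans (cong D (2*suc m)) (ℤ.*-cancelˡ-≡ (+ suc (suc (2 * m))) _ _ (begin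
      + suc (suc (2 * m)) ℤ.* D (suc (suc (2 * m)))       ≡⟨ D-suc² (2 * m) ⟩
      + 16 ℤ.* (+ (2 * m) ℤ.* D (2 * m) ℤ.+ D (2 * m))
        ≡⟨ cong (λ d → + 16 ℤ.* (+ (2 * m) ℤ.* d ℤ.+ d)) (D-even m) ⟩
      + 16 ℤ.* (+ (2 * m) ℤ.* + p ℤ.+ + p)
        ≡⟨ cong (λ z → + 16 ℤ.* (z ℤ.+ + p)) (ℤ.pos-* (2 * m) p) ⟨
      + 16 ℤ.* (+ (2 * m * p) ℤ.+ + p)
        ≡⟨ cong (λ z → + 16 ℤ.* z) (ℤ.pos-+ (2 * m * p) p) ⟨
      + 16 ℤ.* + (2 * m * p + p)                          ≡⟨ ℤ.pos-* 16 (2 * m * p + p) ⟨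
      + (16 * (2 * m * p + p))                            ≡⟨ cong +_ natural ⟩
      + (suc (suc (2 * m)) * (4 ^ suc m * centralBinomial (suc m)))
        ≡⟨ ℤ.pos-* (suc (suc (2 * m))) (4 ^ suc m * centralBinomial (suc m)) ⟩
      + suc (suc (2 * m)) ℤ.* + (4 ^ suc m * centralBinomial (suc m)) ∎))
      where
      open ≡-Reasoning
      b b′ p : ℕ
      b = centralBinomial m
      b′ = centralBinomial (suc m)
      p = 4 ^ m * b
      natural : 16 * (2 * m * p + p) ≡ suc (suc (2 * m)) * (4 * 4 ^ m * b′)
      natural = begin
        16 * (2 * m * (4 ^ m * b) + 4 ^ m * b)
          ≡⟨ solve 3 (λ m q b → con 16 :* (con 2 :* m :* (q :* b) :+ q :* b) :=
               con 8 :* q :* ((con 4 :* m :+ con 2) :* b)) refl m (4 ^ m) b ⟩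
        8 * 4 ^ m * ((4 * m + 2) * b)     ≡⟨ cong (8 * 4 ^ m *_) (centralBinomial-suc m) ⟨
        8 * 4 ^ m * (suc m * b′)
          ≡⟨ solve 3 (λ m q b → con 8 :* q :* ((con 1 :+ m) :* b) :=
               (con 2 :+ con 2 :* m) :* (con 4 :* q :* b)) refl m (4 ^ m) b′ ⟩
        suc (suc (2 * m)) * (4 * 4 ^ m * b′) ∎

  sum-leftLeaves : ∀ n → 2 * sum (map leftLeaves (trees (suc n))) ≡ centralBinomial (suc n)
  sum-leftLeaves n = ℤ.+-injective (begin
    + (2 * sum (map leftLeaves (trees (suc n))))    ≡⟨ ℤ.pos-* 2 (sum (map leftLeaves (trees (suc n)))) ⟩
    + 2 ℤ.* + sum (map leftLeaves (trees (suc n)))  ≡⟨ cong (λ z → + 2 ℤ.* z) (Σ-pos leftLeaves (trees (suc n))) ⟨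
    + 2 ℤ.* LL (suc n)                              ≡⟨ const-⊛ (+ 2) LL (suc n) ⟨
    (const (+ 2) ⊛ LL) (suc n)                      ≡⟨ at leftLeaves-series (suc n) ⟩
    B (suc n) ℤ.+ 0ℤ                                ≡⟨ ℤ.+-identityʳ _ ⟩
    B (suc n)                                       ≡⟨ B-catalan (suc n) ⟩
    + (suc (suc n) * catalan (suc n))               ≡⟨ cong +_ (suc-*-catalan (suc n)) ⟩
    + centralBinomial (suc n)                       ∎)
    where open ≡-Reasoning

  sum-oddPaths : ∀ m → 4 * sum (map (oddPaths false) (trees (2 * suc m))) ≡ 4 ^ suc m * centralBinomial (suc m)
  sum-oddPaths m = ℤ.+-injective (trans (ℤ.pos-* 4 (sum (map (oddPaths false) (trees n)))) (trans
    (cong (λ z → + 4 ℤ.* z) (sym (Σ-pos (oddPaths false) (trees n))))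
    (trans (total-paths m) (D-even (suc m)))))
    where
    n : ℕ
    n = 2 * suc m

  private
    sum-+ : ∀ {A : Set} (f g : A → ℕ) xs → sum (map (λ x → f x + g x) xs) ≡ sum (map f xs) + sum (map g xs)
    sum-+ f g []       = refl
    sum-+ f g (x ∷ xs) = trans (cong (λ z → f x + g x + z) (sum-+ f g xs))
      (solve 4 (λ a b c d → a :+ b :+ (c :+ d) := a :+ c :+ (b :+ d)) refl (f x) (g x) (sum (map f xs)) (sum (map g xs)))

    sum-const : ∀ {A : Set} k (xs : List A) → sum (map (λ _ → k) xs) ≡ k * length xs
    sum-const k []       = sym (*-zeroʳ k)
    sum-const k (x ∷ xs) = trans (cong (λ z → k + z) (sum-const k xs)) (sym (*-suc k (length xs)))

    sum-* : ∀ {A : Set} k (f : A → ℕ) xs → sum (map (λ x → k * f x) xs) ≡ k * sum (map f xs)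
    sum-* k f []       = sym (*-zeroʳ k)
    sum-* k f (x ∷ xs) = trans (cong (λ z → k * f x + z) (sum-* k f xs)) (sym (*-distribˡ-+ k (f x) _))

  length-allNC : ∀ n → length (allNC n) ≡ catalan n
  length-allNC n = trans (sym (length-map encode (allNC n))) (↭-length (encode-↭ n))

  -- Doubled because the mean of L is m + 1/2. The 3 is 2(m + 2) - (2m + 1), from the potential m +
  -- 2 of the pairing and from twice that mean.
  distance-sum : ∀ k → let m = suc k in
    2 * sum (map (d-H (λ₂ m)) (allNC (2 * m))) + 3 * catalan (2 * m) ≡ 4 ^ m * centralBinomial m
  distance-sum k = +-cancelʳ-≡ ((2 * m + 1) * c) _ _ (begin
    2 * s + 3 * c + (2 * m + 1) * c
      ≡⟨ solve 3 (λ s m c → con 2 :* s :+ con 3 :* c :+ (con 2 :* m :+ con 1) :* c :=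
           con 2 :* (s :+ (m :+ con 2) :* c)) refl s m c ⟩
    2 * (s + (m + 2) * c)             ≡⟨ cong (2 *_) potential-sum ⟩
    2 * (L + 2 * P)                   ≡⟨ solve 2 (λ l p → con 2 :* (l :+ con 2 :* p) :=
                                           con 4 :* p :+ con 2 :* l) refl L P ⟩
    4 * P + 2 * L                     ≡⟨ cong₂ _+_ (sum-oddPaths k) 2L ⟩
    4 ^ m * centralBinomial m + (2 * m + 1) * c ∎)
    where
    open ≡-Reasoning
    m n c s L P : ℕ
    m = suc k
    n = 2 * m
    c = catalan n
    s = sum (map (d-H (λ₂ m)) (allNC n))
    L = sum (map leftLeaves (trees n))
    P = sum (map (oddPaths false) (trees n))
    2L : 2 * L ≡ (2 * m + 1) * c
    2L = trans (sum-leftLeaves (k + (suc k + 0))) (trans (sym (suc-*-catalan n)) (cong (_* c) (+-comm 1 n)))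
    potential-sum : s + (m + 2) * c ≡ L + 2 * P
    potential-sum = begin
      s + (m + 2) * c
        ≡⟨ cong (λ z → s + (m + 2) * z) (length-allNC n) ⟨
      s + (m + 2) * length (allNC n)
        ≡⟨ cong (λ z → s + z) (sum-const (m + 2) (allNC n)) ⟨
      s + sum (map (λ _ → m + 2) (allNC n))
        ≡⟨ sum-+ (d-H (λ₂ m)) (λ _ → m + 2) (allNC n) ⟨
      sum (map (λ ρ → d-H (λ₂ m) ρ + (m + 2)) (allNC n))
        ≡⟨ sum-allNC n (λ ρ → trans (distance m (s≤s z≤n) ρ) (potential-encode ρ)) ⟩
      sum (map (λ t → leftLeaves t + 2 * oddPaths false t) (trees n))
        ≡⟨ sum-+ leftLeaves (λ t → 2 * oddPaths false t) (trees n) ⟩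
      L + sum (map (λ t → 2 * oddPaths false t) (trees n))
        ≡⟨ cong (λ z → L + z) (sum-* 2 (oddPaths false) (trees n)) ⟩
      L + 2 * P ∎

open DistanceSum

-- Monotone multiples of squared central binomial coefficients.

module CentralBinomialBounds where

  open import Data.Nat
  open import Data.Nat.Properties
  open import Data.Nat.Solver using (module +-*-Solver)
  open import Relation.Binary.PropositionalEquality using (_≡_; refl; sym; trans; cong)
  open +-*-Solver
  open ≤-Reasoning

  -- Polynomial inequalities below are certified by an explicit remainder `r`, and the ring solver
  -- checks the resulting equation.
  ≤-from-≡ : ∀ {a b} r → a + r ≡ b → a ≤ b
  ≤-from-≡ {a} r refl = m≤m+n a r

  private
    b : ℕ → ℕ
    b = centralBinomial

    b²-suc : ∀ n → suc n * suc n * (b (suc n) * b (suc n)) ≡ (4 * n + 2) * (4 * n + 2) * (b n * b n)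
    b²-suc n = begin-equality
      suc n * suc n * (b (suc n) * b (suc n))
        ≡⟨ solve 2 (λ n b → n :* n :* (b :* b) := n :* b :* (n :* b)) refl (suc n) (b (suc n)) ⟩
      suc n * b (suc n) * (suc n * b (suc n))     ≡⟨ cong (λ x → x * x) (centralBinomial-suc n) ⟩
      (4 * n + 2) * b n * ((4 * n + 2) * b n)
        ≡⟨ solve 2 (λ n b → n :* b :* (n :* b) := n :* n :* (b :* b)) refl (4 * n + 2) (b n) ⟩
      (4 * n + 2) * (4 * n + 2) * (b n * b n)     ∎

    increasing-step : ∀ n → (4 * n + 1) * (b n * b n) * 16 ≤ (4 * suc n + 1) * (b (suc n) * b (suc n))
    increasing-step n = *-cancelˡ-≤ (suc n * suc n) (begin
      suc n * suc n * ((4 * n + 1) * (b n * b n) * 16)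
        ≤⟨ ≤-from-≡ (4 * (b n * b n)) (solve 2 (λ n q →
             (con 1 :+ n) :* (con 1 :+ n) :* ((con 4 :* n :+ con 1) :* q :* con 16) :+ con 4 :* q :=
             (con 4 :* (con 1 :+ n) :+ con 1) :* ((con 4 :* n :+ con 2) :* (con 4 :* n :+ con 2) :* q)) refl n (b n * b n)) ⟩
      (4 * suc n + 1) * ((4 * n + 2) * (4 * n + 2) * (b n * b n))
        ≡⟨ cong ((4 * suc n + 1) *_) (b²-suc n) ⟨
      (4 * suc n + 1) * (suc n * suc n * (b (suc n) * b (suc n)))
        ≡⟨ solve 3 (λ p q r → p :* (q :* r) := q :* (p :* r)) refl (4 * suc n + 1) (suc n * suc n) (b (suc n) * b (suc n)) ⟩
      suc n * suc n * ((4 * suc n + 1) * (b (suc n) * b (suc n))) ∎)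

  -- (4n+1) C(2n,n)² / 16ⁿ is increasing in n.
  increasing : ∀ n k → (4 * n + 1) * (b n * b n) * 16 ^ k ≤ (4 * (k + n) + 1) * (b (k + n) * b (k + n))
  increasing n zero    = ≤-reflexive (*-identityʳ _)
  increasing n (suc k) = begin
    (4 * n + 1) * (b n * b n) * (16 * 16 ^ k)
      ≡⟨ solve 2 (λ p q → p :* (con 16 :* q) := p :* q :* con 16) refl ((4 * n + 1) * (b n * b n)) (16 ^ k) ⟩
    (4 * n + 1) * (b n * b n) * 16 ^ k * 16             ≤⟨ *-monoˡ-≤ 16 (increasing n k) ⟩
    (4 * (k + n) + 1) * (b (k + n) * b (k + n)) * 16    ≤⟨ increasing-step (k + n) ⟩
    (4 * suc (k + n) + 1) * (b (suc (k + n)) * b (suc (k + n))) ∎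

  private
    -- This is 32n² times 1 + 1/(4n) + 1/(32n²), the first three terms in the expansion of 16ⁿ / (πn
    -- C(2n,n)²). The first two terms, times 4n, give the factor 4n + 1 of `increasing`.
    A : ℕ → ℕ
    A n = 32 * (n * n) + 8 * n + 1

    decreasing-step : ∀ n → A (suc n) * (b (suc n) * b (suc n)) * n ≤ 16 * suc n * A n * (b n * b n)
    decreasing-step n = *-cancelˡ-≤ (suc n * suc n) (begin
      suc n * suc n * (A (suc n) * (b (suc n) * b (suc n)) * n)
        ≡⟨ solve 4 (λ p q r s → p :* (q :* r :* s) :=
             q :* s :* (p :* r)) refl (suc n * suc n) (A (suc n)) (b (suc n) * b (suc n)) n ⟩
      A (suc n) * n * (suc n * suc n * (b (suc n) * b (suc n)))
        ≡⟨ cong (A (suc n) * n *_) (b²-suc n) ⟩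
      A (suc n) * n * ((4 * n + 2) * (4 * n + 2) * (b n * b n))
        ≤⟨ ≤-from-≡ ((12 * n + 16) * (b n * b n)) (solve 2 (λ n q →
             (con 32 :* ((con 1 :+ n) :* (con 1 :+ n)) :+ con 8 :* (con 1 :+ n) :+ con 1) :* n
               :* ((con 4 :* n :+ con 2) :* (con 4 :* n :+ con 2) :* q) :+ (con 12 :* n :+ con 16) :* q :=
             (con 1 :+ n) :* (con 1 :+ n) :* (con 16 :* (con 1 :+ n) :* (con 32 :* (n :* n) :+ con 8 :* n :+ con 1) :* q))
             refl n (b n * b n)) ⟩
      suc n * suc n * (16 * suc n * A n * (b n * b n)) ∎)

  -- (32n²+8n+1) C(2n,n)² / (n 16ⁿ) is decreasing in n ≥ 1.
  decreasing : ∀ n k → let j = k + suc n in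
    A j * (b j * b j) * suc n ≤ 16 ^ k * j * A (suc n) * (b (suc n) * b (suc n))
  decreasing n zero    = ≤-reflexive (solve 3 (λ a q n → a :* q :* n := con 1 :* n :* a :* q) refl
    (A (suc n)) (b (suc n) * b (suc n)) (suc n))
  decreasing n (suc k) = *-cancelˡ-≤ j {{>-nonZero (≤-trans (s≤s z≤n) (m≤n+m (suc n) k))}} (begin
    j * (A (suc j) * q′ * suc n)
      ≡⟨ solve 4 (λ j a q n → j :* (a :* q :* n) := a :* q :* j :* n) refl j (A (suc j)) q′ (suc n) ⟩
    A (suc j) * q′ * j * suc n                ≤⟨ *-monoˡ-≤ (suc n) (decreasing-step j) ⟩
    16 * suc j * A j * q * suc n
      ≡⟨ solve 4 (λ s a q n → con 16 :* s :* a :* q :* n := con 16 :* s :* (a :* q :* n)) refl (suc j) (A j) q (suc n) ⟩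
    16 * suc j * (A j * q * suc n)            ≤⟨ *-monoʳ-≤ (16 * suc j) (decreasing n k) ⟩
    16 * suc j * (16 ^ k * j * A (suc n) * p)
      ≡⟨ solve 5 (λ s t j a p → con 16 :* s :* (t :* j :* a :* p) :=
           j :* (con 16 :* t :* s :* a :* p)) refl (suc j) (16 ^ k) j (A (suc n)) p ⟩
    j * (16 * 16 ^ k * suc j * A (suc n) * p) ∎)
    where
    j q q′ p : ℕ
    j = k + suc n
    q = b j * b j
    q′ = b (suc j) * b (suc j)
    p = b (suc n) * b (suc n)

  module _ (k : ℕ) where

    private
      m c h : ℕ
      m = suc k
      c = catalan (2 * m)
      h = 16 ^ m * (b m * b m)

      b-2m : b (m + m) ≡ (2 * m + 1) * c
      b-2m = trans (cong (λ z → b (m + z)) (sym (+-identityʳ m)))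
        (trans (sym (suc-*-catalan (2 * m))) (cong (_* c) (+-comm 1 (2 * m))))

    -- `increasing` is applied from m to 2m, where the binomial is (2m + 1) c. The constant 7 makes
    -- the cubic and quadratic coefficients of the two sides agree, and 36m + 17 remains.
    upper : 32 * h ≤ (16 * m + 7) * (16 * m + 7) * (c * c)
    upper = *-cancelˡ-≤ (4 * m + 1) {{>-nonZero (m≤n+m 1 (4 * m))}} (begin
      (4 * m + 1) * (32 * (16 ^ m * (b m * b m)))
        ≡⟨ solve 3 (λ x q t → x :* (con 32 :* (t :* q)) := con 32 :* (x :* q :* t)) refl (4 * m + 1) (b m * b m) (16 ^ m) ⟩
      32 * ((4 * m + 1) * (b m * b m) * 16 ^ m)             ≤⟨ *-monoʳ-≤ 32 (increasing m m) ⟩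
      32 * ((4 * (m + m) + 1) * (b (m + m) * b (m + m)))
        ≡⟨ cong (λ z → 32 * ((4 * (m + m) + 1) * (z * z))) b-2m ⟩
      32 * ((4 * (m + m) + 1) * ((2 * m + 1) * c * ((2 * m + 1) * c)))
        ≤⟨ ≤-from-≡ ((36 * m + 17) * (c * c)) (solve 2 (λ m c →
             con 32 :* ((con 4 :* (m :+ m) :+ con 1) :* ((con 2 :* m :+ con 1) :* c :* ((con 2 :* m :+ con 1) :* c)))
               :+ (con 36 :* m :+ con 17) :* (c :* c) :=
             (con 4 :* m :+ con 1) :* ((con 16 :* m :+ con 7) :* (con 16 :* m :+ con 7) :* (c :* c))) refl m c) ⟩
      (4 * m + 1) * ((16 * m + 7) * (16 * m + 7) * (c * c)) ∎)

    private
      lower-2m : A (m + m) * (b (m + m) * b (m + m)) ≤ 2 * A m * h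
      lower-2m = *-cancelʳ-≤ _ _ m (begin
        A (m + m) * (b (m + m) * b (m + m)) * m           ≤⟨ decreasing k m ⟩
        16 ^ m * (m + m) * A m * (b m * b m)
          ≡⟨ solve 4 (λ t m a q → t :* (m :+ m) :* a :* q := con 2 :* a :* (t :* q) :* m) refl (16 ^ m) m (A m) (b m * b m) ⟩
        2 * A m * h * m ∎)

    -- The opposite comparison, from `decreasing`. The term 32c² absorbs the lower-order excess;
    -- divided by 128c² it is the 1/4 of `≤ratio²`.
    lower : (16 * m + 7) * (16 * m + 7) * (c * c) ≤ 32 * h + 32 * (c * c)
    lower = *-cancelˡ-≤ (A m) {{>-nonZero (m≤n+m 1 (32 * (m * m) + 8 * m))}} (begin
      A m * ((16 * m + 7) * (16 * m + 7) * (c * c))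
        -- Expressed in k = m - 1, because in terms of m the remainder 544m² - 40m - 1 has negative
        -- coefficients.
        ≤⟨ ≤-from-≡ ((544 * (k * k) + 1048 * k + 503) * (c * c)) (solve 2 (λ k c → let m = con 1 :+ k in
             (con 32 :* (m :* m) :+ con 8 :* m :+ con 1) :* ((con 16 :* m :+ con 7) :* (con 16 :* m :+ con 7) :* (c :* c))
               :+ (con 544 :* (k :* k) :+ con 1048 :* k :+ con 503) :* (c :* c) :=
             con 16 :* ((con 32 :* ((m :+ m) :* (m :+ m)) :+ con 8 :* (m :+ m) :+ con 1)
               :* ((con 2 :* m :+ con 1) :* c :* ((con 2 :* m :+ con 1) :* c)))
               :+ (con 32 :* (m :* m) :+ con 8 :* m :+ con 1) :* (con 32 :* (c :* c))) refl k c) ⟩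
      16 * (A (m + m) * ((2 * m + 1) * c * ((2 * m + 1) * c))) + A m * (32 * (c * c))
        ≡⟨ cong (λ z → 16 * (A (m + m) * (z * z)) + A m * (32 * (c * c))) b-2m ⟨
      16 * (A (m + m) * (b (m + m) * b (m + m))) + A m * (32 * (c * c))
        ≤⟨ +-monoˡ-≤ (A m * (32 * (c * c))) (*-monoʳ-≤ 16 lower-2m) ⟩
      16 * (2 * A m * h) + A m * (32 * (c * c))
        ≡⟨ solve 3 (λ a h c → con 16 :* (con 2 :* a :* h) :+ a :* c := a :* (con 32 :* h :+ c)) refl (A m) h (32 * (c * c)) ⟩
      A m * (32 * h + 32 * (c * c)) ∎)

open CentralBinomialBounds

-- The closed form in rational numbers, and the limit.

module Limit where

  open import Data.Integer as ℤ using (+_)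
  import Data.Integer.Properties as ℤ
  open import Data.List using (map)
  open import Data.Nat as ℕ using (ℕ; zero; suc; _^_; _∸_; z≤n; _!; s≤s)
  open import Data.Nat.Combinatorics using (_C_)
  open import Data.Nat.ListAction using (sum)
  import Data.Nat.Properties as ℕ
  import Data.Nat.Solver as ℕSolver
  open import Data.Product using (∃-syntax; _×_; _,_; proj₁; proj₂)
  open import Data.Rational
  open import Data.Rational.Properties
  open import Data.Rational.Solver using (module +-*-Solver)
  open import Data.Rational.Unnormalised as ℚᵘ using (ℚᵘ; mkℚᵘ; *≡*; *≤*)
  import Data.Rational.Unnormalised.Properties as ℚᵘ
  open import Data.Sum using (inj₁; inj₂)
  open import Relation.Binary.PropositionalEquality
    using (_≡_; refl; sym; trans; cong; cong₂; subst; subst₂; module ≡-Reasoning)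
  open import Relation.Nullary using (yes; no; contradiction)
  open +-*-Solver
  open ℕSolver.+-*-Solver using () renaming (solve to solveℕ; con to κ; _:*_ to _⊠_; _:=_ to _≔_)

  toℚᵘ-/1 : ∀ n → toℚᵘ (ℕ→ℚ n) ℚᵘ.≃ mkℚᵘ (+ n) 0
  toℚᵘ-/1 n = toℚᵘ-fromℚᵘ (mkℚᵘ (+ n) 0)

  ℕ→ℚ-+ : ∀ m n → ℕ→ℚ (m ℕ.+ n) ≡ ℕ→ℚ m + ℕ→ℚ n
  ℕ→ℚ-+ m n = toℚᵘ-injective (ℚᵘ.≃-trans (toℚᵘ-/1 (m ℕ.+ n)) (ℚᵘ.≃-trans
    (*≡* (cong (ℤ._* + 1) (trans (ℤ.pos-+ m n) (sym (cong₂ ℤ._+_ (ℤ.*-identityʳ (+ m)) (ℤ.*-identityʳ (+ n)))))))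
    (ℚᵘ.≃-sym (ℚᵘ.≃-trans (toℚᵘ-homo-+ (ℕ→ℚ m) (ℕ→ℚ n)) (ℚᵘ.+-cong (toℚᵘ-/1 m) (toℚᵘ-/1 n))))))

  ℕ→ℚ-* : ∀ m n → ℕ→ℚ (m ℕ.* n) ≡ ℕ→ℚ m * ℕ→ℚ n
  ℕ→ℚ-* m n = toℚᵘ-injective (ℚᵘ.≃-trans (toℚᵘ-/1 (m ℕ.* n)) (ℚᵘ.≃-trans
    (*≡* (cong (ℤ._* + 1) (ℤ.pos-* m n)))
    (ℚᵘ.≃-sym (ℚᵘ.≃-trans (toℚᵘ-homo-* (ℕ→ℚ m) (ℕ→ℚ n)) (ℚᵘ.*-cong (toℚᵘ-/1 m) (toℚᵘ-/1 n))))))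

  ℕ→ℚ-mono-≤ : ∀ {m n} → m ℕ.≤ n → ℕ→ℚ m ≤ ℕ→ℚ n
  ℕ→ℚ-mono-≤ {m} {n} h = toℚᵘ-cancel-≤ (ℚᵘ.≤-respˡ-≃ (ℚᵘ.≃-sym (toℚᵘ-/1 m)) (ℚᵘ.≤-respʳ-≃ (ℚᵘ.≃-sym (toℚᵘ-/1 n))
    (*≤* (ℤ.*-monoʳ-≤-nonNeg (+ 1) (ℤ.+≤+ h)))))

  /-≡-ℕ→ℚ : ∀ c d .{{_ : ℕ.NonZero d}} → + (c ℕ.* d) / d ≡ ℕ→ℚ c
  /-≡-ℕ→ℚ c (suc d) = toℚᵘ-injective (ℚᵘ.≃-trans (toℚᵘ-fromℚᵘ (mkℚᵘ (+ (c ℕ.* suc d)) d))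
    (ℚᵘ.≃-trans (*≡* (trans (ℤ.*-identityʳ _) (ℤ.pos-* c (suc d)))) (ℚᵘ.≃-sym (toℚᵘ-/1 c))))

  Cat-catalan : ∀ n → Cat n ≡ ℕ→ℚ (catalan n)
  Cat-catalan n = trans (/-congˡ′ (sym (catalan-factorial n))) (/-≡-ℕ→ℚ (catalan n) (n ! ℕ.* suc n !) {{nz}})
    where
    nz : ℕ.NonZero (n ! ℕ.* suc n !)
    nz = ℕ.m*n≢0 (n !) (suc n !) {{n ℕ.!≢0}} {{suc n ℕ.!≢0}}
    /-congˡ′ : ∀ {p q} → p ≡ q → (+ p / (n ! ℕ.* suc n !)) {{nz}} ≡ (+ q / (n ! ℕ.* suc n !)) {{nz}}
    /-congˡ′ refl = refl

  ÷Cat-* : ∀ q n → (q ÷Cat n) * ℕ→ℚ (catalan n) ≡ q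
  ÷Cat-* q n = trans (cong ((q ÷Cat n) *_) (sym (Cat-catalan n)))
    (trans (*-assoc q _ (Cat n)) (trans (cong (q *_) (*-inverseˡ (Cat n) {{Cat-nonZero n}})) (*-identityʳ q)))

  numerator : ℕ → ℕ
  numerator m = 2 ^ (2 ℕ.* m ∸ 1) ℕ.* ((2 ℕ.* m) C m)

  2*numerator : ∀ k → let m = suc k in 2 ℕ.* numerator m ≡ 4 ^ m ℕ.* centralBinomial m
  2*numerator k = trans (sym (ℕ.*-assoc 2 (2 ^ (2 ℕ.* m ∸ 1)) (centralBinomial m)))
    (cong (ℕ._* centralBinomial m) (sym (ℕ.^-*-assoc 2 2 m)))
    where
    m : ℕ
    m = suc k

  ratio : ℕ → ℚ
  ratio m = ℕ→ℚ (numerator m) ÷Cat (2 ℕ.* m)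

  mean-distance : ∀ k → let m = suc k in d̃₂ m ≡ ratio m - (+ 3 / 2)
  mean-distance k = begin
    S * inv                                   ≡⟨ cong (_* inv) S≡ ⟩
    (Q - (+ 3 / 2) * c) * inv
      ≡⟨ solve 3 (λ q c i → (q :- con (+ 3 / 2) :* c) :* i := q :* i :- con (+ 3 / 2) :* (c :* i)) refl Q c inv ⟩
    Q * inv - (+ 3 / 2) * (c * inv)           ≡⟨ cong (λ z → Q * inv - (+ 3 / 2) * z) c*inv ⟩
    Q * inv - (+ 3 / 2) * 1ℚ                  ≡⟨⟩
    Q * inv - (+ 3 / 2)                       ∎
    where
    open ≡-Reasoning
    m s : ℕ
    m = suc k
    s = sum (map (d-H (λ₂ m)) (allNC (2 ℕ.* m)))
    S Q c inv : ℚ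
    S = ℕ→ℚ s
    Q = ℕ→ℚ (numerator m)
    c = ℕ→ℚ (catalan (2 ℕ.* m))
    inv = (1/ Cat (2 ℕ.* m)) {{Cat-nonZero (2 ℕ.* m)}}
    c*inv : c * inv ≡ 1ℚ
    c*inv = trans (cong (_* inv) (sym (Cat-catalan (2 ℕ.* m)))) (*-inverseʳ (Cat (2 ℕ.* m)) {{Cat-nonZero (2 ℕ.* m)}})
    2S+3c : ℕ→ℚ 2 * S + ℕ→ℚ 3 * c ≡ ℕ→ℚ 2 * Q
    2S+3c = trans (sym (trans (ℕ→ℚ-+ (2 ℕ.* s) _) (cong₂ _+_ (ℕ→ℚ-* 2 s) (ℕ→ℚ-* 3 (catalan (2 ℕ.* m))))))
      (trans (cong ℕ→ℚ (trans (distance-sum k) (sym (2*numerator k)))) (ℕ→ℚ-* 2 (numerator m)))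
    S≡ : S ≡ Q - (+ 3 / 2) * c
    S≡ = begin
      S
        ≡⟨ solve 2 (λ s c → s := con ½ :* (con (+ 2 / 1) :* s :+ con (+ 3 / 1) :* c) :- con (+ 3 / 2) :* c) refl S c ⟩
      ½ * (ℕ→ℚ 2 * S + ℕ→ℚ 3 * c) - (+ 3 / 2) * c ≡⟨ cong (λ z → ½ * z - (+ 3 / 2) * c) 2S+3c ⟩
      ½ * (ℕ→ℚ 2 * Q) - (+ 3 / 2) * c
        ≡⟨ solve 2 (λ q c → con ½ :* (con (+ 2 / 1) :* q) :- con (+ 3 / 2) :* c := q :- con (+ 3 / 2) :* c) refl Q c ⟩
      Q - (+ 3 / 2) * c                         ∎

  ≤-by : ∀ {x y} t → 0ℚ ≤ t → y ≡ x + t → x ≤ y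
  ≤-by {x} t h refl = subst (_≤ x + t) (+-identityʳ x) (+-monoʳ-≤ x h)

  ≤⇒0≤- : ∀ {x y} → x ≤ y → 0ℚ ≤ y - x
  ≤⇒0≤- {x} {y} h = subst (_≤ y - x) (+-inverseʳ x) (+-monoˡ-≤ (- x) h)

  0≤+ : ∀ {x y} → 0ℚ ≤ x → 0ℚ ≤ y → 0ℚ ≤ x + y
  0≤+ {x} {y} p q = subst (_≤ x + y) (+-identityʳ 0ℚ) (+-mono-≤ p q)

  0≤* : ∀ {x y} → 0ℚ ≤ x → 0ℚ ≤ y → 0ℚ ≤ x * y
  0≤* {x} {y} p q = subst (_≤ x * y) (*-zeroʳ x) (*-monoˡ-≤-nonNeg x {{nonNegative p}} q)

  square-cancel : ∀ {x y} → 0ℚ ≤ y → x * x ≤ y * y → x ≤ y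
  square-cancel {x} {y} 0≤y h with x ≤? y
  ... | yes p = p
  ... | no ¬p = contradiction refl (<⇒≢ (<-≤-trans (≤-<-trans (*-monoˡ-≤-nonNeg y {{nonNegative 0≤y}} (<⇒≤ y<x))
                  (*-monoˡ-<-pos x {{positive (≤-<-trans 0≤y y<x)}} y<x)) h))
    where
    y<x : y < x
    y<x = ≰⇒> ¬p

  shifted : ℕ → ℚ
  shifted m = ℕ→ℚ m + (+ 7 / 16)

  module _ (k : ℕ) where

    private
      m c n h t : ℕ
      m = suc k
      h = 32 ℕ.* (16 ^ m ℕ.* (centralBinomial m ℕ.* centralBinomial m))
      t = 16 ℕ.* m ℕ.+ 7
      c = catalan (2 ℕ.* m)
      n = numerator m
      a s cℚ : ℚ
      a = ratio m
      s = shifted m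
      cℚ = ℕ→ℚ c

      a*c : a * cℚ ≡ ℕ→ℚ n
      a*c = ÷Cat-* (ℕ→ℚ n) (2 ℕ.* m)

      4n² : 4 ℕ.* (n ℕ.* n) ≡ 16 ^ m ℕ.* (centralBinomial m ℕ.* centralBinomial m)
      4n² = trans (solveℕ 1 (λ n → κ 4 ⊠ (n ⊠ n) ≔ (κ 2 ⊠ n) ⊠ (κ 2 ⊠ n)) refl n)
        (trans (cong (λ z → z ℕ.* z) (2*numerator k))
          (trans (solveℕ 2 (λ p b → p ⊠ b ⊠ (p ⊠ b) ≔ p ⊠ p ⊠ (b ⊠ b)) refl (4 ^ m) (centralBinomial m))
            (cong (ℕ._* (centralBinomial m ℕ.* centralBinomial m)) (4^*4^ m))))
        where
        4^*4^ : ∀ i → 4 ^ i ℕ.* 4 ^ i ≡ 16 ^ i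
        4^*4^ zero    = refl
        4^*4^ (suc i) = trans (solveℕ 1 (λ p → κ 4 ⊠ p ⊠ (κ 4 ⊠ p) ≔ κ 16 ⊠ (p ⊠ p)) refl (4 ^ i))
          (cong (16 ℕ.*_) (4^*4^ i))

      positive-c : Positive cℚ
      positive-c = subst Positive (Cat-catalan (2 ℕ.* m))
        (normalize-pos ((2 ℕ.* (2 ℕ.* m)) !) ((2 ℕ.* m) ! ℕ.* suc (2 ℕ.* m) !)
          {{ℕ.m*n≢0 ((2 ℕ.* m) !) (suc (2 ℕ.* m) !) {{(2 ℕ.* m) ℕ.!≢0}} {{suc (2 ℕ.* m) ℕ.!≢0}}}} {{(2 ℕ.* (2 ℕ.* m)) ℕ.!≢0}})

      positive-c² : Positive (cℚ * cℚ)
      positive-c² = pos*pos⇒pos cℚ {{positive-c}} cℚ {{positive-c}}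

      128n² : ℕ→ℚ (32 ℕ.* (16 ^ m ℕ.* (centralBinomial m ℕ.* centralBinomial m))) ≡ (+ 128 / 1) * (a * a) * (cℚ * cℚ)
      128n² = begin
        ℕ→ℚ (32 ℕ.* (16 ^ m ℕ.* (centralBinomial m ℕ.* centralBinomial m)))
          ≡⟨ cong (λ z → ℕ→ℚ (32 ℕ.* z)) 4n² ⟨
        ℕ→ℚ (32 ℕ.* (4 ℕ.* (n ℕ.* n)))       ≡⟨ cong ℕ→ℚ (sym (ℕ.*-assoc 32 4 (n ℕ.* n))) ⟩
        ℕ→ℚ (128 ℕ.* (n ℕ.* n))              ≡⟨ trans (ℕ→ℚ-* 128 (n ℕ.* n)) (cong ((+ 128 / 1) *_) (ℕ→ℚ-* n n)) ⟩
        (+ 128 / 1) * (ℕ→ℚ n * ℕ→ℚ n)        ≡⟨ cong (λ z → (+ 128 / 1) * (z * z)) a*c ⟨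
        (+ 128 / 1) * (a * cℚ * (a * cℚ))
          ≡⟨ solve 2 (λ a c → con (+ 128 / 1) :* (a :* c :* (a :* c)) := con (+ 128 / 1) :* (a :* a) :* (c :* c)) refl a cℚ ⟩
        (+ 128 / 1) * (a * a) * (cℚ * cℚ)    ∎
        where open ≡-Reasoning

      256s² : ℕ→ℚ ((16 ℕ.* m ℕ.+ 7) ℕ.* (16 ℕ.* m ℕ.+ 7) ℕ.* (c ℕ.* c)) ≡ (+ 256 / 1) * (s * s) * (cℚ * cℚ)
      256s² = begin
        ℕ→ℚ ((16 ℕ.* m ℕ.+ 7) ℕ.* (16 ℕ.* m ℕ.+ 7) ℕ.* (c ℕ.* c))
          ≡⟨ trans (ℕ→ℚ-* (t ℕ.* t) (c ℕ.* c)) (cong₂ _*_ (ℕ→ℚ-* (16 ℕ.* m ℕ.+ 7) (16 ℕ.* m ℕ.+ 7)) (ℕ→ℚ-* c c)) ⟩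
        ℕ→ℚ (16 ℕ.* m ℕ.+ 7) * ℕ→ℚ (16 ℕ.* m ℕ.+ 7) * (cℚ * cℚ)
          ≡⟨ cong (λ z → z * z * (cℚ * cℚ)) (trans (ℕ→ℚ-+ (16 ℕ.* m) 7) (cong (_+ (+ 7 / 1)) (ℕ→ℚ-* 16 m))) ⟩
        ((+ 16 / 1) * ℕ→ℚ m + (+ 7 / 1)) * ((+ 16 / 1) * ℕ→ℚ m + (+ 7 / 1)) * (cℚ * cℚ)
          ≡⟨ solve 2 (λ m c → (con (+ 16 / 1) :* m :+ con (+ 7 / 1)) :* (con (+ 16 / 1) :* m :+ con (+ 7 / 1)) :* c :=
               con (+ 256 / 1) :* ((m :+ con (+ 7 / 16)) :* (m :+ con (+ 7 / 16))) :* c) refl (ℕ→ℚ m) (cℚ * cℚ) ⟩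
        (+ 256 / 1) * (s * s) * (cℚ * cℚ) ∎
        where open ≡-Reasoning

    0≤ratio : 0ℚ ≤ a
    0≤ratio = *-cancelʳ-≤-pos cℚ {{positive-c}} (subst₂ _≤_ (sym (*-zeroˡ cℚ)) (sym a*c) (ℕ→ℚ-mono-≤ {0} {n} z≤n))

    ratio²≤ : a * a ≤ (+ 2 / 1) * (s * s)
    ratio²≤ = *-cancelˡ-≤-pos (+ 128 / 1) (subst ((+ 128 / 1) * (a * a) ≤_)
      (solve 1 (λ s → con (+ 256 / 1) :* s := con (+ 128 / 1) :* (con (+ 2 / 1) :* s)) refl (s * s))
      (*-cancelʳ-≤-pos (cℚ * cℚ) {{positive-c²}} (subst₂ _≤_ 128n² 256s² (ℕ→ℚ-mono-≤ {h} {t ℕ.* t ℕ.* (c ℕ.* c)} (upper k)))))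

    ≤ratio² : (+ 2 / 1) * (s * s) ≤ a * a + (+ 1 / 4)
    ≤ratio² = *-cancelˡ-≤-pos (+ 128 / 1) (subst₂ _≤_
      (solve 1 (λ s → con (+ 256 / 1) :* s := con (+ 128 / 1) :* (con (+ 2 / 1) :* s)) refl (s * s))
      (solve 1 (λ a → con (+ 128 / 1) :* a :+ con (+ 32 / 1) := con (+ 128 / 1) :* (a :+ con (+ 1 / 4))) refl (a * a))
      (*-cancelʳ-≤-pos (cℚ * cℚ) {{positive-c²}} (subst₂ _≤_ 256s²
        (trans (ℕ→ℚ-+ h (32 ℕ.* (c ℕ.* c))) (trans (cong₂ _+_ 128n² (trans (ℕ→ℚ-* 32 (c ℕ.* c)) (cong ((+ 32 / 1) *_) (ℕ→ℚ-* c c))))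
          (sym (*-distribʳ-+ (cℚ * cℚ) ((+ 128 / 1) * (a * a)) (+ 32 / 1)))))
        (ℕ→ℚ-mono-≤ {t ℕ.* t ℕ.* (c ℕ.* c)} {h ℕ.+ 32 ℕ.* (c ℕ.* c)} (lower k)))))

  archimedean : ∀ τ → 0ℚ < τ → ∃[ N ] (∀ n → N ℕ.≤ n → 1ℚ ≤ τ * ℕ→ℚ n)
  archimedean τ@(mkℚ (+ zero) d _)  (*<* (ℤ.+<+ ()))
  archimedean τ@(mkℚ (+ suc p) d _) τ>0 = suc d , λ n h → toℚᵘ-cancel-≤
    (ℚᵘ.≤-respʳ-≃ (ℚᵘ.≃-sym (ℚᵘ.≃-trans (toℚᵘ-homo-* τ (ℕ→ℚ n)) (ℚᵘ.*-congˡ {toℚᵘ τ} (toℚᵘ-/1 n))))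
      (*≤* (subst₂ ℤ._≤_ (sym (ℤ.*-identityˡ _)) (sym (trans (ℤ.*-identityʳ _) (sym (ℤ.pos-* (suc p) n))))
        (ℤ.+≤+ (subst (ℕ._≤ suc p ℕ.* n) (sym (ℕ.*-identityʳ (suc d))) (ℕ.≤-trans h (ℕ.m≤m+n n (p ℕ.* n))))))))

  p≤∣p∣ : ∀ p → p ≤ ∣ p ∣
  p≤∣p∣ p with ∣p∣≡p∨∣p∣≡-p p
  ... | inj₁ e = ≤-reflexive (sym e)
  ... | inj₂ e = ≤-by (∣ p ∣ + ∣ p ∣) (0≤+ (0≤∣p∣ p) (0≤∣p∣ p))
    (trans (solve 2 (λ p q → q := p :+ (:- p :+ q)) refl p ∣ p ∣) (cong (λ z → p + (z + ∣ p ∣)) (sym e)))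

  ∣∣-lub : ∀ {p r} → p ≤ r → - p ≤ r → ∣ p ∣ ≤ r
  ∣∣-lub {p} {r} h g with ∣p∣≡p∨∣p∣≡-p p
  ... | inj₁ e = subst (_≤ r) (sym e) h
  ... | inj₂ e = subst (_≤ r) (sym e) g

  -- Both bounds are phrased as non-negative quantities since they occur as summands in the
  -- certificates of `square-roots-close`.
  √2²-near-2 : ∀ η → 0ℚ < η → ∃[ N ] (∀ n → N ℕ.≤ n →
    let r = seq √2 n in 0ℚ ≤ r * r - (+ 2 / 1) + η × 0ℚ ≤ (+ 2 / 1) + η - r * r)
  √2²-near-2 η η>0 = let N , f = √2*√2≃2 η η>0 in N , λ n h → let r² = seq √2 n * seq √2 n in
      subst (0ℚ ≤_) (solve 2 (λ x η → η :- (:- (x :- con (+ 2 / 1))) := x :- con (+ 2 / 1) :+ η) refl r² η)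
        (≤⇒0≤- (≤-trans (subst (- (r² - (+ 2 / 1)) ≤_) (∣-p∣≡∣p∣ (r² - (+ 2 / 1))) (p≤∣p∣ (- (r² - (+ 2 / 1))))) (<⇒≤ (f n h))))
    , subst (0ℚ ≤_) (solve 2 (λ x η → η :- (x :- con (+ 2 / 1)) := con (+ 2 / 1) :+ η :- x) refl r² η)
        (≤⇒0≤- (≤-trans (p≤∣p∣ (r² - (+ 2 / 1))) (<⇒≤ (f n h))))

  -- Squares are compared. Exchanging r² for 2 costs at most ηs² = τs. In the bound for a, the cross
  -- term 2τrs pays for it because r ≥ 1. In the bound for rs the further cost 1/4 is below τs, and
  -- the cross term 2τa pays for both because a ≥ s.
  square-roots-close : ∀ {a s r τ η} → 0ℚ ≤ a → 1ℚ ≤ s → 1ℚ ≤ r → 0ℚ ≤ τ → 1ℚ ≤ τ * s → η * s ≡ τ →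
    0ℚ ≤ r * r - (+ 2 / 1) + η → 0ℚ ≤ (+ 2 / 1) + η - r * r →
    a * a ≤ (+ 2 / 1) * (s * s) → (+ 2 / 1) * (s * s) ≤ a * a + (+ 1 / 4) → ∣ a - r * s ∣ ≤ τ
  square-roots-close {a} {s} {r} {τ} {η} 0≤a 1≤s 1≤r 0≤τ 1≤τs refl near⁻ near⁺ a²≤ ≤a² = ∣∣-lub
    (≤-by (r * s + τ - a) (≤⇒0≤- a≤) (solve 3 (λ a q t → t := a :- q :+ (q :+ t :- a)) refl a (r * s) τ))
    (≤-by (a + τ - r * s) (≤⇒0≤- rs≤) (solve 3 (λ a q t → t := :- (a :- q) :+ (a :+ t :- q)) refl a (r * s) τ))
    where
    0≤1 : 0ℚ ≤ 1ℚ
    0≤1 = nonNegative⁻¹ 1ℚ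
    0≤s : 0ℚ ≤ s
    0≤s = ≤-trans 0≤1 1≤s
    0≤r : 0ℚ ≤ r
    0≤r = ≤-trans 0≤1 1≤r
    a≤ : a ≤ r * s + τ
    a≤ = square-cancel (0≤+ (0≤* 0≤r 0≤s) 0≤τ) (≤-by _
      (0≤+ (0≤+ (0≤+ (≤⇒0≤- a²≤) (0≤* (0≤* 0≤s near⁻) 0≤s))
        (0≤* (0≤* 0≤τ 0≤s) (0≤+ (≤⇒0≤- 1≤r) 0≤r))) (0≤* 0≤τ 0≤τ))
      (solve 4 (λ a s r η → let t = η :* s in
        (r :* s :+ t) :* (r :* s :+ t) := a :* a :+ ((con (+ 2 / 1) :* (s :* s) :- a :* a)
        :+ s :* (r :* r :- con (+ 2 / 1) :+ η) :* s :+ t :* s :* (r :- con 1ℚ :+ r) :+ t :* t)) refl a s r η))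
    -- From a² ≥ 2s² - 1/4 and s ≥ 1.
    s≤a : s ≤ a
    s≤a = square-cancel 0≤a (≤-by _
      (0≤+ (≤⇒0≤- ≤a²) (0≤+ (0≤* (≤⇒0≤- 1≤s) (0≤+ 0≤s 0≤1)) (nonNegative⁻¹ (+ 3 / 4))))
      (solve 2 (λ a s → a :* a := s :* s :+ (a :* a :+ con (+ 1 / 4) :- con (+ 2 / 1) :* (s :* s)
        :+ ((s :- con 1ℚ) :* (s :+ con 1ℚ) :+ con (+ 3 / 4)))) refl a s))
    rs≤ : r * s ≤ a + τ
    rs≤ = square-cancel (0≤+ 0≤a 0≤τ) (≤-by _
      (0≤+ (0≤+ (0≤+ (0≤+ (≤⇒0≤- ≤a²) (0≤* (0≤* 0≤s near⁺) 0≤s))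
        (0≤* (0≤* (nonNegative⁻¹ (+ 2 / 1)) 0≤τ) (≤⇒0≤- s≤a)))
        (0≤+ (≤⇒0≤- 1≤τs) (nonNegative⁻¹ (+ 3 / 4)))) (0≤* 0≤τ 0≤τ))
      (solve 4 (λ a s r η → let t = η :* s in
        (a :+ t) :* (a :+ t) := r :* s :* (r :* s) :+ ((a :* a :+ con (+ 1 / 4) :- con (+ 2 / 1) :* (s :* s))
        :+ s :* (con (+ 2 / 1) :+ η :- r :* r) :* s :+ con (+ 2 / 1) :* t :* (a :- s)
        :+ (t :* s :- con 1ℚ :+ con (+ 3 / 4)) :+ t :* t)) refl a s r η))

  mean-distance-limit : (λ m → fromℚ (d̃₂ m) -ᴿ √2 *ᴿ fromℚ (ℕ→ℚ m)) ⟶ fromℚ (+ 7 / 16) *ᴿ √2 -ᴿ fromℚ (+ 3 / 2)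
  -- The successor excludes m = 0, which `mean-distance` does not cover.
  mean-distance-limit ε (δ , δ>0 , N₀ , ε-large) = suc (proj₁ arch) , λ { (suc k) h → eventually k (ℕ.≤-trans (ℕ.n≤1+n _) h) }
    where
    τ : ℚ
    -- One half bounds the difference, the other is the margin that `_<ᴿ_` demands.
    τ = ½ * δ
    τ>0 : 0ℚ < τ
    τ>0 = subst (_< τ) (*-zeroʳ ½) (*-monoʳ-<-pos ½ δ>0)
    arch : ∃[ N ] (∀ n → N ℕ.≤ n → 1ℚ ≤ τ * ℕ→ℚ n)
    arch = archimedean τ τ>0
    eventually : ∀ k → proj₁ arch ℕ.≤ suc k →
         ∣ (fromℚ (d̃₂ (suc k)) -ᴿ √2 *ᴿ fromℚ (ℕ→ℚ (suc k))) -ᴿ (fromℚ (+ 7 / 16) *ᴿ √2 -ᴿ fromℚ (+ 3 / 2)) ∣ᴿ <ᴿ ε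
    eventually k h = τ , τ>0 , N₀ ℕ.⊔ (N₁ ℕ.⊔ N₂) , λ j hj →
      let r = seq √2 j
          hj₀ = ℕ.m⊔n≤o⇒m≤o N₀ (N₁ ℕ.⊔ N₂) hj
          hj₁ = ℕ.m⊔n≤o⇒m≤o N₁ N₂ (ℕ.m⊔n≤o⇒n≤o N₀ (N₁ ℕ.⊔ N₂) hj)
          hj₂ = ℕ.m⊔n≤o⇒n≤o N₁ N₂ (ℕ.m⊔n≤o⇒n≤o N₀ (N₁ ℕ.⊔ N₂) hj)
          near⁻ , near⁺ = near η η>0 j hj₁
          -- Accuracy 1 already gives r² ≥ 2 - 1.
          1≤r = square-cancel (√2-nonNeg j) (≤-by _ (proj₁ (near 1ℚ (positive⁻¹ 1ℚ) j hj₂))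
            (solve 1 (λ r → r :* r := con 1ℚ :* con 1ℚ :+ (r :* r :- con (+ 2 / 1) :+ con 1ℚ)) refl r))
      in ≤-trans (+-monoˡ-≤ τ (subst (λ z → ∣ z ∣ ≤ τ) (sym (rewrite-difference r))
           (square-roots-close (0≤ratio k) 1≤s 1≤r (<⇒≤ τ>0) 1≤τs η*s near⁻ near⁺ (ratio²≤ k) (≤ratio² k))))
         (subst (_≤ seq ε j) (solve 1 (λ d → con 0ℚ :+ d := con ½ :* d :+ con ½ :* d) refl δ) (ε-large j hj₀))
      where
      s : ℚ
      s = shifted (suc k)
      1≤s : 1ℚ ≤ s
      1≤s = subst (_≤ s) (+-identityʳ 1ℚ) (+-mono-≤ (ℕ→ℚ-mono-≤ {1} {suc k} (s≤s z≤n)) (nonNegative⁻¹ (+ 7 / 16)))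
      instance
        s-pos : Positive s
        s-pos = positive (<-≤-trans (positive⁻¹ 1ℚ) 1≤s)
        s-nonZero : NonZero s
        s-nonZero = pos⇒nonZero s
      η : ℚ
      -- The approximation to √2 gets multiplied by `s`, which grows with m, so its square must be
      -- accurate to τ/s; the index from which this holds depends on `k`.
      η = τ * 1/ s
      η>0 : 0ℚ < η
      η>0 = subst (_< η) (*-zeroˡ (1/ s)) (*-monoˡ-<-pos (1/ s) {{1/pos⇒pos s}} τ>0)
      η*s : η * s ≡ τ
      η*s = trans (*-assoc τ (1/ s) s) (trans (cong (τ *_) (*-inverseˡ s)) (*-identityʳ τ))
      1≤τs : 1ℚ ≤ τ * s
      1≤τs = ≤-trans (proj₂ arch (suc k) h) (*-monoˡ-≤-nonNeg τ {{nonNegative (<⇒≤ τ>0)}}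
        (subst (_≤ s) (+-identityʳ _) (+-monoʳ-≤ (ℕ→ℚ (suc k)) (nonNegative⁻¹ (+ 7 / 16)))))
      near : ∀ η → (η>0 : 0ℚ < η) → ∀ n → proj₁ (√2²-near-2 η η>0) ℕ.≤ n →
             let r = seq √2 n in 0ℚ ≤ r * r - (+ 2 / 1) + η × 0ℚ ≤ (+ 2 / 1) + η - r * r
      near η η>0 = proj₂ (√2²-near-2 η η>0)
      N₁ N₂ : ℕ
      N₁ = proj₁ (√2²-near-2 η η>0)
      N₂ = proj₁ (√2²-near-2 1ℚ (positive⁻¹ 1ℚ))
      rewrite-difference : ∀ r → (d̃₂ (suc k) + - (r * ℕ→ℚ (suc k))) + - ((+ 7 / 16) * r + - (+ 3 / 2)) ≡ ratio (suc k) - r * s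
      rewrite-difference r = trans (cong (λ d → (d + - (r * ℕ→ℚ (suc k))) + - ((+ 7 / 16) * r + - (+ 3 / 2))) (mean-distance k))
        (solve 3 (λ a r m → (a :- con (+ 3 / 2) :+ :- (r :* m)) :+ :- (con (+ 7 / 16) :* r :+ :- con (+ 3 / 2)) :=
          a :- r :* (m :+ con (+ 7 / 16))) refl (ratio (suc k)) r (ℕ→ℚ (suc k)))

open Limit

open import Data.Integer using (+_)
open import Data.Nat using (ℕ; NonZero; suc; _*_; _∸_; _^_)
open import Data.Nat.Combinatorics using (_C_)
open import Data.Product using (_×_; _,_)
open import Data.Rational using (_-_; _/_)
open import Relation.Binary.PropositionalEquality using (_≡_)

proposition1p8 : (∀ m .{{_ : NonZero m}} →
    d̃₂ m ≡ ℕ→ℚ (2 ^ (2 * m ∸ 1) * ((2 * m) C m)) ÷Cat (2 * m) - (+ 3 / 2))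
    × ((λ m → fromℚ (d̃₂ m) -ᴿ √2 *ᴿ fromℚ (ℕ→ℚ m))
    ⟶ fromℚ (+ 7 / 16) *ᴿ √2 -ᴿ fromℚ (+ 3 / 2))
proposition1p8 = (λ { (suc k) → mean-distance k }) , mean-distance-limit
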